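{- For every $\epsilon\in(0,0.25)$ there exist absolute constants $C_1,C_2>0$ such that for every finite simple graph $G$ with $n$ vertices and minimum degree $\delta>0$ which contains no isolated edge, \[ s(G)\le \frac{n}{\delta}\left(1+\frac{C_1}{\delta^{\epsilon}}\right)+C_2 . \]
   Context: For a finite simple graph $G$ and a positive integer $k$, a weighting $f:E(G)\to\{1,2,\dots,k\}$ is called $k$-irregular if the weighted degrees $\tilde f(v)=\sum_{u:\{u,v\}\in E(G)} f(\{u,v\})$ are pairwise distinct over all $v\in V(G)$. The irregularity strength $s(G)$ is the least positive integer $k$ for which a $k$-irregular weighting of $G$ exists (and $s(G)=\infty$ if none exists). An isolated edge is a connected component of $G$ consisting of a single edge. -}

module Defs where

open import Data.Nat as ℕ using (ℕ; zero; suc; _≤_; _<_)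
open import Data.Bool using (Bool; true; false; if_then_else_)
open import Data.Fin using (Fin)
open import Data.List using (List; map; allFin)
open import Data.Nat.ListAction using (sum)
import Data.Integer as ℤ
open import Data.Product using (Σ; _×_; _,_; ∃; ∃-syntax)
open import Relation.Binary.PropositionalEquality using (_≡_)
open import Relation.Nullary using (¬_)
open import Function.Definitions using (Injective)
import Data.Rational as ℚ
open ℚ using (ℚ)

record Graph (n : ℕ) : Set where
  field
    adj   : Fin n → Fin n → Bool
    sym   : ∀ i j → adj i j ≡ adj j i
    irref : ∀ i → adj i i ≡ false
open Graph public

deg : ∀ {n} → Graph n → Fin n → ℕ
deg G i = sum (map (λ j → if adj G i j then 1 else 0) (allFin _))

IsMinDegree : ∀ {n} → Graph n → ℕ → Set
IsMinDegree G δ = (∀ i → δ ≤ deg G i) × (∃[ i ] deg G i ≡ δ)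

NoIsolatedEdge : ∀ {n} → Graph n → Set
NoIsolatedEdge G = ∀ u v → adj G u v ≡ true → ¬ (deg G u ≡ 1 × deg G v ≡ 1)

-- An edge weighting is represented by a symmetric function on pairs of
-- vertices; only its values on edges matter.  It is a weighting with
-- values in {1,…,k} if every edge gets a weight in [1,k].
record Weighting {n} (G : Graph n) (k : ℕ) : Set where
  field
    w      : Fin n → Fin n → ℕ
    w-sym  : ∀ i j → w i j ≡ w j i
    w-low  : ∀ i j → adj G i j ≡ true → 1 ≤ w i j
    w-high : ∀ i j → adj G i j ≡ true → w i j ≤ k
open Weighting public

wdeg : ∀ {n} {G : Graph n} {k} → Weighting G k → Fin n → ℕ
wdeg {G = G} f i = sum (map (λ j → if adj G i j then w f i j else 0) (allFin _))

Irregular : ∀ {n} → Graph n → ℕ → Set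
Irregular G k = Σ (Weighting G k) λ f → Injective _≡_ _≡_ (wdeg f)

nℚ : ℕ → ℚ
nℚ m = ℤ.+ m ℚ./ 1

_^ℚ_ : ℚ → ℕ → ℚ
x ^ℚ zero  = ℚ.1ℚ
x ^ℚ suc m = x ℚ.* (x ^ℚ m)

-- For ε = p/q (q > 0), δ > 0 and r ≥ 0 rational:
-- r ≥ δ^(-ε)  ⇔  r^q · δ^p ≥ 1.
UpperBoundOfNegPow : ℕ → ℕ → ℕ → ℚ → Set
UpperBoundOfNegPow δ p q r =
  (ℚ.0ℚ ℚ.≤ r) × (ℚ.1ℚ ℚ.≤ (r ^ℚ q) ℚ.* ((nℚ δ) ^ℚ p))

-- The bound  k ≤ (n/δ)(1 + C₁ δ^(-p/q)) + C₂  (δ > 0), written after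
-- multiplying by δ, and with the irrational quantity t = δ^(-p/q) handled
-- exactly: since the right-hand side is increasing in t, it holds iff it
-- holds with t replaced by every rational r ≥ t.
Bound : (n δ p q : ℕ) (C₁ C₂ : ℚ) (k : ℕ) → Set
Bound n δ p q C₁ C₂ k =
  ∀ r → UpperBoundOfNegPow δ p q r →
    nℚ δ ℚ.* nℚ k
      ℚ.≤ (nℚ n) ℚ.* (ℚ.1ℚ ℚ.+ C₁ ℚ.* r) ℚ.+ C₂ ℚ.* (nℚ δ)

-- s(G) ≤ X  ⇔  there is a k-irregular weighting for some positive k ≤ X.

-- Put K = 3s ≈ n/δ (1 + O(δ^(-ε))) and M ≈ δ^ε.  Give every vertex a random level e, and let
-- an edge have weight 1 + K if its levels add up to at least T₀ and weight 1 otherwise; then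
-- the weighted degree of v is close to deg v (1 + K e/T₀), so these values are spread almost
-- evenly.  Two random sets P ⊂ R of densities about M^(-2) and M^(-1) are kept in reserve.
-- A vertex v outside R is moved, along its edges to P, to its own target value outside the
-- residues below 4s modulo M s; this absorbs the deviation of order √δ because P has
-- about δ/M² ≫ √δ vertices near v, which is where ε < 1/4 enters.  The vertices of R are
-- then given values in the free residues, greedily along edges inside R: v has about δ/M²
-- candidate windows, and few vertices of R compete for them because the levels spread R as
-- well.  The few vertices violating a concentration bound join R, so that neither a union
-- bound over all vertices nor the local lemma is needed.  The random choice is
-- derandomised by the method of conditional expectations.  For bounded δ the greedy stage
-- alone gives a strength linear in n.
module Submission where

open import Defs hiding (w) renaming (sym to adj-sym)
open import Data.Nat
open import Data.Nat.Properties
open import Data.Nat.DivMod using (_/_; _%_; m≡m%n+[m/n]*n; m%n<n; m/n*n≤m; m*n/n≡m; /-monoˡ-≤)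
open import Data.Nat.ListAction using (sum)
open import Data.Nat.Tactic.RingSolver using (solve-∀)
open import Data.Bool using (Bool; true; false; if_then_else_; _∧_; _∨_; not) renaming (T to Tᵇ)
open import Data.Bool.Properties using (∧-zeroʳ; ∧-identityʳ)
open import Data.Fin using (Fin; zero; suc; toℕ; fromℕ<)
open import Data.Fin.Properties using (toℕ<n; toℕ-fromℕ<; toℕ-injective) renaming (_≟_ to _≟F_; suc-injective to suc-injectiveF)
open import Data.List using (List; []; _∷_; _++_; map; allFin; length; tabulate; filter)
open import Data.List.Properties using (map-tabulate; length-++; filter-notAll)
open import Data.List.Membership.Propositional using (_∈_; _∉_)
open import Data.List.Membership.Propositional.Properties using (∈-++⁺ˡ; ∈-++⁺ʳ; ∈-filter⁺)
open import Data.List.Membership.DecPropositional Data.Nat._≟_ using (_∈?_)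
open import Data.List.Relation.Unary.Any using (here; there) renaming (map to Any-map)
open import Data.Product using (Σ; _×_; _,_; ∃-syntax; proj₁; proj₂)
open import Data.Sum using (_⊎_; inj₁; inj₂)
open import Data.Empty using (⊥; ⊥-elim)
open import Data.Unit using (⊤; tt)
open import Relation.Nullary using (¬_; ¬?; Dec; yes; no; does)
open import Relation.Nullary.Decidable using (dec-true; dec-false)
open import Relation.Binary.PropositionalEquality using (_≡_; _≢_; refl; sym; trans; cong; cong₂; subst; subst₂; module ≡-Reasoning)
open import Function using (_∘_; case_of_)
open import Relation.Binary.Definitions using (tri<; tri≈; tri>)
open import Data.Rational using (ℚ; 0ℚ) renaming (_<_ to _<ℚ_)
import Data.Rational as ℚ
import Data.Rational.Properties as ℚ
import Data.Rational.Unnormalised as ℚᵘ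
import Data.Rational.Unnormalised.Properties as ℚᵘ
import Data.Rational.Solver as ℚSolver
import Data.Integer as ℤ
import Data.Integer.Properties as ℤ
import Data.Nat.Coprimality as Coprimality

-- The densities are fixed by the crowding of `R`. With `P` of density `1 / H` and `Q` of density
-- about `g / H`, a vertex has about `δ g / H` edges into `Q`; of the values reached in steps of `s`
-- only one in `M` is free, so `N` is about `δ g / (H M)`. The competitors are at most `3 n / H`
-- exceptional and `18 n g² / H²` ordinary vertices, and must stay below `N s / 8` with `s` about
-- `n / (3 δ)`. This asks for `g` of order `M` and `H` of order `g M`, that is `M²`. A vertex
-- tolerates a deviation of `degree / (8 H)`, whose tail exponent has order `δ / H²`, so `δ / M⁴`.
-- The leading constant is spent in `3 s`, about `(n / δ) (1 + 16 / M)`: four of `M` blocks of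
-- residues are reserved for `R`, and the rest of the 16 pays for the tail bounds on cells, whose
-- relative error must itself be `O(1 / M)`. Probabilities are counts over finitely many labels and
-- exponentials are powers of `1 + 1 / w`, so every probabilistic estimate is an inequality between
-- natural numbers.

-- The format of most polynomial estimates: weighted hypotheses are added up to `l ≤ r`, and a
-- semiring identity with explicit slack `x` finishes. No subtraction occurs, so the ring solver
-- applies.
≤-cancel-cert : ∀ {l r a b} x → l ≤ r → a + r + x ≡ b + l → a ≤ b
≤-cancel-cert {l} {r} {a} {b} x l≤r eq = +-cancelʳ-≤ l a b (begin
  a + l ≤⟨ +-monoʳ-≤ a l≤r ⟩
  a + r ≤⟨ m≤m+n (a + r) x ⟩
  a + r + x ≡⟨ eq ⟩
  b + l ∎)
  where open ≤-Reasoning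

difference : ∀ {m n} → m ≤ n → ∃[ c ] m + c ≡ n
difference {m} {n} m≤n = n ∸ m , m+[n∸m]≡n m≤n

-- Finite sums, counting and pigeonhole.

private variable
  m n : ℕ

𝟙 : Bool → ℕ
𝟙 true  = 1
𝟙 false = 0

∑ : ∀ n → (Fin n → ℕ) → ℕ
∑ zero    f = 0
∑ (suc n) f = f zero + ∑ n (f ∘ suc)

# : (Fin n → Bool) → ℕ
# p = ∑ _ (𝟙 ∘ p)

𝟙≤1 : ∀ b → 𝟙 b ≤ 1
𝟙≤1 true  = s≤s z≤n
𝟙≤1 false = z≤n

𝟙-mono : ∀ {a b} → (a ≡ true → b ≡ true) → 𝟙 a ≤ 𝟙 b
𝟙-mono {false}        _ = z≤n
𝟙-mono {true} {b}     h rewrite h refl = ≤-refl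

𝟙-not : ∀ b → 𝟙 b + 𝟙 (not b) ≡ 1
𝟙-not true  = refl
𝟙-not false = refl

not-¬-true : ∀ {b} → ¬ b ≡ true → b ≡ false
not-¬-true {true}  h = ⊥-elim (h refl)
not-¬-true {false} _ = refl

true≢false : ∀ {b} → b ≡ true → b ≡ false → ⊥
true≢false refl ()

∧-true⁻ : ∀ {a b} → a ∧ b ≡ true → a ≡ true × b ≡ true
∧-true⁻ {true} {true} _ = refl , refl

∨-true⁻ : ∀ {a b} → a ∨ b ≡ true → a ≡ true ⊎ b ≡ true
∨-true⁻ {true}         _ = inj₁ refl
∨-true⁻ {false} {true} _ = inj₂ refl

∨-trueʳ : ∀ {a b} → b ≡ true → a ∨ b ≡ true
∨-trueʳ {true}  _ = refl
∨-trueʳ {false} h = h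

∨-trueˡ : ∀ {a b} → a ≡ true → a ∨ b ≡ true
∨-trueˡ refl = refl

∧-true : ∀ {a b} → a ≡ true → b ≡ true → a ∧ b ≡ true
∧-true refl refl = refl

not-true⁻ : ∀ {b} → not b ≡ true → b ≡ false
not-true⁻ {false} _ = refl

∨-false⁻ : ∀ {a b} → a ∨ b ≡ false → a ≡ false × b ≡ false
∨-false⁻ {false} {false} _ = refl , refl

∑-cong : ∀ {n} {f g : Fin n → ℕ} → (∀ i → f i ≡ g i) → ∑ n f ≡ ∑ n g
∑-cong {zero}  h = refl
∑-cong {suc n} h = cong₂ _+_ (h zero) (∑-cong (h ∘ suc))

∑-mono : ∀ {n} {f g : Fin n → ℕ} → (∀ i → f i ≤ g i) → ∑ n f ≤ ∑ n g
∑-mono {zero}  h = z≤n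
∑-mono {suc n} h = +-mono-≤ (h zero) (∑-mono (h ∘ suc))

+-interchange : ∀ a b c d → (a + b) + (c + d) ≡ (a + c) + (b + d)
+-interchange = solve-∀

∑-+ : ∀ n (f g : Fin n → ℕ) → ∑ n (λ i → f i + g i) ≡ ∑ n f + ∑ n g
∑-+ zero    f g = refl
∑-+ (suc n) f g = trans (cong (f zero + g zero +_) (∑-+ n (f ∘ suc) (g ∘ suc)))
  (+-interchange (f zero) (g zero) (∑ n (f ∘ suc)) (∑ n (g ∘ suc)))

∑-*ˡ : ∀ n c (f : Fin n → ℕ) → ∑ n (λ i → c * f i) ≡ c * ∑ n f
∑-*ˡ zero    c f = sym (*-zeroʳ c)
∑-*ˡ (suc n) c f = trans (cong (c * f zero +_) (∑-*ˡ n c (f ∘ suc)))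
  (sym (*-distribˡ-+ c (f zero) _))

∑-*ʳ : ∀ n c (f : Fin n → ℕ) → ∑ n (λ i → f i * c) ≡ ∑ n f * c
∑-*ʳ n c f = trans (∑-cong (λ i → *-comm (f i) c)) (trans (∑-*ˡ n c f) (*-comm c _))

∑-const : ∀ n c → ∑ n (λ _ → c) ≡ n * c
∑-const zero    c = refl
∑-const (suc n) c = cong (c +_) (∑-const n c)

∑-zero : ∀ {n} {f : Fin n → ℕ} → (∀ i → f i ≡ 0) → ∑ n f ≡ 0
∑-zero {n} h = trans (∑-cong h) (trans (∑-const n 0) (*-zeroʳ n))

∑-swap : ∀ m n (f : Fin m → Fin n → ℕ) → ∑ m (λ i → ∑ n (f i)) ≡ ∑ n (λ j → ∑ m (λ i → f i j))
∑-swap zero    n f = sym (∑-zero {n} (λ _ → refl))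
∑-swap (suc m) n f = trans (cong (∑ n (f zero) +_) (∑-swap m n (f ∘ suc)))
  (sym (∑-+ n (f zero) (λ j → ∑ m (λ i → f (suc i) j))))

∑-term : ∀ {n} (f : Fin n → ℕ) i → f i ≤ ∑ n f
∑-term f zero    = m≤m+n _ _
∑-term f (suc i) = ≤-trans (∑-term (f ∘ suc) i) (m≤n+m _ (f zero))

∑-allFin : ∀ n (f : Fin n → ℕ) → sum (map f (allFin n)) ≡ ∑ n f
∑-allFin n f = trans (cong sum (map-tabulate (λ i → i) f)) (go n f)
  where
  go : ∀ n (f : Fin n → ℕ) → sum (tabulate f) ≡ ∑ n f
  go zero    f = refl
  go (suc n) f = cong (f zero +_) (go n (f ∘ suc))

∑-update : ∀ {n} (f g : Fin n → ℕ) j → (∀ i → i ≢ j → f i ≡ g i) → ∑ n f + g j ≡ ∑ n g + f j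
∑-update f g zero h = trans (cong (λ z → f zero + z + g zero) (∑-cong (λ i → h (suc i) λ ()))) (lem (f zero) _ (g zero))
  where
  lem : ∀ a b c → a + b + c ≡ c + b + a
  lem = solve-∀
∑-update f g (suc j) h rewrite h zero (λ ()) = trans (+-assoc (g zero) _ _)
  (trans (cong (g zero +_) (∑-update (f ∘ suc) (g ∘ suc) j (λ i i≢j → h (suc i) (i≢j ∘ suc-injectiveF))))
    (sym (+-assoc (g zero) _ _)))

∑-average : ∀ n (f : Fin n → ℕ) → 0 < n → ∃[ i ] n * f i ≤ ∑ n f
∑-average (suc zero)    f _ = zero , ≤-refl
∑-average (suc (suc n)) f _ with ∑-average (suc n) (f ∘ suc) (s≤s z≤n)
... | i , h with ≤-total (f zero) (f (suc i))
... | inj₁ a≤b = zero , +-monoʳ-≤ (f zero) (≤-trans (*-monoʳ-≤ (suc n) a≤b) h)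
... | inj₂ b≤a = suc i , +-mono-≤ b≤a h

#-mono : ∀ {n} {p q : Fin n → Bool} → (∀ i → p i ≡ true → q i ≡ true) → # p ≤ # q
#-mono h = ∑-mono (λ i → 𝟙-mono (h i))

#≤n : ∀ {n} (p : Fin n → Bool) → # p ≤ n
#≤n {n} p = ≤-trans (∑-mono (λ i → 𝟙≤1 (p i))) (≤-reflexive (trans (∑-const n 1) (*-identityʳ n)))

#-not : ∀ {n} (p : Fin n → Bool) → # p + # (not ∘ p) ≡ n
#-not {n} p = trans (sym (∑-+ n _ _)) (trans (∑-cong (λ i → 𝟙-not (p i))) (trans (∑-const n 1) (*-identityʳ n)))

#-pos : ∀ {n} {p : Fin n → Bool} i → p i ≡ true → 0 < # p
#-pos {p = p} i h = ≤-trans (≤-reflexive (sym (cong 𝟙 h))) (∑-term (𝟙 ∘ p) i)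

#-false : ∀ {n} {p : Fin n → Bool} → (∀ i → p i ≡ false) → # p ≡ 0
#-false h = ∑-zero (λ i → cong 𝟙 (h i))

#-witness : ∀ {n} (p : Fin n → Bool) → 0 < # p → ∃[ i ] p i ≡ true
#-witness {suc n} p h with p zero in eq
... | true  = zero , eq
... | false with #-witness (p ∘ suc) h
... | i , e = suc i , e

#-witness₂ : ∀ {n} (p : Fin n → Bool) j → 1 < # p → ∃[ i ] i ≢ j × p i ≡ true
#-witness₂ {suc n} p zero h with p zero
#-witness₂ {suc n} p zero (s≤s h) | true with #-witness (p ∘ suc) h
... | i , e = suc i , (λ ()) , e
#-witness₂ {suc n} p zero h | false with #-witness (p ∘ suc) (<-trans (s≤s z≤n) h)
... | i , e = suc i , (λ ()) , e
#-witness₂ {suc n} p (suc j) h with p zero in eq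
... | true  = zero , (λ ()) , eq
... | false with #-witness₂ (p ∘ suc) j h
... | i , ne , e = suc i , ne ∘ suc-injectiveF , e

#-unique : ∀ {n} (p : Fin n → Bool) → (∀ i j → p i ≡ true → p j ≡ true → i ≡ j) → # p ≤ 1
#-unique {zero}  p h = z≤n
#-unique {suc n} p h with p zero in eq
... | false = #-unique (p ∘ suc) (λ i j a b → suc-injectiveF (h (suc i) (suc j) a b))
... | true  = ≤-reflexive (cong suc (#-false (λ i → not-¬-true (λ e → case h zero (suc i) eq e of λ ()))))

exists : ∀ {n} → (Fin n → Bool) → Bool
exists {zero}  p = false
exists {suc n} p = p zero ∨ exists (p ∘ suc)

exists⁺ : ∀ {n} (p : Fin n → Bool) i → p i ≡ true → exists p ≡ true
exists⁺ p zero    h = ∨-trueˡ h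
exists⁺ p (suc i) h = ∨-trueʳ (exists⁺ (p ∘ suc) i h)

exists⁻ : ∀ {n} (p : Fin n → Bool) → exists p ≡ true → ∃[ i ] p i ≡ true
exists⁻ {suc n} p h with ∨-true⁻ {p zero} h
... | inj₁ e = zero , e
... | inj₂ e with exists⁻ (p ∘ suc) e
... | i , e′ = suc i , e′

exists-false : ∀ {n} {p : Fin n → Bool} → exists p ≡ false → ∀ i → p i ≡ false
exists-false {p = p} h i = not-¬-true (λ e → true≢false (exists⁺ p i e) h)

𝟙-exists : ∀ {n} (p : Fin n → Bool) → 𝟙 (exists p) ≤ # p
𝟙-exists {n} p with exists p in eq
... | false = z≤n
... | true with exists⁻ p eq
... | i , e = #-pos i e

#-union : ∀ {n} (q : Fin n → Bool) (t : Fin n → Fin n → Bool) r → (∀ i → # (t i) ≤ r) →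
  # (λ u → exists (λ i → q i ∧ t i u)) ≤ r * # q
#-union {n} q t r h = begin
  # (λ u → exists (λ i → q i ∧ t i u))     ≤⟨ ∑-mono (λ u → 𝟙-exists (λ i → q i ∧ t i u)) ⟩
  ∑ n (λ u → ∑ n (λ i → 𝟙 (q i ∧ t i u)))  ≡⟨ ∑-swap n n _ ⟩
  ∑ n (λ i → ∑ n (λ u → 𝟙 (q i ∧ t i u)))  ≤⟨ ∑-mono row ⟩
  ∑ n (λ i → r * 𝟙 (q i))                  ≡⟨ ∑-*ˡ n r (𝟙 ∘ q) ⟩
  r * # q                                   ∎
  where
  open ≤-Reasoning
  row : ∀ i → ∑ n (λ u → 𝟙 (q i ∧ t i u)) ≤ r * 𝟙 (q i)
  row i with q i
  ... | true  = ≤-trans (h i) (≤-reflexive (sym (*-identityʳ r)))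
  ... | false = ≤-reflexive (trans (∑-zero {n} (λ _ → refl)) (sym (*-zeroʳ r)))

#-∨ : ∀ {n} (p q : Fin n → Bool) → # (λ i → p i ∨ q i) ≤ # p + # q
#-∨ {n} p q = ≤-trans (∑-mono (λ i → lem (p i) (q i))) (≤-reflexive (∑-+ n _ _))
  where
  lem : ∀ a b → 𝟙 (a ∨ b) ≤ 𝟙 a + 𝟙 b
  lem true  b = s≤s z≤n
  lem false b = ≤-refl

#-split : ∀ {n} (p q : Fin n → Bool) → # (λ i → p i ∧ q i) + # (λ i → p i ∧ not (q i)) ≡ # p
#-split {n} p q = trans (sym (∑-+ n _ _)) (∑-cong (λ i → lem (p i) (q i)))
  where
  lem : ∀ a b → 𝟙 (a ∧ b) + 𝟙 (a ∧ not b) ≡ 𝟙 a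
  lem true  b = 𝟙-not b
  lem false b = refl

choose-subset : ∀ {n} (p : Fin n → Bool) r → r ≤ # p →
  Σ (Fin n → Bool) λ q → (∀ i → q i ≡ true → p i ≡ true) × # q ≡ r
choose-subset {n} p zero _ = (λ _ → false) , (λ _ ()) , #-false {n} (λ _ → refl)
choose-subset {suc n} p (suc r) h with p zero in eq
... | true with choose-subset (p ∘ suc) r (s≤s⁻¹ h)
... | q , sub , c = (λ { zero → true ; (suc i) → q i }) ,
                    (λ { zero _ → eq ; (suc i) e → sub i e }) , cong suc c
choose-subset {suc n} p (suc r) h | false with choose-subset (p ∘ suc) (suc r) h
... | q , sub , c = (λ { zero → false ; (suc i) → q i }) ,
                    (λ { zero () ; (suc i) e → sub i e }) , c

distribute : ∀ {n} K (p : Fin n → Bool) X → X ≤ K * # p →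
  Σ (Fin n → ℕ) λ ω → (∀ i → ω i ≤ K) × (∀ i → p i ≡ false → ω i ≡ 0) × ∑ n ω ≡ X
distribute {zero} K p X h = (λ ()) , (λ ()) , (λ ()) ,
  sym (n≤0⇒n≡0 (≤-trans h (≤-reflexive (*-zeroʳ K))))
distribute {suc n} K p X h with p zero in eq
... | false with distribute K (p ∘ suc) X h
... | ω , a , b , c = (λ { zero → 0 ; (suc i) → ω i }) , (λ { zero → z≤n ; (suc i) → a i }) ,
                      (λ { zero _ → refl ; (suc i) e → b i e }) , c
distribute {suc n} K p X h | true with distribute K (p ∘ suc) (X ∸ K) (begin
    X ∸ K                            ≤⟨ ∸-monoˡ-≤ K h ⟩
    K * suc (# (p ∘ suc)) ∸ K        ≡⟨ cong (_∸ K) (*-suc K _) ⟩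
    K + K * # (p ∘ suc) ∸ K          ≡⟨ m+n∸m≡n K _ ⟩
    K * # (p ∘ suc)                  ∎)
  where open ≤-Reasoning
... | ω , a , b , c = (λ { zero → X ⊓ K ; (suc i) → ω i }) , (λ { zero → m⊓n≤n X K ; (suc i) → a i }) ,
                      (λ { zero e → ⊥-elim (true≢false eq e) ; (suc i) e → b i e }) ,
                      trans (cong (X ⊓ K +_) c) (trans (cong (_+ (X ∸ K)) (⊓-comm X K)) (m⊓n+n∸m≡n K X))

rank : ∀ {n} → (Fin n → Bool) → Fin n → ℕ
rank p zero    = 0
rank p (suc i) = 𝟙 (p zero) + rank (p ∘ suc) i

rank<# : ∀ {n} (p : Fin n → Bool) i → p i ≡ true → rank p i < # p
rank<# p zero    h rewrite h = s≤s z≤n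
rank<# p (suc i) h = +-monoʳ-< (𝟙 (p zero)) (rank<# (p ∘ suc) i h)

rank-injective : ∀ {n} (p : Fin n → Bool) i j → p i ≡ true → p j ≡ true → rank p i ≡ rank p j → i ≡ j
rank-injective p zero    zero    a b e = refl
rank-injective p zero    (suc j) a b e rewrite a = case e of λ ()
rank-injective p (suc i) zero    a b e rewrite b = case e of λ ()
rank-injective p (suc i) (suc j) a b e =
  cong suc (rank-injective (p ∘ suc) i j a b (+-cancelˡ-≡ (𝟙 (p zero)) _ _ e))

-- Pigeonhole by induction on `s`: if the largest candidate is forbidden, deleting its occurrences
-- shortens the list.
missing : ∀ s (F : List ℕ) → length F < s → ∃[ t ] t < s × t ∉ F
missing (suc s) F h with s ∈? F
... | no  s∉ = s , ≤-refl , s∉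
... | yes s∈ with missing s (filter ≢s? F)
                   (<-≤-trans (filter-notAll ≢s? F (Any-map (λ e ne → ne (sym e)) s∈)) (s≤s⁻¹ h))
  where
  ≢s? : ∀ x → Dec (x ≢ s)
  ≢s? x = ¬? (x ≟ s)
... | t , t<s , t∉ = t , m<n⇒m<1+n t<s , λ t∈ → t∉ (∈-filter⁺ (λ x → ¬? (x ≟ s)) t∈ (<⇒≢ t<s))

-- Powers, products and the integer form of the exponential moment method.

^-distribʳ-* : ∀ k a b → (a * b) ^ k ≡ a ^ k * b ^ k
^-distribʳ-* zero    a b = refl
^-distribʳ-* (suc k) a b = trans (cong (a * b *_) (^-distribʳ-* k a b)) (lem a b (a ^ k) (b ^ k))
  where
  lem : ∀ a b x y → a * b * (x * y) ≡ a * x * (b * y)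
  lem = solve-∀

∏ : ∀ n → (Fin n → ℕ) → ℕ
∏ zero    f = 1
∏ (suc n) f = f zero * ∏ n (f ∘ suc)

∏-* : ∀ n κ (f : Fin n → ℕ) → ∏ n (λ i → κ * f i) ≡ κ ^ n * ∏ n f
∏-* zero    κ f = refl
∏-* (suc n) κ f = trans (cong (κ * f zero *_) (∏-* n κ (f ∘ suc))) (lem κ (f zero) (κ ^ n) _)
  where
  lem : ∀ a b c d → a * b * (c * d) ≡ a * c * (b * d)
  lem = solve-∀

∑L : {A : Set} → (A → ℕ) → List A → ℕ
∑L f []       = 0
∑L f (x ∷ xs) = f x + ∑L f xs

∑L-++ : {A : Set} (f : A → ℕ) (xs ys : List A) → ∑L f (xs ++ ys) ≡ ∑L f xs + ∑L f ys
∑L-++ f []       ys = refl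
∑L-++ f (x ∷ xs) ys = trans (cong (f x +_) (∑L-++ f xs ys)) (sym (+-assoc (f x) _ _))

∑L-cong : {A : Set} {f g : A → ℕ} → (∀ x → f x ≡ g x) → ∀ xs → ∑L f xs ≡ ∑L g xs
∑L-cong h []       = refl
∑L-cong h (x ∷ xs) = cong₂ _+_ (h x) (∑L-cong h xs)

∑L-map : {A B : Set} (f : B → ℕ) (h : A → B) (xs : List A) → ∑L f (map h xs) ≡ ∑L (f ∘ h) xs
∑L-map f h []       = refl
∑L-map f h (x ∷ xs) = cong (f (h x) +_) (∑L-map f h xs)

∑L-*ˡ : ∀ {A : Set} c (f : A → ℕ) (xs : List A) → ∑L (λ x → c * f x) xs ≡ c * ∑L f xs
∑L-*ˡ c f []       = sym (*-zeroʳ c)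
∑L-*ˡ c f (x ∷ xs) = trans (cong (c * f x +_) (∑L-*ˡ c f xs)) (sym (*-distribˡ-+ c (f x) _))

∑L-∈ : {A : Set} (f : A → ℕ) {x : A} {xs : List A} → x ∈ xs → f x ≤ ∑L f xs
∑L-∈ f (here refl) = m≤m+n _ _
∑L-∈ f (there p)   = ≤-trans (∑L-∈ f p) (m≤n+m _ _)

∑L-mono : {A : Set} {f g : A → ℕ} → (∀ x → f x ≤ g x) → ∀ xs → ∑L f xs ≤ ∑L g xs
∑L-mono h []       = z≤n
∑L-mono h (x ∷ xs) = +-mono-≤ (h x) (∑L-mono h xs)

∑-∑L-swap : {A : Set} (f : Fin m → A → ℕ) (xs : List A) →
  ∑ m (λ i → ∑L (f i) xs) ≡ ∑L (λ x → ∑ m (λ i → f i x)) xs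
∑-∑L-swap {m} f []       = ∑-zero {m} (λ _ → refl)
∑-∑L-swap {m} f (x ∷ xs) = trans (∑-+ m (λ i → f i x) _) (cong (∑ m (λ i → f i x) +_) (∑-∑L-swap f xs))

flat : {A : Set} → ∀ m → (Fin m → List A) → List A
flat zero    F = []
flat (suc m) F = F zero ++ flat m (F ∘ suc)

∑L-flat : ∀ {A : Set} (f : A → ℕ) m (F : Fin m → List A) → ∑L f (flat m F) ≡ ∑ m (λ i → ∑L f (F i))
∑L-flat f zero    F = refl
∑L-flat f (suc m) F = trans (∑L-++ f (F zero) _) (cong (∑L f (F zero) +_) (∑L-flat f m (F ∘ suc)))

∈-flat : {A : Set} {x : A} → ∀ {m} (F : Fin m → List A) i → x ∈ F i → x ∈ flat m F
∈-flat F zero    p = ∈-++⁺ˡ p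
∈-flat F (suc i) p = ∈-++⁺ʳ (F zero) (∈-flat (F ∘ suc) i p)

-- The hypothesis is `f i / w ≥ (1 + 1/w) ^ (e′ i - e i)` cross-multiplied, so that exponents of
-- either sign are covered; the claim is the product of these inequalities.
power-product : ∀ n w (f e e′ : Fin n → ℕ) →
  (∀ i → w * (suc w ^ e′ i * w ^ e i) ≤ f i * (suc w ^ e i * w ^ e′ i)) →
  w ^ n * (suc w ^ ∑ n e′ * w ^ ∑ n e) ≤ ∏ n f * (suc w ^ ∑ n e * w ^ ∑ n e′)
power-product zero    w f e e′ h = ≤-refl
power-product (suc n) w f e e′ h
  rewrite ^-distribˡ-+-* (suc w) (e zero) (∑ n (e ∘ suc)) | ^-distribˡ-+-* w (e zero) (∑ n (e ∘ suc))
        | ^-distribˡ-+-* (suc w) (e′ zero) (∑ n (e′ ∘ suc)) | ^-distribˡ-+-* w (e′ zero) (∑ n (e′ ∘ suc)) =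
  subst₂ _≤_ (shuffle w (suc w ^ e′ zero) (w ^ e zero) (w ^ n) _ _)
             (shuffle (f zero) (suc w ^ e zero) (w ^ e′ zero) (∏ n (f ∘ suc)) _ _)
    (*-mono-≤ (h zero) (power-product n w (f ∘ suc) (e ∘ suc) (e′ ∘ suc) (h ∘ suc)))
  where
  shuffle : ∀ a b c a′ b′ c′ → a * (b * c) * (a′ * (b′ * c′)) ≡ a * a′ * (b * b′ * (c * c′))
  shuffle = solve-∀

bernoulli : ∀ w E → w ^ E * (w + E) ≤ w * suc w ^ E
bernoulli w zero    = ≤-reflexive (trans (*-identityˡ (w + 0)) (trans (+-identityʳ w) (sym (*-identityʳ w))))
bernoulli w (suc E) = begin
  w * w ^ E * (w + suc E)              ≤⟨ m≤m+n _ (w ^ E * E) ⟩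
  w * w ^ E * (w + suc E) + w ^ E * E  ≡⟨ lem w (w ^ E) E ⟩
  suc w * (w ^ E * (w + E))            ≤⟨ *-monoʳ-≤ (suc w) (bernoulli w E) ⟩
  suc w * (w * suc w ^ E)              ≡⟨ lem₂ w (suc w) (suc w ^ E) ⟩
  w * (suc w * suc w ^ E)              ∎
  where
  open ≤-Reasoning
  lem : ∀ w p E → w * p * (w + (1 + E)) + p * E ≡ (1 + w) * (p * (w + E))
  lem = solve-∀
  lem₂ : ∀ a b c → b * (a * c) ≡ a * (b * c)
  lem₂ = solve-∀

-- The reverse Bernoulli bound `(1 + 1/w) ^ a ≤ w / (w - a)`, with `b = w - a`. In the induction
-- step the new factor `1 + 1/w` is at most `(b + 1) / b` because `b ≤ w`.
bernoulli-upper : ∀ w a b → a + b ≡ w → suc w ^ a * b ≤ w ^ a * w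
bernoulli-upper w zero    b refl = ≤-refl
bernoulli-upper w (suc a) b e    = begin
  suc w * suc w ^ a * b          ≡⟨ lem w (suc w ^ a) b ⟩
  suc w ^ a * (b + w * b)        ≤⟨ *-monoʳ-≤ (suc w ^ a) (+-monoˡ-≤ (w * b) b≤w) ⟩
  suc w ^ a * (w + w * b)        ≡⟨ lem₂ w (suc w ^ a) b ⟩
  suc w ^ a * suc b * w          ≤⟨ *-monoˡ-≤ w (bernoulli-upper w a (suc b) (trans (+-suc a b) e)) ⟩
  w ^ a * w * w                  ≡⟨ cong (_* w) (*-comm (w ^ a) w) ⟩
  w * w ^ a * w                  ∎
  where
  open ≤-Reasoning
  b≤w : b ≤ w
  b≤w = ≤-trans (m≤n+m b (suc a)) (≤-reflexive e)
  lem : ∀ w p b → (1 + w) * p * b ≡ p * (b + w * b)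
  lem = solve-∀
  lem₂ : ∀ w p b → p * (w + w * b) ≡ p * (1 + b) * w
  lem₂ = solve-∀

-- The factors of the exponential potential are compared with powers of 1 + 1/w,
-- w = L²T, which plays the role of exp(1/w).
module _ (L T : ℕ) (2≤L : 2 ≤ L) (0<T : 0 < T) where
  private
    w = L * L * T

    0<L : 0 < L
    0<L = <-≤-trans (s≤s z≤n) 2≤L

    0<w : 0 < w
    0<w = *-mono-< (*-mono-< 0<L 0<L) 0<T

    instance
      w-nonZero : NonZero w
      w-nonZero = >-nonZero 0<w

  -- Here `d / w = 1 - L j / w`. Bernoulli reduces the claim to `w² ≤ d (w + E)`, which follows from
  -- `L² j ≤ 2 d`; the extra `2 j` in the exponent pays for the second-order term of the logarithm.
  -- The bound `2 ≤ L` enters through `2 L j ≤ L² T`.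
  factor-down : ∀ j d → j ≤ T → d + L * j ≡ w →
    w * w ^ (L * j + 2 * j) ≤ d * suc w ^ (L * j + 2 * j)
  factor-down j d j≤T e = *-cancelˡ-≤ w (begin
    w * (w * p)              ≡⟨ lem₃ w p ⟩
    w * w * p                ≤⟨ *-monoˡ-≤ p square ⟩
    d * (w + E) * p          ≡⟨ lem₄ d (w + E) p ⟩
    d * (p * (w + E))        ≤⟨ *-monoʳ-≤ d (bernoulli w E) ⟩
    d * (w * suc w ^ E)      ≡⟨ lem₅ d w _ ⟩
    w * (d * suc w ^ E)      ∎)
    where
    open ≤-Reasoning
    E = L * j + 2 * j
    p = w ^ E
    lem₃ : ∀ w p → w * (w * p) ≡ w * w * p
    lem₃ = solve-∀
    lem₄ : ∀ a b c → a * b * c ≡ a * (c * b)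
    lem₄ = solve-∀
    lem₅ : ∀ a b c → a * (b * c) ≡ b * (a * c)
    lem₅ = solve-∀
    L²j≤2d : L * L * j ≤ 2 * d
    L²j≤2d = ≤-cancel-cert 0 (+-mono-≤ (*-monoʳ-≤ (L * L) j≤T)
                                       (*-mono-≤ 2≤L (*-monoʳ-≤ L j≤T)))
      (trans (lem₆ (L * L * j) (L * L * T) (L * (L * T)))
        (trans (cong (L * L * j +_) (trans (lem₇ L T) (cong (2 *_) (sym e)))) (lem₈ (L * L * j) d (L * j))))
      where
      lem₆ : ∀ a b c → a + (b + c) + 0 ≡ a + (b + c)
      lem₆ = solve-∀
      lem₇ : ∀ L T → L * L * T + L * (L * T) ≡ 2 * (L * L * T)
      lem₇ = solve-∀
      lem₈ : ∀ a d b → a + 2 * (d + b) ≡ 2 * d + (a + 2 * b)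
      lem₈ = solve-∀
    square : w * w ≤ d * (w + E)
    square = subst (λ v → v * v ≤ d * (v + E)) e (≤-cancel-cert 0 (*-monoʳ-≤ j L²j≤2d) (lem L j d))
      where
      lem : ∀ L j d → (d + L * j) * (d + L * j) + j * (2 * d) + 0
                    ≡ d * ((d + L * j) + (L * j + 2 * j)) + j * (L * L * j)
      lem = solve-∀

  private
    -- This says `1 + U/w ≥ (1 + 1/w) ^ (U - T)`. For `U ≤ T` it is immediate. For `U = T + a` the
    -- reverse Bernoulli bound leaves `a U ≤ w T`, true since `U ≤ L T` and `(L T)² = w T`; this is
    -- the reason for `w = L² T`.
    factor-excess : ∀ U → U ≤ L * T →
      w * (suc w ^ U * w ^ T) ≤ (w + U) * (suc w ^ T * w ^ U)
    factor-excess U U≤LT with ≤-total U T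
    ... | inj₁ U≤T with difference U≤T
    ... | c , refl rewrite ^-distribˡ-+-* (suc w) U c | ^-distribˡ-+-* w U c = begin
      w * (suc w ^ U * (w ^ U * w ^ c))        ≤⟨ *-monoˡ-≤ (suc w ^ U * (w ^ U * w ^ c)) (m≤m+n w U) ⟩
      (w + U) * (suc w ^ U * (w ^ U * w ^ c))  ≤⟨ *-monoʳ-≤ (w + U) (*-monoʳ-≤ (suc w ^ U) (*-monoʳ-≤ (w ^ U) (^-monoˡ-≤ c (n≤1+n w)))) ⟩
      (w + U) * (suc w ^ U * (w ^ U * suc w ^ c)) ≡⟨ lem (w + U) (suc w ^ U) (w ^ U) (suc w ^ c) ⟩
      (w + U) * (suc w ^ U * suc w ^ c * w ^ U) ∎
      where
      open ≤-Reasoning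
      lem : ∀ a b c d → a * (b * (c * d)) ≡ a * (b * d * c)
      lem = solve-∀
    factor-excess U U≤LT | inj₂ T≤U with difference T≤U
    ... | a , refl with difference (≤-trans (<⇒≤ (m<n+m a 0<T)) (≤-trans U≤LT LT≤w))
      where
      LT≤w : L * T ≤ w
      LT≤w = *-monoˡ-≤ T (≤-trans (≤-reflexive (sym (*-identityʳ L))) (*-monoʳ-≤ L 0<L))
    ... | b , a+b≡w rewrite ^-distribˡ-+-* (suc w) T a | ^-distribˡ-+-* w T a = begin
      w * (suc w ^ T * suc w ^ a * w ^ T)      ≡⟨ lem w (suc w ^ T) (suc w ^ a) (w ^ T) ⟩
      suc w ^ T * w ^ T * (w * suc w ^ a)      ≤⟨ *-monoʳ-≤ (suc w ^ T * w ^ T) main ⟩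
      suc w ^ T * w ^ T * ((w + (T + a)) * w ^ a) ≡⟨ lem₂ (suc w ^ T) (w ^ T) (w + (T + a)) (w ^ a) ⟩
      (w + (T + a)) * (suc w ^ T * (w ^ T * w ^ a)) ∎
      where
      open ≤-Reasoning
      lem : ∀ a b c d → a * (b * c * d) ≡ b * d * (a * c)
      lem = solve-∀
      lem₂ : ∀ a b c d → a * b * (c * d) ≡ c * (a * (b * d))
      lem₂ = solve-∀
      LT≤w : L * T ≤ w
      LT≤w = *-monoˡ-≤ T (≤-trans (≤-reflexive (sym (*-identityʳ L))) (*-monoʳ-≤ L 0<L))
      a<w : a < w
      a<w = <-≤-trans (m<n+m a 0<T) (≤-trans U≤LT LT≤w)
      0<b : 0 < b
      0<b = +-cancelˡ-< a 0 b (subst₂ _<_ (sym (+-identityʳ a)) (sym a+b≡w) a<w)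
      instance
        b-nonZero : NonZero b
        b-nonZero = >-nonZero 0<b
      aU≤wT : a * (T + a) ≤ w * T
      aU≤wT = ≤-trans (*-mono-≤ (≤-trans (m≤n+m a T) U≤LT) U≤LT) (≤-reflexive (eq L T))
        where
        eq : ∀ L T → L * T * (L * T) ≡ L * L * T * T
        eq = solve-∀
      square : w * w ≤ b * (w + (T + a))
      square = ≤-cancel-cert 0 aU≤wT
        (subst (λ v → v * v + v * T + 0 ≡ b * (v + (T + a)) + a * (T + a)) a+b≡w (lem₃ a b T))
        where
        lem₃ : ∀ a b T → (a + b) * (a + b) + (a + b) * T + 0 ≡ b * ((a + b) + (T + a)) + a * (T + a)
        lem₃ = solve-∀
      main : w * suc w ^ a ≤ (w + (T + a)) * w ^ a
      main = *-cancelˡ-≤ b (begin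
        b * (w * suc w ^ a)           ≡⟨ lem₃ b w (suc w ^ a) ⟩
        w * (suc w ^ a * b)           ≤⟨ *-monoʳ-≤ w (bernoulli-upper w a b a+b≡w) ⟩
        w * (w ^ a * w)               ≡⟨ lem₃ w (w ^ a) w ⟩
        w ^ a * (w * w)               ≤⟨ *-monoʳ-≤ (w ^ a) square ⟩
        w ^ a * (b * (w + (T + a)))   ≡⟨ lem₄ (w ^ a) b (w + (T + a)) ⟩
        b * ((w + (T + a)) * w ^ a)   ∎)
        where
        lem₃ : ∀ a b c → a * (b * c) ≡ b * (c * a)
        lem₃ = solve-∀
        lem₄ : ∀ a b c → a * (b * c) ≡ b * (c * a)
        lem₄ = solve-∀

  -- The exponents differ by `U - T - 2 j`: the common `L j` cancels, `2 j` only helps, and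
  -- `factor-excess` covers `U - T`. The term `2 j` is kept so that both cases of a factor share the
  -- exponent `(L + 2) j`.
  factor-up : ∀ j U → U + L * j ≡ L * T →
    w * (suc w ^ (L * T) * w ^ (L * j + 2 * j + T)) ≤ (w + U) * (suc w ^ (L * j + 2 * j + T) * w ^ (L * T))
  factor-up j U e = begin
    w * (suc w ^ (L * T) * w ^ (L * j + 2 * j + T))   ≡⟨ cong₂ (λ x y → w * (x * y)) (trans (cong (suc w ^_) (sym e)) (^-distribˡ-+-* (suc w) U (L * j))) (exps w) ⟩
    w * ((suc w ^ U * q′) * (q * r * w ^ T))          ≡⟨ lem w (suc w ^ U) q′ q r (w ^ T) ⟩
    (q * q′) * r * (w * (suc w ^ U * w ^ T))          ≤⟨ *-mono-≤ (*-monoʳ-≤ (q * q′) (^-monoˡ-≤ (2 * j) (n≤1+n w))) (factor-excess U (≤-trans (m≤m+n U _) (≤-reflexive e))) ⟩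
    (q * q′) * r′ * ((w + U) * (suc w ^ T * w ^ U))   ≡⟨ lem₂ q q′ r′ (w + U) (suc w ^ T) (w ^ U) ⟩
    (w + U) * ((q′ * r′ * suc w ^ T) * (w ^ U * q))   ≡⟨ cong₂ (λ x y → (w + U) * (x * y)) (sym (exps (suc w))) (trans (sym (^-distribˡ-+-* w U (L * j))) (cong (w ^_) e)) ⟩
    (w + U) * (suc w ^ (L * j + 2 * j + T) * w ^ (L * T)) ∎
    where
    open ≤-Reasoning
    q  = w ^ (L * j)
    q′ = suc w ^ (L * j)
    r  = w ^ (2 * j)
    r′ = suc w ^ (2 * j)
    exps : ∀ v → v ^ (L * j + 2 * j + T) ≡ v ^ (L * j) * v ^ (2 * j) * v ^ T
    exps v = trans (^-distribˡ-+-* v (L * j + 2 * j) T) (cong (_* v ^ T) (^-distribˡ-+-* v (L * j) (2 * j)))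
    lem : ∀ a b c d e f → a * ((b * c) * (d * e * f)) ≡ (d * c) * e * (a * (b * f))
    lem = solve-∀
    lem₂ : ∀ a b c d e f → (a * b) * c * (d * (e * f)) ≡ d * ((b * c * e) * (f * a))
    lem₂ = solve-∀

  -- From `(1 + 1/w) ^ w ≥ 2`, applied to `B` blocks of length `w`.
  exp-doubling : ∀ B Δ → w * B ≤ Δ → 2 ^ B * w ^ Δ ≤ suc w ^ Δ
  exp-doubling B Δ h with difference h
  ... | c , refl rewrite ^-distribˡ-+-* w (w * B) c | ^-distribˡ-+-* (suc w) (w * B) c = begin
    2 ^ B * (w ^ (w * B) * w ^ c)  ≡⟨ *-assoc (2 ^ B) _ _ ⟨
    2 ^ B * w ^ (w * B) * w ^ c    ≤⟨ *-mono-≤ (blocks B) (^-monoˡ-≤ c (n≤1+n w)) ⟩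
    suc w ^ (w * B) * suc w ^ c    ∎
    where
    open ≤-Reasoning
    double : 2 * w ^ w ≤ suc w ^ w
    double = *-cancelˡ-≤ w (≤-trans (≤-reflexive (lem w (w ^ w))) (bernoulli w w))
      where
      lem : ∀ w p → w * (2 * p) ≡ p * (w + w)
      lem = solve-∀
    blocks : ∀ B → 2 ^ B * w ^ (w * B) ≤ suc w ^ (w * B)
    blocks zero rewrite *-zeroʳ w = ≤-refl
    blocks (suc B) rewrite *-suc w B | ^-distribˡ-+-* w w (w * B) | ^-distribˡ-+-* (suc w) w (w * B) = begin
      2 * 2 ^ B * (w ^ w * w ^ (w * B))   ≡⟨ lem (2 ^ B) (w ^ w) _ ⟩
      2 * w ^ w * (2 ^ B * w ^ (w * B))   ≤⟨ *-mono-≤ double (blocks B) ⟩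
      suc w ^ w * suc w ^ (w * B)         ∎
      where
      lem : ∀ a b c → 2 * a * (b * c) ≡ 2 * b * (a * c)
      lem = solve-∀

  -- A Chernoff bound over the integers. With `j u / T` the probability of the event at `u`,
  -- dividing the last hypothesis by `L T` gives `(1 + 2/L) mean + hits/L + L B ≤ hits`. Such an
  -- excess forces the potential above `2 ^ B` times its average `w ^ n`.
  potential-large : ∀ {n} (j : Fin n → ℕ) (b : Fin n → Bool) (f : Fin n → ℕ) →
    (∀ u → j u ≤ T) →
    (∀ u → b u ≡ true → f u + L * j u ≡ w + L * T) →
    (∀ u → b u ≡ false → f u + L * j u ≡ w) →
    ∀ B → (L + 2) * ∑ n j + T * # b + w * B ≤ L * T * # b →
    w ^ n * 2 ^ B ≤ ∏ n f
  potential-large {n} j b f j≤T up down B h with difference h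
  ... | c , eq = *-cancelʳ-≤ (w ^ n * 2 ^ B) (∏ n f) (suc w ^ E * w ^ (E + Δ)) (begin
    w ^ n * 2 ^ B * (suc w ^ E * w ^ (E + Δ))    ≡⟨ cong (λ z → w ^ n * 2 ^ B * (suc w ^ E * z)) (^-distribˡ-+-* w E Δ) ⟩
    w ^ n * 2 ^ B * (suc w ^ E * (w ^ E * w ^ Δ)) ≡⟨ lem (w ^ n) (2 ^ B) (suc w ^ E) (w ^ E) (w ^ Δ) ⟩
    w ^ n * (suc w ^ E * (2 ^ B * w ^ Δ) * w ^ E) ≤⟨ *-monoʳ-≤ (w ^ n) (*-monoˡ-≤ (w ^ E) (*-monoʳ-≤ (suc w ^ E) (exp-doubling B Δ (m≤m+n _ c)))) ⟩
    w ^ n * (suc w ^ E * suc w ^ Δ * w ^ E)      ≡⟨ cong (λ z → w ^ n * (z * w ^ E)) (sym (^-distribˡ-+-* (suc w) E Δ)) ⟩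
    w ^ n * (suc w ^ (E + Δ) * w ^ E)            ≡⟨ cong₂ (λ x y → w ^ n * (suc w ^ x * w ^ y)) (sym sum-e′) (sym sum-e) ⟩
    w ^ n * (suc w ^ ∑ n e′ * w ^ ∑ n e)         ≤⟨ power-product n w f e e′ each ⟩
    ∏ n f * (suc w ^ ∑ n e * w ^ ∑ n e′)         ≡⟨ cong₂ (λ x y → ∏ n f * (suc w ^ x * w ^ y)) sum-e sum-e′ ⟩
    ∏ n f * (suc w ^ E * w ^ (E + Δ))            ∎)
    where
    open ≤-Reasoning
    E = (L + 2) * ∑ n j + T * # b
    Δ = w * B + c
    e e′ : Fin n → ℕ
    e  u = (L + 2) * j u + T * 𝟙 (b u)
    e′ u = L * T * 𝟙 (b u)
    instance
      nz : NonZero (suc w ^ E * w ^ (E + Δ))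
      nz = m*n≢0 (suc w ^ E) (w ^ (E + Δ)) {{m^n≢0 (suc w) E}} {{m^n≢0 w (E + Δ)}}
    sum-e : ∑ n e ≡ E
    sum-e = trans (∑-+ n _ _) (cong₂ _+_ (∑-*ˡ n (L + 2) j) (∑-*ˡ n T (𝟙 ∘ b)))
    sum-e′ : ∑ n e′ ≡ E + Δ
    sum-e′ = trans (∑-*ˡ n (L * T) (𝟙 ∘ b)) (trans (sym eq) (+-assoc E (w * B) c))
    lem : ∀ a b c d e → a * b * (c * (d * e)) ≡ a * (c * (b * e) * d)
    lem = solve-∀
    exp-true : ∀ j T → (L + 2) * j + T * 1 ≡ L * j + 2 * j + T
    exp-true j T = ring L j T
      where
      ring : ∀ L j T → (L + 2) * j + T * 1 ≡ L * j + 2 * j + T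
      ring = solve-∀
    exp-false : ∀ j T → (L + 2) * j + T * 0 ≡ L * j + 2 * j
    exp-false j T = ring L j T
      where
      ring : ∀ L j T → (L + 2) * j + T * 0 ≡ L * j + 2 * j
      ring = solve-∀
    each : ∀ u → w * (suc w ^ e′ u * w ^ e u) ≤ f u * (suc w ^ e u * w ^ e′ u)
    each u with b u in eqb
    ... | true rewrite exp-true (j u) T | *-identityʳ (L * T) with difference (*-monoʳ-≤ L (j≤T u))
    ... | U , e₁ = subst (λ z → w * (suc w ^ (L * T) * w ^ (L * j u + 2 * j u + T)) ≤ z * (suc w ^ (L * j u + 2 * j u + T) * w ^ (L * T)))
                     (sym fu) (factor-up (j u) U (trans (+-comm U _) e₁))
      where
      fu : f u ≡ w + U
      fu = +-cancelʳ-≡ (L * j u) _ _ (trans (up u eqb) (trans (cong (w +_) (trans (sym e₁) (+-comm _ U))) (sym (+-assoc w U _))))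
    each u | false rewrite exp-false (j u) T | *-zeroʳ (L * T) =
      subst₂ (λ x y → w * x ≤ f u * y) (sym (*-identityˡ _)) (sym (*-identityʳ _)) (factor-down (j u) (f u) (j≤T u) (down u eqb))

-- Random labels, Chernoff potentials and their derandomisation.

module Labels (T₀ H : ℕ) where

  Label : Set
  Label = Fin T₀ × Fin H

  ∑ᴸ : (Label → ℕ) → ℕ
  ∑ᴸ f = ∑ T₀ (λ e → ∑ H (λ z → f (e , z)))

  size : (Label → Bool) → ℕ
  size p = ∑ᴸ (𝟙 ∘ p)

  T : ℕ
  T = T₀ * H

  ∑ᴸ-cong : ∀ {f g} → (∀ x → f x ≡ g x) → ∑ᴸ f ≡ ∑ᴸ g
  ∑ᴸ-cong h = ∑-cong (λ e → ∑-cong (λ z → h (e , z)))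

  ∑ᴸ-+ : ∀ f g → ∑ᴸ (λ x → f x + g x) ≡ ∑ᴸ f + ∑ᴸ g
  ∑ᴸ-+ f g = trans (∑-cong (λ e → ∑-+ H (λ z → f (e , z)) (λ z → g (e , z)))) (∑-+ T₀ _ _)

  ∑ᴸ-*ˡ : ∀ c f → ∑ᴸ (λ x → c * f x) ≡ c * ∑ᴸ f
  ∑ᴸ-*ˡ c f = trans (∑-cong (λ e → ∑-*ˡ H c (λ z → f (e , z)))) (∑-*ˡ T₀ c _)

  ∑ᴸ-const : ∀ c → ∑ᴸ (λ _ → c) ≡ T * c
  ∑ᴸ-const c = trans (∑-cong {T₀} (λ _ → ∑-const H c)) (trans (∑-const T₀ (H * c)) (sym (*-assoc T₀ H c)))

  size-not : ∀ p → size p + size (not ∘ p) ≡ T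
  size-not p = trans (sym (∑ᴸ-+ _ _)) (trans (∑ᴸ-cong (λ x → 𝟙-not (p x))) (trans (∑ᴸ-const 1) (*-identityʳ T)))

  size≤T : ∀ p → size p ≤ T
  size≤T p = ≤-trans (m≤m+n _ _) (≤-reflexive (size-not p))

  ∑ᴸ-average : ∀ f → 0 < T₀ → 0 < H → ∃[ x ] T * f x ≤ ∑ᴸ f
  ∑ᴸ-average f 0<T₀ 0<H with ∑-average T₀ (λ e → ∑ H (λ z → f (e , z))) 0<T₀
  ... | e , he with ∑-average H (λ z → f (e , z)) 0<H
  ... | z , hz = (e , z) , ≤-trans (≤-reflexive (*-assoc T₀ H _)) (≤-trans (*-monoʳ-≤ T₀ hz) he)

  -- All factors have mean at most one common `Ω`, so that potentials of tail bounds with different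
  -- `L` can be added. `coef` is the weight of the constraint and, during derandomisation, also
  -- holds the factors of the vertices already labelled.
  record Constraint (n Ω : ℕ) : Set where
    constructor constraint
    field
      coef   : ℕ
      factor : Fin n → Label → ℕ
      fair   : ∀ u → ∑ᴸ (factor u) ≤ T * Ω
  open Constraint public

  potential : ∀ {n Ω} → (Fin n → Label) → Constraint n Ω → ℕ
  potential x c = coef c * ∏ _ (λ u → factor c u (x u))

  -- Method of conditional expectations: labels are fixed one vertex at a time,
  -- never increasing the expected total potential.
  derandomise : ∀ n {Ω} → 0 < T₀ → 0 < H → (cs : List (Constraint n Ω)) →
    Σ (Fin n → Label) λ x → ∑L (potential x) cs ≤ Ω ^ n * ∑L coef cs
  derandomise zero 0<T₀ 0<H cs = (λ ()) , ≤-reflexive (trans (∑L-cong (λ c → *-identityʳ (coef c)) cs) (sym (+-identityʳ _)))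
  derandomise (suc n) {Ω} 0<T₀ 0<H cs = extend
    where
    first : Label → ℕ
    first t = ∑L (λ c → coef c * factor c zero t) cs
    total : ∑ᴸ first ≤ T * (Ω * ∑L coef cs)
    total = begin
      ∑ᴸ first                                        ≡⟨ ∑-cong (λ e → ∑-∑L-swap (λ z c → coef c * factor c zero (e , z)) cs) ⟩
      ∑ T₀ (λ e → ∑L (λ c → ∑ H (λ z → coef c * factor c zero (e , z))) cs) ≡⟨ ∑-∑L-swap {T₀} (λ e c → ∑ H (λ z → coef c * factor c zero (e , z))) cs ⟩
      ∑L (λ c → ∑ᴸ (λ t → coef c * factor c zero t)) cs ≤⟨ ∑L-mono (λ c → ≤-trans (≤-reflexive (∑ᴸ-*ˡ (coef c) _)) (*-monoʳ-≤ (coef c) (fair c zero))) cs ⟩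
      ∑L (λ c → coef c * (T * Ω)) cs                  ≡⟨ ∑L-cong (λ c → *-comm (coef c) (T * Ω)) cs ⟩
      ∑L (λ c → T * Ω * coef c) cs                    ≡⟨ ∑L-*ˡ (T * Ω) coef cs ⟩
      T * Ω * ∑L coef cs                              ≡⟨ *-assoc T Ω _ ⟩
      T * (Ω * ∑L coef cs)                            ∎
      where open ≤-Reasoning
    extend : Σ (Fin (suc n) → Label) λ x → ∑L (potential x) cs ≤ Ω ^ suc n * ∑L coef cs
    extend with ∑ᴸ-average first 0<T₀ 0<H
    ... | t , ht with derandomise n 0<T₀ 0<H (map restrict cs)
      where
      restrict : Constraint (suc n) Ω → Constraint n Ω
      restrict c = constraint (coef c * factor c zero t) (factor c ∘ suc) (fair c ∘ suc)
    ... | y , hy = x , (begin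
      ∑L (potential x) cs           ≡⟨ ∑L-cong (λ c → sym (*-assoc (coef c) _ _)) cs ⟩
      ∑L (λ c → coef c * factor c zero t * ∏ n (λ u → factor c (suc u) (y u))) cs ≡⟨ ∑L-map (potential y) _ cs ⟨
      ∑L (potential y) (map _ cs)   ≤⟨ hy ⟩
      Ω ^ n * ∑L coef (map _ cs)    ≡⟨ cong (Ω ^ n *_) (∑L-map coef _ cs) ⟩
      Ω ^ n * first t               ≤⟨ *-monoʳ-≤ (Ω ^ n) first≤ ⟩
      Ω ^ n * (Ω * ∑L coef cs)      ≡⟨ lem (Ω ^ n) Ω _ ⟩
      Ω * Ω ^ n * ∑L coef cs        ∎)
      where
      open ≤-Reasoning
      lem : ∀ a b c → a * (b * c) ≡ b * a * c
      lem = solve-∀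
      instance
        T-nonZero : NonZero T
        T-nonZero = >-nonZero (*-mono-< 0<T₀ 0<H)
      first≤ : first t ≤ Ω * ∑L coef cs
      first≤ = *-cancelˡ-≤ T (≤-trans ht total)
      x : Fin (suc n) → Label
      x zero    = t
      x (suc u) = y u

  module _ (0<T₀ : 0 < T₀) (0<H : 0 < H) (L : ℕ) (2≤L : 2 ≤ L) {n : ℕ} (S : Fin n → Label → Bool) where
    private
      j : Fin n → ℕ
      j u = size (S u)

    -- Divided by `L² T`, this is `1 + (indicator - p) / L` with `p = j u / T` the probability of
    -- `S u`: the linearised exponential moment, of mean exactly 1.
    chernoffFactor : Fin n → Label → ℕ
    chernoffFactor u x = if S u x then L * L * T + L * (T ∸ j u) else L * L * T ∸ L * j u

    private
      down : ∀ u → (L * L * T ∸ L * j u) + L * j u ≡ L * L * T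
      down u = m∸n+n≡m (≤-trans (*-monoʳ-≤ L (size≤T (S u)))
        (≤-trans (*-monoʳ-≤ L (≤-trans (≤-reflexive (sym (*-identityˡ T))) (*-monoˡ-≤ T (<⇒≤ 2≤L)))) (≤-reflexive (sym (*-assoc L L T)))))

      split-factor : ∀ u x → chernoffFactor u x ≡
        (L * L * T + L * (T ∸ j u)) * 𝟙 (S u x) + (L * L * T ∸ L * j u) * 𝟙 (not (S u x))
      split-factor u x with S u x
      ... | true  = lem (L * L * T + L * (T ∸ j u)) (L * L * T ∸ L * j u)
        where
        lem : ∀ a b → a ≡ a * 1 + b * 0
        lem = solve-∀
      ... | false = lem (L * L * T + L * (T ∸ j u)) (L * L * T ∸ L * j u)
        where
        lem : ∀ a b → b ≡ a * 0 + b * 1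
        lem = solve-∀

      factor-total : ∀ u → ∑ᴸ (chernoffFactor u) ≡ T * (L * L * T)
      factor-total u = begin
        ∑ᴸ (chernoffFactor u)         ≡⟨ ∑ᴸ-cong (split-factor u) ⟩
        _                             ≡⟨ ∑ᴸ-+ _ _ ⟩
        _                             ≡⟨ cong₂ _+_ (∑ᴸ-*ˡ a (𝟙 ∘ S u)) (∑ᴸ-*ˡ d (𝟙 ∘ not ∘ S u)) ⟩
        a * j u + d * j′              ≡⟨ cong (λ z → (L * L * T + L * z) * j u + d * j′) T∸j ⟩
        (L * L * T + L * j′) * j u + d * j′ ≡⟨ cong (λ z → (z + L * j′) * j u + d * j′) (sym (down u)) ⟩
        (d + L * j u + L * j′) * j u + d * j′ ≡⟨ lem L (j u) j′ d ⟩
        (j u + j′) * (d + L * j u)    ≡⟨ cong₂ _*_ (size-not (S u)) (down u) ⟩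
        T * (L * L * T)               ∎
        where
        open ≡-Reasoning
        a = L * L * T + L * (T ∸ j u)
        d = L * L * T ∸ L * j u
        j′ = size (not ∘ S u)
        T∸j : T ∸ j u ≡ j′
        T∸j = trans (cong (_∸ j u) (sym (size-not (S u)))) (m+n∸m≡n (j u) j′)
        lem : ∀ L j k d → (d + L * j + L * k) * j + d * k ≡ (j + k) * (d + L * j)
        lem = solve-∀

    chernoff : (coef κ Ω : ℕ) → κ * (L * L * T) ≡ Ω → Constraint n Ω
    chernoff coef κ Ω e = constraint coef (λ u x → κ * chernoffFactor u x)
      (λ u → ≤-reflexive (trans (∑ᴸ-*ˡ κ (chernoffFactor u))
        (trans (cong (κ *_) (factor-total u)) (trans (lem κ T (L * L * T)) (cong (T *_) e)))))
      where
      lem : ∀ a b c → a * (b * c) ≡ b * (a * c)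
      lem = solve-∀

    hits : (Fin n → Label) → ℕ
    hits x = # (λ u → S u (x u))

    potential-chernoff : ∀ coef κ Ω (e : κ * (L * L * T) ≡ Ω) x B →
      (L + 2) * ∑ n j + T * hits x + L * L * T * B ≤ L * T * hits x →
      coef * (Ω ^ n * 2 ^ B) ≤ potential x (chernoff coef κ Ω e)
    potential-chernoff coef κ Ω e x B h = *-monoʳ-≤ coef (begin
      Ω ^ n * 2 ^ B                        ≡⟨ cong (λ z → z ^ n * 2 ^ B) (sym e) ⟩
      (κ * (L * L * T)) ^ n * 2 ^ B        ≡⟨ cong (_* 2 ^ B) (^-distribʳ-* n κ (L * L * T)) ⟩
      κ ^ n * (L * L * T) ^ n * 2 ^ B      ≡⟨ *-assoc (κ ^ n) _ _ ⟩
      κ ^ n * ((L * L * T) ^ n * 2 ^ B)    ≤⟨ *-monoʳ-≤ (κ ^ n) (potential-large L T 2≤L (*-mono-< 0<T₀ 0<H) j (λ u → S u (x u)) f (λ u → size≤T (S u)) on off B h) ⟩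
      κ ^ n * ∏ n f                        ≡⟨ ∏-* n κ f ⟨
      ∏ n (λ u → κ * f u)                  ∎)
      where
      open ≤-Reasoning
      f : Fin n → ℕ
      f u = chernoffFactor u (x u)
      on : ∀ u → S u (x u) ≡ true → f u + L * j u ≡ L * L * T + L * T
      on u eq rewrite eq = trans (+-assoc (L * L * T) _ _) (cong (L * L * T +_)
        (trans (sym (*-distribˡ-+ L (T ∸ j u) (j u))) (cong (L *_) (m∸n+n≡m (size≤T (S u))))))
      off : ∀ u → S u (x u) ≡ false → f u + L * j u ≡ L * L * T
      off u eq rewrite eq = down u

-- Updates of sets and weightings, and clashes between pairs of values.

_==_ : Fin n → Fin n → Bool
x == y = does (x ≟F y)

==-refl : (v : Fin n) → (v == v) ≡ true
==-refl v = dec-true (v ≟F v) refl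

==-≢ : {x v : Fin n} → x ≢ v → (x == v) ≡ false
==-≢ {x = x} {v} h = dec-false (x ≟F v) h

==-true : {x v : Fin n} → (x == v) ≡ true → x ≡ v
==-true {x = x} {v} h with x ≟F v
... | yes e = e

insert : Fin n → (Fin n → Bool) → Fin n → Bool
insert v P x = (x == v) ∨ P x

delete : Fin n → (Fin n → Bool) → Fin n → Bool
delete v P x = not (x == v) ∧ P x

insert-self : (v : Fin n) (P : Fin n → Bool) → insert v P v ≡ true
insert-self v P = ∨-trueˡ (==-refl v)

insert-⊇ : ∀ {v x : Fin n} {P} → P x ≡ true → insert v P x ≡ true
insert-⊇ {v = v} {x} h = ∨-trueʳ {x == v} h

insert-≢ : ∀ {v x : Fin n} {P} → x ≢ v → insert v P x ≡ P x
insert-≢ ne rewrite ==-≢ ne = refl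

insert-true⁻ : ∀ {v x : Fin n} {P} → insert v P x ≡ true → x ≡ v ⊎ P x ≡ true
insert-true⁻ {v = v} {x} h with ∨-true⁻ {x == v} h
... | inj₁ e = inj₁ (==-true e)
... | inj₂ e = inj₂ e

insert-false⁻ : ∀ {v x : Fin n} {P} → insert v P x ≡ false → x ≢ v × P x ≡ false
insert-false⁻ {v = v} {x} {P} h with ∨-false⁻ {x == v} h
... | a , b = (λ { refl → true≢false (==-refl x) a }) , b

delete-self : (v : Fin n) (P : Fin n → Bool) → delete v P v ≡ false
delete-self v P rewrite ==-refl v = refl

delete-≢ : ∀ {v x : Fin n} {P} → x ≢ v → delete v P x ≡ P x
delete-≢ ne rewrite ==-≢ ne = refl

delete-⊆ : ∀ {v x : Fin n} {P} → delete v P x ≡ true → P x ≡ true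
delete-⊆ {v = v} {x} h = proj₂ (∧-true⁻ {not (x == v)} h)

insert-delete : ∀ {v : Fin n} {P} → P v ≡ true → ∀ x → P x ≡ insert v (delete v P) x
insert-delete {v = v} {P} h x with x ≟F v
... | yes refl = h
... | no  ne   = refl

#-delete : ∀ {v : Fin n} {P} → P v ≡ true → # (delete v P) < # P
#-delete {n} {v} {P} h = ≤-reflexive (begin
  suc (# (delete v P))     ≡⟨ cong suc (sym (trans (+-identityʳ _) refl)) ⟩
  suc (# (delete v P) + 0) ≡⟨ +-suc _ 0 ⟨
  # (delete v P) + 1       ≡⟨ cong (# (delete v P) +_) (sym (cong 𝟙 h)) ⟩
  # (delete v P) + 𝟙 (P v) ≡⟨ ∑-update (𝟙 ∘ delete v P) (𝟙 ∘ P) v (λ i ne → cong 𝟙 (delete-≢ {P = P} ne)) ⟩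
  # P + 𝟙 (delete v P v)   ≡⟨ cong (# P +_) (cong 𝟙 (delete-self v P)) ⟩
  # P + 0                  ≡⟨ +-identityʳ _ ⟩
  # P                      ∎)
  where open ≡-Reasoning

assign : (Fin n → ℕ) → Fin n → ℕ → Fin n → ℕ
assign a v x y = if y == v then x else a y

assign-self : (a : Fin n → ℕ) (v : Fin n) (x : ℕ) → assign a v x v ≡ x
assign-self a v x rewrite ==-refl v = refl

assign-≢ : ∀ {a : Fin n → ℕ} {v y x} → y ≢ v → assign a v x y ≡ a y
assign-≢ ne rewrite ==-≢ ne = refl

setRow : (Fin n → Fin n → ℕ) → Fin n → (Fin n → ℕ) → Fin n → Fin n → ℕ
setRow W v f x y = if x == v then f y else (if y == v then f x else W x y)

setRow-row : ∀ (W : Fin n → Fin n → ℕ) v f y → setRow W v f v y ≡ f y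
setRow-row W v f y rewrite ==-refl v = refl

setRow-col : ∀ (W : Fin n → Fin n → ℕ) v f {x} → x ≢ v → setRow W v f x v ≡ f x
setRow-col W v f ne rewrite ==-≢ ne | ==-refl v = refl

setRow-other : ∀ (W : Fin n → Fin n → ℕ) v f {x y} → x ≢ v → y ≢ v → setRow W v f x y ≡ W x y
setRow-other W v f ne ne′ rewrite ==-≢ ne | ==-≢ ne′ = refl

setRow-sym : ∀ {W : Fin n → Fin n → ℕ} v f → (∀ x y → W x y ≡ W y x) → ∀ x y → setRow W v f x y ≡ setRow W v f y x
setRow-sym v f h x y with x ≟F v | y ≟F v
... | yes refl | yes refl = refl
... | yes refl | no _ = refl
... | no _ | yes refl = refl
... | no _ | no _ = h x y

-- The pairs `{x, x + s}` and `{y, y + s}`, the values still open to two processed vertices, are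
-- disjoint.
Apart : ℕ → ℕ → ℕ → Set
Apart s x y = x ≢ y × x ≢ y + s × x + s ≢ y

Apart-sym : ∀ {s x y} → Apart s x y → Apart s y x
Apart-sym (a , b , c) = (a ∘ sym) , (c ∘ sym) , (b ∘ sym)

Apart-+ : ∀ {s x y} t → Apart s x y → Apart s (x + t) (y + t)
Apart-+ {s} {x} {y} t (a , b , c) =
  (λ e → a (+-cancelʳ-≡ t x y e)) ,
  (λ e → b (+-cancelʳ-≡ t x (y + s) (trans e (lem y t s)))) ,
  (λ e → c (+-cancelʳ-≡ t (x + s) y (trans (sym (lem x t s)) e)))
  where
  lem : ∀ y t s → y + t + s ≡ y + s + t
  lem = solve-∀

-- Contains every offset `t` for which `D + t` is not `Apart` from `y`. Truncated subtraction may
-- add further offsets but never loses one.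
clashes : ℕ → ℕ → ℕ → List ℕ
clashes s D y = (y ∸ D) ∷ (y + s ∸ D) ∷ (y ∸ (D + s)) ∷ []

clashes-apart : ∀ {s D y t} → t ∉ clashes s D y → Apart s (D + t) y
clashes-apart {s} {D} {y} {t} h =
  (λ { refl → h (here (sym (m+n∸m≡n D t))) }) ,
  (λ e → h (there (here (sym (trans (cong (_∸ D) (sym e)) (m+n∸m≡n D t)))))) ,
  (λ { refl → h (there (there (here (sym (trans (cong (_∸ (D + s)) (lem D t s)) (m+n∸m≡n (D + s) t)))))) })
  where
  lem : ∀ D t s → D + t + s ≡ D + s + t
  lem = solve-∀

∑-length-flat : ∀ {A : Set} m (F : Fin m → List A) → length (flat m F) ≡ ∑ m (λ i → length (F i))
∑-length-flat zero    F = refl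
∑-length-flat (suc m) F = trans (length-++ (F zero)) (cong (length (F zero) +_) (∑-length-flat m (F ∘ suc)))

-- A pair `{x, x + s}` inside `[D, D + 3 s)` can only meet `{a u, a u + s}` if `a u + s ≥ D` and
-- `a u < D + 3 s`.
near : (s : ℕ) (P : Fin n → Bool) (a : Fin n → ℕ) (D : ℕ) → Fin n → Bool
near s P a D u = P u ∧ ((D ≤ᵇ a u + s) ∧ (a u <ᵇ D + 3 * s))

cost : (s : ℕ) (P : Fin n → Bool) (a : Fin n → ℕ) (D : ℕ) → ℕ
cost s P a D = # (near s P a D)

-- `D` determines which vertices are near, `D₁` is the point from which the offset counts. They
-- differ only for the middle vertex of a path, which receives two offsets.
allClashes : (s : ℕ) (P : Fin n → Bool) (a : Fin n → ℕ) (D D₁ : ℕ) → List ℕ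
allClashes {n} s P a D D₁ = flat n (λ u → if near s P a D u then clashes s D₁ (a u) else [])

allClashes-length : ∀ s (P : Fin n → Bool) a D D₁ → length (allClashes s P a D D₁) ≡ 3 * cost s P a D
allClashes-length {n} s P a D D₁ = trans (∑-length-flat n _) (trans (∑-cong each) (∑-*ˡ n 3 _))
  where
  each : ∀ u → length (if near s P a D u then clashes s D₁ (a u) else []) ≡ 3 * 𝟙 (near s P a D u)
  each u with near s P a D u
  ... | true  = refl
  ... | false = refl

≤ᵇ-true : ∀ {x y} → x ≤ y → (x ≤ᵇ y) ≡ true
≤ᵇ-true {x} {y} h with x ≤ᵇ y | ≤⇒≤ᵇ h
... | true | _ = refl

≤ᵇ-true⁻ : ∀ {x y} → (x ≤ᵇ y) ≡ true → x ≤ y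
≤ᵇ-true⁻ {x} {y} h = ≤ᵇ⇒≤ x y (subst Tᵇ (sym h) tt)

≤ᵇ-false⁻ : ∀ {x y} → (x ≤ᵇ y) ≡ false → y < x
≤ᵇ-false⁻ h = ≰⇒> (λ le → true≢false (≤ᵇ-true le) h)

<ᵇ-true : ∀ {x y} → x < y → (x <ᵇ y) ≡ true
<ᵇ-true {x} {y} h with x <ᵇ y | <⇒<ᵇ h
... | true | _ = refl

<ᵇ-true⁻ : ∀ {x y} → (x <ᵇ y) ≡ true → x < y
<ᵇ-true⁻ {x} {y} h = <ᵇ⇒< x y (subst Tᵇ (sym h) tt)

<ᵇ-false⁻ : ∀ {x y} → (x <ᵇ y) ≡ false → y ≤ x
<ᵇ-false⁻ h = ≮⇒≥ (λ lt → true≢false (<ᵇ-true lt) h)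

far-above : ∀ {s x y} → y + s < x → Apart s x y
far-above {s} {x} {y} h = (λ { refl → <⇒≱ h (m≤m+n x s) }) , (λ { refl → <-irrefl refl h }) ,
  (λ { refl → <⇒≱ h (≤-trans (m≤m+n x s) (m≤m+n (x + s) s)) })

allClashes-apart : ∀ {s} {P : Fin n → Bool} {a D D₁ t} → t ∉ allClashes s P a D D₁ → D ≤ D₁ → D₁ + t + s < D + 3 * s →
  ∀ u → P u ≡ true → Apart s (D₁ + t) (a u)
allClashes-apart {n} {s} {P} {a} {D} {D₁} {t} h D≤D₁ bound u Pu
  with D ≤ᵇ a u + s in e₁ | a u <ᵇ D + 3 * s in e₂
... | false | _ = far-above (<-≤-trans (≤ᵇ-false⁻ {D} e₁) (≤-trans D≤D₁ (m≤m+n D₁ t)))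
... | true | false = Apart-sym (far-above (<-≤-trans bound (<ᵇ-false⁻ {a u} e₂)))
... | true | true = clashes-apart (λ m → h (∈-flat _ u (subst (λ b → t ∈ (if b then clashes s D₁ (a u) else [])) (sym is-near) m)))
  where
  is-near : near s P a D u ≡ true
  is-near rewrite Pu | e₁ | e₂ = refl

-- The greedy stage: invariants, moves and order of processing.

module Value {n : ℕ} (G : Graph n) where

  edge : (Fin n → Fin n → ℕ) → Fin n → Fin n → ℕ
  edge W v u = if adj G v u then W v u else 0

  val : (Fin n → Fin n → ℕ) → Fin n → ℕ
  val W v = ∑ n (edge W v)

  edge-true : ∀ W {u v} → adj G u v ≡ true → edge W u v ≡ W u v
  edge-true W h rewrite h = refl

record Absorbed {n : ℕ} (G : Graph n) (R : Fin n → Bool) (Hd : Fin n → Fin n → Bool) (s : ℕ)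
  (W₀ : Fin n → Fin n → ℕ) (Free : ℕ → Set) : Set where
  open Value G
  field
    W          : Fin n → Fin n → ℕ
    W-sym′     : ∀ u v → W u v ≡ W v u
    W-off      : ∀ u v → Hd u v ≡ false → W u v ≡ W₀ u v
    W-bounds   : ∀ u v → Hd u v ≡ true → 1 ≤ W u v × W u v ≤ 1 + 3 * s
    W-distinct : ∀ u v → R u ≡ true → R v ≡ true → val W u ≡ val W v → u ≡ v
    W-free     : ∀ u → R u ≡ true → Σ ℕ λ D → Free D × D ≤ val W u × val W u < D + 3 * s

-- The final stage, after Kalkowski, Karoński and Pfender.  The vertices of R are
-- processed one after the other; a processed vertex v keeps its weighted degree
-- in a pair {a v , a v + s}, so that a later neighbour may still change their
-- common edge by s in one direction.
module Absorb {n : ℕ} (G : Graph n) (R : Fin n → Bool) (Hd : Fin n → Fin n → Bool)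
  (Hd-sym : ∀ u v → Hd u v ≡ true → Hd v u ≡ true)
  (Hd-adj : ∀ u v → Hd u v ≡ true → adj G u v ≡ true)
  (Hd-R : ∀ u v → Hd u v ≡ true → R u ≡ true)
  (tog : Fin n → Fin n → Bool)
  (tog-Hd : ∀ v u → R v ≡ true → tog v u ≡ true → Hd v u ≡ true)
  (s : ℕ) (W₀ : Fin n → Fin n → ℕ) (W₀-sym : ∀ u v → W₀ u v ≡ W₀ v u)
  (W₀-Hd : ∀ u v → Hd u v ≡ true → W₀ u v ≡ 1 + s)
  (Free : ℕ → Set)
  where

  open Value G

  -- The upper bound leaves room for `x + s`, so that both values of a pair lie in the window of
  -- length `3 s`.
  Located : ℕ → Set
  Located x = Σ ℕ λ D → Free D × D ≤ x × x + s < D + 3 * s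

  -- `B` holds the vertices whose turn has begun, `P` those whose pair is fixed. A designated edge
  -- starts at `1 + s`, gains at most `s` at the turn of its first end, and then moves by at most
  -- `s` in either direction at the turn of its second end: hence the ranges in `half` and `full`.
  record Invariant (W : Fin n → Fin n → ℕ) (B P : Fin n → Bool) (a : Fin n → ℕ) : Set where
    field
      W-sym  : ∀ u v → W u v ≡ W v u
      off    : ∀ u v → Hd u v ≡ false → W u v ≡ W₀ u v
      fresh  : ∀ u v → Hd u v ≡ true → B u ≡ false → B v ≡ false → W u v ≡ 1 + s
      half   : ∀ u v → Hd u v ≡ true → B u ≡ true → B v ≡ false → 1 + s ≤ W u v × W u v ≤ 1 + 2 * s
      full   : ∀ u v → Hd u v ≡ true → B u ≡ true → B v ≡ true → 1 ≤ W u v × W u v ≤ 1 + 3 * s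
      P⊆B    : ∀ u → P u ≡ true → B u ≡ true
      P⊆R    : ∀ u → P u ≡ true → R u ≡ true
      pair   : ∀ u → P u ≡ true → val W u ≡ a u ⊎ val W u ≡ a u + s
      apart  : ∀ u v → P u ≡ true → P v ≡ true → u ≢ v → Apart s (a u) (a v)
      place  : ∀ u → P u ≡ true → Located (a u)
  open Invariant

  Hd-irrefl : ∀ {u v} → Hd u v ≡ true → u ≢ v
  Hd-irrefl {u} h refl = true≢false (Hd-adj u u h) (irref G u)

  bounds : ∀ {W B P a} → Invariant W B P a → ∀ u v → Hd u v ≡ true → 1 ≤ W u v × W u v ≤ 1 + 3 * s
  bounds {W} {B} I u v h with B u in e₁ | B v in e₂
  ... | true  | true  = full I u v h e₁ e₂
  ... | true  | false = ≤-trans (s≤s z≤n) (proj₁ (half I u v h e₁ e₂)) ,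
                        ≤-trans (proj₂ (half I u v h e₁ e₂)) (s≤s (*-monoˡ-≤ s {2} {3} (s≤s (s≤s z≤n))))
  ... | false | true rewrite W-sym I u v =
                        ≤-trans (s≤s z≤n) (proj₁ (half I v u (Hd-sym u v h) e₂ e₁)) ,
                        ≤-trans (proj₂ (half I v u (Hd-sym u v h) e₂ e₁)) (s≤s (*-monoˡ-≤ s {2} {3} (s≤s (s≤s z≤n))))
  ... | false | false rewrite fresh I u v h e₁ e₂ = s≤s z≤n , s≤s (m≤m+n s _)

  val-setRow : ∀ W v f → val (setRow W v f) v ≡ ∑ n (λ u → if adj G v u then f u else 0)
  val-setRow W v f = ∑-cong (λ u → cong (λ z → if adj G v u then z else 0) (setRow-row W v f u))

  val-setRow-other : ∀ W v f {x} → x ≢ v →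
    val (setRow W v f) x + edge W x v ≡ val W x + (if adj G x v then f x else 0)
  val-setRow-other W v f {x} ne = trans
    (∑-update (edge (setRow W v f) x) (edge W x) v
      (λ i ne′ → cong (λ z → if adj G x i then z else 0) (setRow-other W v f ne ne′)))
    (cong (λ z → val W x + (if adj G x v then z else 0)) (setRow-col W v f ne))

  val-setRow-unchanged : ∀ W v f {x} → x ≢ v → f x ≡ W x v → val (setRow W v f) x ≡ val W x
  val-setRow-unchanged W v f {x} ne e = +-cancelʳ-≡ (edge W x v) _ _
    (trans (val-setRow-other W v f ne) (cong (λ z → val W x + (if adj G x v then z else 0)) e))

  record Toggled (W : Fin n → Fin n → ℕ) (B P ex : Fin n → Bool) (a : Fin n → ℕ) (v : Fin n) (D : ℕ) : Set where
    field
      W′    : Fin n → Fin n → ℕ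
      inv′  : Invariant W′ (insert v B) P a
      val′  : val W′ v ≡ D
      away  : ∀ x y → x ≢ v → y ≢ v → W′ x y ≡ W x y
      keep  : ∀ x → ex x ≡ true → W′ v x ≡ W v x
      value : ∀ x → x ≢ v → ex x ≡ true → val W′ x ≡ val W x

  -- Every toggled edge offers two weights that differ by `s`: lowered or unchanged if the neighbour
  -- has the upper value of its pair, unchanged or raised otherwise. If `i` neighbours take the
  -- larger weight, `v` gets `D + i s`, whichever they are. `ex` protects edges, in particular those
  -- to vertices that have begun but have no pair yet, since these cannot afford a change by `s`.
  toggle : ∀ {W B P a} → Invariant W B P a → ∀ v → R v ≡ true → B v ≡ false → (ex : Fin n → Bool) →
    (∀ w → B w ≡ true → P w ≡ false → ex w ≡ true) →
    Σ ℕ λ D → ∀ i → i ≤ # (λ w → tog v w ∧ not (ex w)) → Toggled W B P ex a v (D + i * s)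
  toggle {W} {B} {P} {a} I v Rv Bv ex pending = ∑ n (λ u → if adj G v u then low u else 0) , go
    where
    t high : Fin n → Bool
    t w = tog v w ∧ not (ex w)
    high w = P w ∧ does (val W w ≟ a w + s)
    low : Fin n → ℕ
    low w = if t w then (if high w then W v w ∸ s else W v w) else W v w

    t-Hd : ∀ w → t w ≡ true → Hd v w ≡ true
    t-Hd w h = tog-Hd v w Rv (proj₁ (∧-true⁻ h))
    t-ex : ∀ w → ex w ≡ true → t w ≡ false
    t-ex w h = not-¬-true (λ e → true≢false (proj₂ (∧-true⁻ {tog v w} e)) (cong not h))

    low≤ : ∀ w → low w ≤ W v w
    low≤ w with t w | high w
    ... | true  | true  = m∸n≤m _ s
    ... | true  | false = ≤-refl
    ... | false | _     = ≤-refl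
    ≤low : ∀ w → W v w ∸ s ≤ low w
    ≤low w with t w | high w
    ... | true  | true  = ≤-refl
    ... | true  | false = m∸n≤m _ s
    ... | false | _     = m∸n≤m _ s
    low-unprocessed : ∀ w → P w ≡ false → low w ≡ W v w
    low-unprocessed w h rewrite h with t w
    ... | true  = refl
    ... | false = refl

    low-high : ∀ w → t w ≡ true → P w ≡ true → val W w ≡ a w + s → low w ≡ W v w ∸ s
    low-high w et Pw hi rewrite et | Pw | dec-true (val W w ≟ a w + s) hi = refl
    low-low : ∀ w → val W w ≢ a w + s → low w ≡ W v w
    low-low w ¬hi rewrite dec-false (val W w ≟ a w + s) ¬hi with t w | P w
    ... | true  | true  = refl
    ... | true  | false = refl
    ... | false | _     = refl

    v≥1+s : ∀ w → Hd v w ≡ true → 1 + s ≤ W v w × W v w ≤ 1 + 2 * s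
    v≥1+s w h with B w in eB
    ... | true rewrite W-sym I v w = half I w v (Hd-sym v w h) eB Bv
    ... | false rewrite fresh I v w h Bv eB = ≤-refl , s≤s (m≤m+n s _)

    go : ∀ i → i ≤ # t → Toggled W B P ex a v (∑ n (λ u → if adj G v u then low u else 0) + i * s)
    go i i≤ with choose-subset t i i≤
    ... | χ , χ⊆t , #χ = record
      { W′ = W′ ; inv′ = inv′ ; val′ = val′
      ; away = λ x y → setRow-other W v f
      ; keep = λ x h → trans (setRow-row W v f x) (f-off x (t-ex x h))
      ; value = λ x ne h → val-setRow-unchanged W v f ne (trans (f-off x (t-ex x h)) (W-sym I v x)) }
      where
      f : Fin n → ℕ
      f u = low u + s * 𝟙 (χ u)
      W′ = setRow W v f

      χ-off : ∀ u → t u ≡ false → χ u ≡ false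
      χ-off u h = not-¬-true (λ e → true≢false (χ⊆t u e) h)
      f-off : ∀ u → t u ≡ false → f u ≡ W v u
      f-off u h rewrite χ-off u h | h | *-zeroʳ s = +-identityʳ _

      val′ : val W′ v ≡ ∑ n (λ u → if adj G v u then low u else 0) + i * s
      val′ = trans (val-setRow W v f) (trans (∑-cong each) (trans (∑-+ n _ _)
        (cong (∑ n (λ u → if adj G v u then low u else 0) +_) (trans (∑-*ˡ n s (𝟙 ∘ χ)) (trans (cong (s *_) #χ) (*-comm s i))))))
        where
        each : ∀ u → (if adj G v u then f u else 0) ≡ (if adj G v u then low u else 0) + s * 𝟙 (χ u)
        each u with adj G v u in ea
        ... | true  = refl
        ... | false rewrite not-¬-true {χ u} (λ e → true≢false (Hd-adj v u (t-Hd u (χ⊆t u e))) ea) = sym (*-zeroʳ s)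

      s𝟙≤s : ∀ b → s * 𝟙 b ≤ s
      s𝟙≤s b = ≤-trans (*-monoʳ-≤ s (𝟙≤1 b)) (≤-reflexive (*-identityʳ s))

      row-fresh : ∀ y → Hd v y ≡ true → B y ≡ false → 1 + s ≤ f y × f y ≤ 1 + 2 * s
      row-fresh y h By = subst (λ z → 1 + s ≤ z + s * 𝟙 (χ y) × z + s * 𝟙 (χ y) ≤ 1 + 2 * s) (sym low≡)
        (m≤m+n _ _ , ≤-trans (+-monoʳ-≤ (1 + s) (s𝟙≤s (χ y))) (≤-reflexive (lem s)))
        where
        low≡ : low y ≡ 1 + s
        low≡ = trans (low-unprocessed y (not-¬-true (λ e → true≢false (P⊆B I y e) By))) (fresh I v y h Bv By)
        lem : ∀ s → 1 + s + s ≡ 1 + 2 * s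
        lem = solve-∀

      row-full : ∀ y → Hd v y ≡ true → 1 ≤ f y × f y ≤ 1 + 3 * s
      row-full y h = ≤-trans (m+n≤o⇒m≤o∸n 1 (proj₁ (v≥1+s y h))) (≤-trans (≤low y) (m≤m+n _ _)) ,
        ≤-trans (+-mono-≤ (≤-trans (low≤ y) (proj₂ (v≥1+s y h))) (s𝟙≤s (χ y))) (≤-reflexive (lem s))
        where
        lem : ∀ s → 1 + 2 * s + s ≡ 1 + 3 * s
        lem = solve-∀

      W′-sym : ∀ x y → W′ x y ≡ W′ y x
      W′-sym = setRow-sym v f (W-sym I)

      inv′ : Invariant W′ (insert v B) P a
      W-sym inv′ = W′-sym
      off inv′ x y h with x ≟F v
      ... | yes refl = trans (f-off y (not-¬-true (λ e → true≢false (t-Hd y e) h))) (off I v y h)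
      ... | no ne with y ≟F v
      ... | no ne′ = off I x y h
      ... | yes refl = trans (f-off x (not-¬-true (λ e → true≢false (Hd-sym v x (t-Hd x e)) h))) (trans (W-sym I v x) (off I x v h))
      fresh inv′ x y h ex ey = trans (setRow-other W v f (proj₁ (insert-false⁻ {P = B} ex)) (proj₁ (insert-false⁻ {P = B} ey)))
        (fresh I x y h (proj₂ (insert-false⁻ {v = v} {x} {B} ex)) (proj₂ (insert-false⁻ {v = v} {y} {B} ey)))
      half inv′ x y h ex ey with insert-false⁻ {v = v} {y} {B} ey
      ... | ne′ , By with x ≟F v
      ... | yes refl = row-fresh y h By
      ... | no ne rewrite ==-≢ ne′ = half I x y h ex By
      full inv′ x y h ex ey with x ≟F v
      ... | yes refl = row-full y h
      ... | no ne with y ≟F v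
      ... | yes refl = row-full x (Hd-sym x v h)
      ... | no ne′ = full I x y h ex ey
      P⊆B inv′ u h = insert-⊇ {v = v} {u} {B} (P⊆B I u h)
      P⊆R inv′ = P⊆R I
      apart inv′ = apart I
      place inv′ = place I
      pair inv′ u Pu = by-toggle (t u) refl
        where
        u≢v : u ≢ v
        u≢v refl = true≢false (P⊆B I u Pu) Bv
        by-toggle : ∀ b → t u ≡ b → val W′ u ≡ a u ⊎ val W′ u ≡ a u + s
        by-toggle false et = subst (λ z → z ≡ a u ⊎ z ≡ a u + s)
          (sym (val-setRow-unchanged W v f u≢v (trans (f-off u et) (W-sym I v u)))) (pair I u Pu)
        by-toggle true et = moved (val W u ≟ a u + s) (χ u) refl
          where
          huv = Hd-sym v u (t-Hd u et)
          change : val W′ u + W v u ≡ val W u + f u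
          change = trans (cong (val W′ u +_) (trans (W-sym I v u) (sym (edge-true W (Hd-adj u v huv)))))
            (trans (val-setRow-other W v f u≢v) (cong (λ b → val W u + (if b then f u else 0)) (Hd-adj u v huv)))
          s≤W : s ≤ W v u
          s≤W = ≤-trans (n≤1+n s) (proj₁ (v≥1+s u (t-Hd u et)))
          solution : ∀ {y z} → f u ≡ z → val W u + z ≡ y + W v u → val W′ u ≡ y
          solution e e′ = +-cancelʳ-≡ (W v u) _ _ (trans change (trans (cong (val W u +_) e) e′))
          f-low : ∀ {y z} → low u ≡ y → χ u ≡ z → f u ≡ y + s * 𝟙 z
          f-low e e′ = cong₂ (λ y z → y + s * 𝟙 z) e e′
          moved : Dec (val W u ≡ a u + s) → ∀ b → χ u ≡ b → val W′ u ≡ a u ⊎ val W′ u ≡ a u + s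
          moved (yes hi) true eχ = inj₂ (solution (f-low (low-high u et Pu hi) eχ)
            (cong₂ _+_ hi (trans (cong (W v u ∸ s +_) (*-identityʳ s)) (m∸n+n≡m s≤W))))
          moved (yes hi) false eχ = inj₁ (solution (f-low (low-high u et Pu hi) eχ)
            (trans (cong₂ _+_ hi (trans (cong (W v u ∸ s +_) (*-zeroʳ s)) (+-identityʳ _)))
              (trans (+-assoc (a u) s _) (cong (a u +_) (m+[n∸m]≡n s≤W)))))
          moved (no ¬hi) b eχ with pair I u Pu
          ... | inj₂ hi = ⊥-elim (¬hi hi)
          moved (no ¬hi) true eχ | inj₁ lo = inj₂ (solution (f-low (low-low u ¬hi) eχ)
            (trans (cong₂ _+_ lo (cong (W v u +_) (*-identityʳ s))) (lem (a u) (W v u) s)))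
            where
            lem : ∀ a w s → a + (w + s) ≡ a + s + w
            lem = solve-∀
          moved (no ¬hi) false eχ | inj₁ lo = inj₁ (solution (f-low (low-low u ¬hi) eχ)
            (cong₂ _+_ lo (trans (cong (W v u +_) (*-zeroʳ s)) (+-identityʳ _))))

  record Shifted (W : Fin n → Fin n → ℕ) (B P : Fin n → Bool) (a : Fin n → ℕ) (u v : Fin n) (t : ℕ) : Set where
    field
      W′    : Fin n → Fin n → ℕ
      inv′  : Invariant W′ B P a
      valu  : val W′ u ≡ val W u + t
      valv  : val W′ v ≡ val W v + t
      value : ∀ x → x ≢ u → x ≢ v → val W′ x ≡ val W x
      away  : ∀ x y → y ≢ v → W′ x y ≡ W x y ⊎ x ≡ v

  -- The fine adjustment. It acts on an edge still at `1 + s`, so the result stays within `1 + 2 s`,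
  -- as `half` demands even if `v` has not begun. Both ends gain `t`, hence neither may have its
  -- pair fixed.
  shift : ∀ {W B P a} → Invariant W B P a → ∀ u v → Hd u v ≡ true → B u ≡ true → P u ≡ false → P v ≡ false →
    W u v ≡ 1 + s → ∀ t → t ≤ s → Shifted W B P a u v t
  shift {W} {B} {P} {a} I u v h Bu Pu Pv eq t t≤s = record
    { W′ = W′ ; inv′ = inv′ ; valu = valu ; valv = valv ; value = value ; away = away }
    where
    u≢v = Hd-irrefl h
    auv = Hd-adj u v h
    f : Fin n → ℕ
    f y = if y == v then W u v + t else W u y
    W′ = setRow W u f
    f-v : f v ≡ W u v + t
    f-v rewrite ==-refl v = refl
    f-≢ : ∀ {y} → y ≢ v → f y ≡ W u y
    f-≢ ne rewrite ==-≢ ne = refl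
    same : ∀ x y → x ≢ v → y ≢ v → W′ x y ≡ W x y
    same x y nx ny with x ≟F u
    ... | yes refl = f-≢ ny
    ... | no _ with y ≟F u
    ... | yes refl = trans (f-≢ nx) (W-sym I u x)
    ... | no _ = refl
    valv : val W′ v ≡ val W v + t
    valv = +-cancelʳ-≡ (edge W v u) _ _ (trans (val-setRow-other W u f (u≢v ∘ sym))
      (trans (cong (λ b → val W v + (if b then f v else 0)) (Hd-adj v u (Hd-sym u v h)))
        (trans (cong (val W v +_) (trans f-v (cong (_+ t) (trans (W-sym I u v) (sym (edge-true W (Hd-adj v u (Hd-sym u v h))))))))
          (lem (val W v) (edge W v u) t))))
      where
      lem : ∀ a b c → a + (b + c) ≡ a + c + b
      lem = solve-∀
    valu : val W′ u ≡ val W u + t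
    valu = +-cancelʳ-≡ (edge W u v) _ _ (trans (∑-update (edge W′ u) (edge W u) v
        (λ i ne → cong (λ z → if adj G u i then z else 0) (trans (setRow-row W u f i) (f-≢ ne))))
      (trans (cong (val W u +_) (trans (edge-true W′ auv) (trans (setRow-row W u f v) f-v)))
        (trans (lem (val W u) (W u v) t) (cong (val W u + t +_) (sym (edge-true W auv))))))
      where
      lem : ∀ a b c → a + (b + c) ≡ a + c + b
      lem = solve-∀
    value : ∀ x → x ≢ u → x ≢ v → val W′ x ≡ val W x
    value x nu nv = val-setRow-unchanged W u f nu (trans (f-≢ nv) (W-sym I u x))
    away : ∀ x y → y ≢ v → W′ x y ≡ W x y ⊎ x ≡ v
    away x y ny = by (x ≟F v)
      where
      by : Dec (x ≡ v) → W′ x y ≡ W x y ⊎ x ≡ v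
      by (yes e) = inj₂ e
      by (no nx) = inj₁ (same x y nx ny)
    new : W′ u v ≡ 1 + s + t
    new = trans (setRow-row W u f v) (trans f-v (cong (_+ t) eq))
    W′-sym : ∀ x y → W′ x y ≡ W′ y x
    W′-sym = setRow-sym u f (W-sym I)
    new-bounds : 1 + s ≤ W′ u v × W′ u v ≤ 1 + 2 * s
    new-bounds rewrite new = m≤m+n _ _ , ≤-trans (+-monoʳ-≤ (1 + s) t≤s) (≤-reflexive (lem s))
      where
      lem : ∀ s → 1 + s + s ≡ 1 + 2 * s
      lem = solve-∀
    new-bounds′ : 1 ≤ W′ u v × W′ u v ≤ 1 + 3 * s
    new-bounds′ = ≤-trans (s≤s z≤n) (proj₁ new-bounds) , ≤-trans (proj₂ new-bounds) (s≤s (*-monoˡ-≤ s {2} {3} (s≤s (s≤s z≤n))))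

    data Position (x y : Fin n) : Set where
      here-uv : x ≡ u → y ≡ v → Position x y
      here-vu : x ≡ v → y ≡ u → Position x y
      else    : W′ x y ≡ W x y → Position x y
    position : ∀ x y → Position x y
    position x y = by (x ≟F u) (x ≟F v) (y ≟F u) (y ≟F v)
      where
      by : Dec (x ≡ u) → Dec (x ≡ v) → Dec (y ≡ u) → Dec (y ≡ v) → Position x y
      by (yes e) _ _ (yes e′) = here-uv e e′
      by _ (yes e) (yes e′) _ = here-vu e e′
      by _ (no nx) _ (no ny) = else (same x y nx ny)
      by (no nx) _ (no ny) _ = else (setRow-other W u f nx ny)
      by (yes refl) (yes e′) _ _ = ⊥-elim (u≢v e′)
      by _ _ (yes refl) (yes e′) = ⊥-elim (u≢v e′)

    inv′ : Invariant W′ B P a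
    W-sym inv′ = W′-sym
    off inv′ x y hf with position x y
    ... | here-uv refl refl = ⊥-elim (true≢false h hf)
    ... | here-vu refl refl = ⊥-elim (true≢false (Hd-sym u v h) hf)
    ... | else e = trans e (off I x y hf)
    fresh inv′ x y hx bx by with position x y
    ... | here-uv refl refl = ⊥-elim (true≢false Bu bx)
    ... | here-vu refl refl = ⊥-elim (true≢false Bu by)
    ... | else e = trans e (fresh I x y hx bx by)
    half inv′ x y hx bx by with position x y
    ... | here-uv refl refl = new-bounds
    ... | here-vu refl refl = ⊥-elim (true≢false Bu by)
    ... | else e rewrite e = half I x y hx bx by
    full inv′ x y hx bx by with position x y
    ... | here-uv refl refl = new-bounds′
    ... | here-vu refl refl rewrite W′-sym v u = new-bounds′
    ... | else e rewrite e = full I x y hx bx by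
    P⊆B inv′ = P⊆B I
    P⊆R inv′ = P⊆R I
    apart inv′ = apart I
    place inv′ = place I
    pair inv′ x Px = subst (λ z → z ≡ a x ⊎ z ≡ a x + s)
      (sym (value x (λ { refl → true≢false Px Pu }) (λ { refl → true≢false Px Pv }))) (pair I x Px)

  finalise : ∀ {W B P a} → Invariant W B P a → ∀ v → R v ≡ true → B v ≡ true → P v ≡ false → ∀ x → val W v ≡ x →
    Located x → (∀ u → P u ≡ true → Apart s x (a u)) → Invariant W B (insert v P) (assign a v x)
  finalise {W} {B} {P} {a} I v Rv Bv Pv x vx loc ap = record
    { W-sym = W-sym I ; off = off I ; fresh = fresh I ; half = half I ; full = full I
    ; P⊆B = λ u h → case insert-true⁻ {v = v} {u} {P} h of λ { (inj₁ refl) → Bv ; (inj₂ e) → P⊆B I u e }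
    ; P⊆R = λ u h → case insert-true⁻ {v = v} {u} {P} h of λ { (inj₁ refl) → Rv ; (inj₂ e) → P⊆R I u e }
    ; pair = pair′ ; apart = apart′ ; place = place′ }
    where
    ≢v : ∀ {u} → P u ≡ true → u ≢ v
    ≢v Pu refl = true≢false Pu Pv
    pair′ : ∀ u → insert v P u ≡ true → val W u ≡ assign a v x u ⊎ val W u ≡ assign a v x u + s
    pair′ u h with insert-true⁻ {v = v} {u} {P} h
    ... | inj₁ refl rewrite assign-self a u x = inj₁ vx
    ... | inj₂ Pu rewrite assign-≢ {a = a} {x = x} (≢v Pu) = pair I u Pu
    place′ : ∀ u → insert v P u ≡ true → Located (assign a v x u)
    place′ u h with insert-true⁻ {v = v} {u} {P} h
    ... | inj₁ refl rewrite assign-self a u x = loc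
    ... | inj₂ Pu rewrite assign-≢ {a = a} {x = x} (≢v Pu) = place I u Pu
    apart′ : ∀ u w → insert v P u ≡ true → insert v P w ≡ true → u ≢ w → Apart s (assign a v x u) (assign a v x w)
    apart′ u w hu hw ne with insert-true⁻ {v = v} {u} {P} hu | insert-true⁻ {v = v} {w} {P} hw
    ... | inj₁ refl | inj₁ refl = ⊥-elim (ne refl)
    ... | inj₁ refl | inj₂ Pw rewrite assign-self a u x | assign-≢ {a = a} {x = x} (≢v Pw) = ap w Pw
    ... | inj₂ Pu | inj₁ refl rewrite assign-self a w x | assign-≢ {a = a} {x = x} (≢v Pu) = Apart-sym (ap u Pu)
    ... | inj₂ Pu | inj₂ Pw rewrite assign-≢ {a = a} {x = x} (≢v Pu) | assign-≢ {a = a} {x = x} (≢v Pw) = apart I u w Pu Pw ne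

  Invariant-resp : ∀ {W P P′ a} → (∀ x → P′ x ≡ P x) → Invariant W P P a → Invariant W P′ P′ a
  Invariant-resp {W} {P} {P′} {a} e I = record
    { W-sym = W-sym I ; off = off I
    ; fresh = λ u v h x y → fresh I u v h (to x) (to y)
    ; half = λ u v h x y → half I u v h (to x) (to y)
    ; full = λ u v h x y → full I u v h (to x) (to y)
    ; P⊆B = λ _ h → h ; P⊆R = λ u h → P⊆R I u (to h)
    ; pair = λ u h → pair I u (to h)
    ; apart = λ u v h h′ → apart I u v (to h) (to h′)
    ; place = λ u h → place I u (to h) }
    where
    to : ∀ {x b} → P′ x ≡ b → P x ≡ b
    to {x} h = trans (sym (e x)) h

  -- An order of processing.  A vertex v (or a path a – c – b) is processed while
  -- the edge v – u (or the two edges of the path) still has its initial weight.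
  data Schedule : (Fin n → Bool) → Set where
    done   : ∀ {P} → (∀ v → R v ≡ true → P v ≡ true) → Schedule P
    single : ∀ {P P′} v u → P v ≡ false → P u ≡ false → Hd v u ≡ true →
      (∀ x → P′ x ≡ insert v P x) → Schedule P′ → Schedule P
    triple : ∀ {P P′} a b c → P a ≡ false → P b ≡ false → P c ≡ false → a ≢ b → Hd c a ≡ true → Hd c b ≡ true →
      (∀ x → P′ x ≡ insert c (insert b (insert a P)) x) → Schedule P′ → Schedule P

  insert-cong : ∀ v {P Q : Fin n → Bool} → (∀ x → P x ≡ Q x) → ∀ x → insert v P x ≡ insert v Q x
  insert-cong v h x = cong ((x == v) ∨_) (h x)

  Schedule-resp : ∀ {P Q} → (∀ x → P x ≡ Q x) → Schedule P → Schedule Q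
  Schedule-resp e (done h) = done (λ v r → trans (sym (e v)) (h v r))
  Schedule-resp e (single v u pv pu h i S) =
    single v u (trans (sym (e v)) pv) (trans (sym (e u)) pu) h (λ x → trans (i x) (insert-cong v e x)) S
  Schedule-resp e (triple a b c pa pb pc ab ca cb i S) =
    triple a b c (trans (sym (e a)) pa) (trans (sym (e b)) pb) (trans (sym (e c)) pc) ab ca cb
      (λ x → trans (i x) (insert-cong c (insert-cong b (insert-cong a e)) x)) S

  module Scheduling (has-neighbour : ∀ v → R v ≡ true → ∃[ u ] Hd v u ≡ true)
    (no-isolated : ∀ v u → Hd v u ≡ true → ∃[ w ] ((w ≢ u × Hd v w ≡ true) ⊎ (w ≢ v × Hd u w ≡ true))) where

    prepend-triple : ∀ {P a b c} → P a ≡ true → P b ≡ true → P c ≡ true → a ≢ b → Hd c a ≡ true → Hd c b ≡ true →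
      Schedule P → Schedule (delete a (delete b (delete c P)))
    prepend-triple {P} {a} {b} {c} pa pb pc ab ca cb S = triple a b c
      (delete-self a (delete b (delete c P)))
      (trans (delete-≢ {P = delete b (delete c P)} (ab ∘ sym)) (delete-self b (delete c P)))
      (trans (delete-≢ {P = delete b (delete c P)} (Hd-irrefl ca)) (trans (delete-≢ {P = delete c P} (Hd-irrefl cb)) (delete-self c P)))
      ab ca cb
      (λ x → trans (insert-delete {v = c} {P} pc x)
        (insert-cong c (λ y → trans (insert-delete {v = b} {delete c P} Pb y)
          (insert-cong b (insert-delete {v = a} {delete b (delete c P)} Pa) y)) x)) S
      where
      Pb : delete c P b ≡ true
      Pb = trans (delete-≢ {P = P} (Hd-irrefl cb ∘ sym)) pb
      Pa : delete b (delete c P) a ≡ true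
      Pa = trans (delete-≢ {P = delete c P} ab) (trans (delete-≢ {P = P} (Hd-irrefl ca ∘ sym)) pa)

    -- The schedule is built backwards: `P` is what must be processed before the steps found so far.
    -- A vertex of `P` with a designated neighbour outside `P` can come last in `P`. If neither `v`
    -- nor its neighbour `u` has one, the absence of isolated designated edges extends `v u` to a
    -- path inside `P`, and its three vertices come last together.
    schedule-from : ∀ k P → # P ≤ k → (∀ v → P v ≡ true → R v ≡ true) → Schedule P → Schedule (λ _ → false)
    schedule-from k P h P⊆R S with exists P in eq
    ... | false = Schedule-resp (exists-false eq) S
    ... | true with exists⁻ P eq
    schedule-from zero P h P⊆R S | true | v , Pv = ⊥-elim (<⇒≱ (#-pos v Pv) h)
    schedule-from (suc k) P h P⊆R S | true | v , Pv = step v Pv (has-neighbour v (P⊆R v Pv))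
      where
      outside : Fin n → Fin n → Bool
      outside v u = Hd v u ∧ not (P u)
      inside : ∀ {v u} → exists (outside v) ≡ false → Hd v u ≡ true → P u ≡ true
      inside {v} {u} e h with Hd v u | P u | exists-false e u
      ... | true | true | _ = refl
      remove : ∀ v → P v ≡ true → exists (outside v) ≡ true → Schedule (λ _ → false)
      remove v Pv e with exists⁻ (outside v) e
      ... | u , hu = schedule-from k (delete v P) (s≤s⁻¹ (<-≤-trans (#-delete {v = v} {P} Pv) h)) (λ x hx → P⊆R x (delete-⊆ {v = v} {x} {P} hx))
        (single v u (delete-self v P) (trans (delete-≢ {P = P} (Hd-irrefl (proj₁ (∧-true⁻ hu)) ∘ sym)) (not-true⁻ (proj₂ (∧-true⁻ {Hd v u} hu))))
          (proj₁ (∧-true⁻ hu)) (insert-delete Pv) S)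
      remove-triple : ∀ {a b c} → P a ≡ true → P b ≡ true → P c ≡ true → a ≢ b → Hd c a ≡ true → Hd c b ≡ true → Schedule (λ _ → false)
      remove-triple {a} {b} {c} pa pb pc ab ca cb = schedule-from k (delete a (delete b (delete c P)))
        (s≤s⁻¹ (≤-<-trans (#-mono (λ x hx → delete-⊆ {v = b} {x} {delete c P} (delete-⊆ {v = a} {x} {delete b (delete c P)} hx))) (<-≤-trans (#-delete {v = c} {P} pc) h)))
        (λ x hx → P⊆R x (delete-⊆ {v = c} {x} {P} (delete-⊆ {v = b} {x} {delete c P} (delete-⊆ {v = a} {x} {delete b (delete c P)} hx))))
        (prepend-triple pa pb pc ab ca cb S)
      step : ∀ v → P v ≡ true → ∃[ u ] Hd v u ≡ true → Schedule (λ _ → false)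
      step v Pv (u , vu) with exists (outside v) in e₁
      ... | true = remove v Pv e₁
      ... | false with exists (outside u) in e₂
      ... | true = remove u (inside e₁ vu) e₂
      ... | false with no-isolated v u vu
      ... | w , inj₁ (w≢u , vw) = remove-triple (inside e₁ vu) (inside e₁ vw) Pv (w≢u ∘ sym) vu vw
      ... | w , inj₂ (w≢v , uw) = remove-triple Pv (inside e₂ uw) (inside e₁ vu) (w≢v ∘ sym) (Hd-sym v u vu) uw

    schedule : Schedule (λ _ → false)
    schedule = schedule-from (# R) R ≤-refl (λ _ h → h) (done (λ _ h → h))

  module Run (τ : ℕ)
    (τ≤tog : ∀ v ex → R v ≡ true → # ex ≤ 2 → τ ≤ # (λ w → tog v w ∧ not (ex w)))
    (find : ∀ W P a v D → (∀ x y → Hd x y ≡ false → W x y ≡ W₀ x y) →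
      (∀ x y → Hd x y ≡ true → 1 ≤ W x y × W x y ≤ 1 + 3 * s) →
      (∀ u → P u ≡ true → R u ≡ true) →
      (∀ u → P u ≡ true → val W u ≡ a u ⊎ val W u ≡ a u + s) → R v ≡ true →
      Σ ℕ λ i → i ≤ τ × Free (D + i * s) × 6 * cost s P a (D + i * s) + 7 ≤ s) where

    record Choice (W : Fin n → Fin n → ℕ) (B P ex : Fin n → Bool) (a : Fin n → ℕ) (v : Fin n) : Set where
      field
        D     : ℕ
        free  : Free D
        cheap : 6 * cost s P a D + 7 ≤ s
        tgl   : Toggled W B P ex a v D

    choose : ∀ {W B P a} → Invariant W B P a → ∀ v → R v ≡ true → B v ≡ false → (ex : Fin n → Bool) → # ex ≤ 2 →
      (∀ w → B w ≡ true → P w ≡ false → ex w ≡ true) → Choice W B P ex a v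
    choose {W} {B} {P} {a} I v Rv Bv ex ex≤2 pending with toggle I v Rv Bv ex pending
    ... | D , f with find W P a v D (off I) (bounds I) (P⊆R I) (pair I) Rv
    ... | i , i≤τ , fr , c = record { D = D + i * s ; free = fr ; cheap = c
                                    ; tgl = f i (≤-trans i≤τ (τ≤tog v ex Rv ex≤2)) }

    Hd-Rʳ : ∀ {u v} → Hd u v ≡ true → R v ≡ true
    Hd-Rʳ {u} {v} h = Hd-R v u (Hd-sym u v h)

    #-singleton : (u : Fin n) → # (_== u) ≤ 1
    #-singleton u = #-unique (_== u) (λ i j a b → trans (==-true a) (sym (==-true b)))

    #-doubleton : (u w : Fin n) → # (λ x → (x == u) ∨ (x == w)) ≤ 2
    #-doubleton u w = ≤-trans (#-∨ (_== u) (_== w)) (+-mono-≤ (#-singleton u) (#-singleton w))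

    3cost<s : ∀ c → 6 * c + 7 ≤ s → 3 * c + 3 < s
    3cost<s c h = ≤-trans (≤-cancel-cert (3 * c + 3) (≤-refl {0}) (lem c)) h
      where
      lem : ∀ c → (1 + (3 * c + 3)) + 0 + (3 * c + 3) ≡ 6 * c + 7 + 0
      lem = solve-∀

    -- The origin of `6 cost + 7`. The offset `t₂` of a path serves two vertices: it must avoid
    -- three clashes for every processed vertex near either window, and six with the third vertex of
    -- the path. The mean of the two hypotheses is exactly this.
    pair<s : ∀ c d → 6 * c + 7 ≤ s → 6 * d + 7 ≤ s → 3 * c + (3 * d + 6) < s
    pair<s c d h h′ = *-cancelˡ-≤ 2 (≤-trans (≤-reflexive (lem c d)) (≤-trans (+-mono-≤ h h′) (≤-reflexive (lem₂ s))))
      where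
      lem : ∀ c d → 2 * (1 + (3 * c + (3 * d + 6))) ≡ 6 * c + 7 + (6 * d + 7)
      lem = solve-∀
      lem₂ : ∀ s → s + s ≡ 2 * s
      lem₂ = solve-∀

    window₁ : ∀ D {t} → t < s → D + t + s < D + 3 * s
    window₁ D {t} t<s = <-≤-trans (+-monoˡ-< s (+-monoʳ-< D t<s)) (≤-cancel-cert s (≤-refl {0}) (lem D s))
      where
      lem : ∀ D s → D + s + s + 0 + s ≡ D + 3 * s + 0
      lem = solve-∀

    window₂ : ∀ D {t t′} → t < s → t′ < s → D + t + t′ + s < D + 3 * s
    window₂ D {t} {t′} t<s t′<s = <-≤-trans (+-monoˡ-< s (+-mono-< (+-monoʳ-< D t<s) t′<s)) (≤-reflexive (lem D s))
      where
      lem : ∀ D s → D + s + s + s ≡ D + 3 * s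
      lem = solve-∀

    Processed : (Fin n → Bool) → Set
    Processed P = Σ (Fin n → Fin n → ℕ) λ W → Σ (Fin n → ℕ) λ a → Invariant W P P a

    shift-single : ∀ {W B P a v u D t} → Invariant W B P a → B v ≡ true → P v ≡ false → P u ≡ false → Hd v u ≡ true →
      W v u ≡ 1 + s → val W v ≡ D → Free D → t < s → (∀ u → P u ≡ true → Apart s (D + t) (a u)) →
      Σ (Fin n → Fin n → ℕ) λ W′ → Σ (Fin n → ℕ) (Invariant W′ B (insert v P))
    shift-single {a = a} {v} {u} {D} {t} I Bv Pv Pu vu evu val-v fr t<s ap with shift I v u vu Bv Pv Pu evu t (<⇒≤ t<s)
    ... | record { W′ = W′ ; inv′ = I′ ; valu = valu } = W′ , assign a v (D + t) ,
      finalise I′ v (Hd-R v u vu) Bv Pv (D + t) (trans valu (cong (_+ t) val-v)) (D , fr , m≤m+n D t , window₁ D t<s) ap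

    process-single : ∀ {P} → Processed P → ∀ v u → P v ≡ false → P u ≡ false → Hd v u ≡ true → Processed (insert v P)
    process-single {P} (W , a , I) v u Pv Pu vu =
      continue (choose I v (Hd-R v u vu) Pv (_== u) (≤-trans (#-singleton u) (s≤s z≤n)) (λ w e e′ → ⊥-elim (true≢false e e′)))
      where
      continue : Choice W P P (_== u) a v → Processed (insert v P)
      continue record { D = D ; free = fr ; cheap = k ; tgl = record { W′ = W₁ ; inv′ = I₁ ; val′ = v₁ ; keep = keep₁ } } =
        place-at (missing s (allClashes s P a D D)
          (≤-<-trans (≤-trans (≤-reflexive (allClashes-length s P a D D)) (m≤m+n _ 3)) (3cost<s (cost s P a D) k)))
        where
        place-at : (∃[ t ] t < s × t ∉ allClashes s P a D D) → Processed (insert v P)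
        place-at (t , t<s , t∉) = shift-single I₁ (insert-self v P) Pv Pu vu (trans (keep₁ u (==-refl u)) (fresh I v u vu Pv Pu)) v₁ fr t<s
          (allClashes-apart t∉ ≤-refl (window₁ D t<s))

    record ToggledPath (W : Fin n → Fin n → ℕ) (P : Fin n → Bool) (a : Fin n → ℕ) (p q c : Fin n) : Set where
      field
        W₃ : Fin n → Fin n → ℕ
        inv₃ : Invariant W₃ (insert c (insert q (insert p P))) P a
        Dp Dq Dc : ℕ
        val-p : val W₃ p ≡ Dp
        val-q : val W₃ q ≡ Dq
        val-c : val W₃ c ≡ Dc
        edge-cp : W₃ c p ≡ 1 + s
        edge-cq : W₃ c q ≡ 1 + s
        free-p : Free Dp
        free-q : Free Dq
        free-c : Free Dc
        cheap-p : 6 * cost s P a Dp + 7 ≤ s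
        cheap-q : 6 * cost s P a Dq + 7 ≤ s
        cheap-c : 6 * cost s P a Dc + 7 ≤ s

    assemble : ∀ {W P a p q c} → Invariant W P P a → P p ≡ false → P q ≡ false → P c ≡ false → p ≢ q →
      Hd c p ≡ true → Hd c q ≡ true →
      (ch₁ : Choice W P P (λ x → (x == q) ∨ (x == c)) a p) →
      (ch₂ : Choice (Toggled.W′ (Choice.tgl ch₁)) (insert p P) P (λ x → (x == p) ∨ (x == c)) a q) →
      Choice (Toggled.W′ (Choice.tgl ch₂)) (insert q (insert p P)) P (λ x → (x == p) ∨ (x == q)) a c →
      ToggledPath W P a p q c
    assemble {W} {P} {a} {p} {q} {c} I Pp Pq Pc p≢q cp cq
      record { D = Dp ; free = fp ; cheap = kp ; tgl = record { W′ = W₁ ; inv′ = I₁ ; val′ = v₁ ; away = away₁ ; keep = keep₁ } }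
      record { D = Dq ; free = fq ; cheap = kq ; tgl = record { W′ = W₂ ; inv′ = I₂ ; val′ = v₂ ; away = away₂ ; keep = keep₂ ; value = value₂ } }
      record { D = Dc ; free = fc ; cheap = kc ; tgl = record { W′ = W₃ ; inv′ = I₃ ; val′ = v₃ ; keep = keep₃ ; value = value₃ } }
      = record
      { W₃ = W₃ ; inv₃ = I₃ ; Dp = Dp ; Dq = Dq ; Dc = Dc
      ; val-p = trans (value₃ p (c≢p ∘ sym) in-p) (trans (value₂ p p≢q in-p) v₁)
      ; val-q = trans (value₃ q (c≢q ∘ sym) (∨-trueʳ {q == p} (==-refl q))) v₂
      ; val-c = v₃
      ; edge-cp = trans (keep₃ p in-p) (trans (away₂ c p c≢q p≢q)
          (trans (W-sym I₁ c p) (trans (keep₁ c (∨-trueʳ {c == q} (==-refl c))) (fresh I p c (Hd-sym c p cp) Pp Pc))))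
      ; edge-cq = trans (keep₃ q (∨-trueʳ {q == p} (==-refl q))) (trans (W-sym I₂ c q)
          (trans (keep₂ c (∨-trueʳ {c == p} (==-refl c))) (trans (away₁ q c (p≢q ∘ sym) c≢p) (fresh I q c (Hd-sym c q cq) Pq Pc))))
      ; free-p = fp ; free-q = fq ; free-c = fc ; cheap-p = kp ; cheap-q = kq ; cheap-c = kc }
      where
      c≢p = Hd-irrefl cp
      c≢q = Hd-irrefl cq
      in-p : ∀ {r} → ((p == p) ∨ r) ≡ true
      in-p = ∨-trueˡ (==-refl p)

    -- All three vertices reach cheap free windows before any fine offset is chosen. At each turn
    -- the other two are protected, so the path edges keep weight `1 + s` and a window once reached
    -- is not left.
    toggle-path : ∀ {W P a} → Invariant W P P a → ∀ p q c → P p ≡ false → P q ≡ false → P c ≡ false → p ≢ q →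
      Hd c p ≡ true → Hd c q ≡ true → ToggledPath W P a p q c
    toggle-path {W} {P} {a} I p q c Pp Pq Pc p≢q cp cq = assemble I Pp Pq Pc p≢q cp cq ch₁ ch₂ ch₃
      where
      ch₁ = choose I p (Hd-Rʳ cp) Pp (λ x → (x == q) ∨ (x == c)) (#-doubleton q c) (λ w e e′ → ⊥-elim (true≢false e e′))
      ch₂ = choose (Toggled.inv′ (Choice.tgl ch₁)) q (Hd-Rʳ cq) (trans (insert-≢ {P = P} (p≢q ∘ sym)) Pq) (λ x → (x == p) ∨ (x == c)) (#-doubleton p c) pending
        where
        pending : ∀ w → insert p P w ≡ true → P w ≡ false → ((w == p) ∨ (w == c)) ≡ true
        pending w e e′ with insert-true⁻ {v = p} {w} {P} e
        ... | inj₁ refl = ∨-trueˡ (==-refl p)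
        ... | inj₂ Pw = ⊥-elim (true≢false Pw e′)
      ch₃ = choose (Toggled.inv′ (Choice.tgl ch₂)) c (Hd-R c p cp)
        (trans (insert-≢ {P = insert p P} (Hd-irrefl cq)) (trans (insert-≢ {P = P} (Hd-irrefl cp)) Pc)) (λ x → (x == p) ∨ (x == q)) (#-doubleton p q) pending
        where
        pending : ∀ w → insert q (insert p P) w ≡ true → P w ≡ false → ((w == p) ∨ (w == q)) ≡ true
        pending w e e′ with insert-true⁻ {v = q} {w} {insert p P} e
        ... | inj₁ refl = ∨-trueʳ {w == p} (==-refl w)
        ... | inj₂ h with insert-true⁻ {v = p} {w} {P} h
        ... | inj₁ refl = ∨-trueˡ (==-refl p)
        ... | inj₂ Pw = ⊥-elim (true≢false Pw e′)

    -- The offsets sit on the path edges `c p` and `c q`, so `c` receives their sum. A single edge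
    -- could not separate its ends, since both would move together. On the path, `c` against `q`
    -- depends on `t₁` alone and `c` against `p` on `t₂` alone, while `q` against `p` is a condition
    -- on `t₂` once `t₁` is fixed.
    record Offsets (P : Fin n → Bool) (a : Fin n → ℕ) (Dp Dq Dc : ℕ) : Set where
      field
        t₁ t₂    : ℕ
        t₁<s     : t₁ < s
        t₂<s     : t₂ < s
        apart-p  : ∀ u → P u ≡ true → Apart s (Dp + t₁) (a u)
        apart-q  : ∀ u → P u ≡ true → Apart s (Dq + t₂) (a u)
        apart-c  : ∀ u → P u ≡ true → Apart s (Dc + t₁ + t₂) (a u)
        apart-cq : Apart s (Dc + t₁ + t₂) (Dq + t₂)
        apart-qp : Apart s (Dq + t₂) (Dp + t₁)
        apart-cp : Apart s (Dc + t₁ + t₂) (Dp + t₁)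

    offsets : ∀ P a Dp Dq Dc → 6 * cost s P a Dp + 7 ≤ s → 6 * cost s P a Dq + 7 ≤ s → 6 * cost s P a Dc + 7 ≤ s →
      Offsets P a Dp Dq Dc
    offsets P a Dp Dq Dc kp kq kc = first
      (missing s F₁ (≤-<-trans (≤-reflexive (trans (length-++ (allClashes s P a Dp Dp))
        (cong (_+ 3) (allClashes-length s P a Dp Dp)))) (3cost<s (cost s P a Dp) kp)))
      where
      F₁ : List ℕ
      F₁ = allClashes s P a Dp Dp ++ clashes s Dc Dq
      F₂ : ℕ → List ℕ
      F₂ t₁ = allClashes s P a Dq Dq ++ (allClashes s P a Dc (Dc + t₁) ++ (clashes s Dq (Dp + t₁) ++ clashes s (Dc + t₁) (Dp + t₁)))
      second : ∀ t₁ → t₁ < s → t₁ ∉ F₁ → (∃[ t ] t < s × t ∉ F₂ t₁) → Offsets P a Dp Dq Dc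
      second t₁ t₁<s t₁∉ (t₂ , t₂<s , t₂∉) = record
        { t₁ = t₁ ; t₂ = t₂ ; t₁<s = t₁<s ; t₂<s = t₂<s
        ; apart-p = allClashes-apart (λ m → t₁∉ (∈-++⁺ˡ m)) ≤-refl (window₁ Dp t₁<s)
        ; apart-cq = Apart-+ t₂ (clashes-apart {s} {Dc} {Dq} {t₁} (λ m → t₁∉ (∈-++⁺ʳ (allClashes s P a Dp Dp) m)))
        ; apart-q = allClashes-apart (λ m → t₂∉ (∈-++⁺ˡ m)) ≤-refl (window₁ Dq t₂<s)
        ; apart-c = allClashes-apart (λ m → t₂∉ (∈-++⁺ʳ (allClashes s P a Dq Dq) (∈-++⁺ˡ m))) (m≤m+n Dc t₁) (window₂ Dc t₁<s t₂<s)
        ; apart-qp = clashes-apart {s} {Dq} {Dp + t₁} {t₂} (λ m → t₂∉ (∈-++⁺ʳ (allClashes s P a Dq Dq) (∈-++⁺ʳ (allClashes s P a Dc (Dc + t₁)) (∈-++⁺ˡ m))))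
        ; apart-cp = clashes-apart {s} {Dc + t₁} {Dp + t₁} {t₂} (λ m → t₂∉ (∈-++⁺ʳ (allClashes s P a Dq Dq) (∈-++⁺ʳ (allClashes s P a Dc (Dc + t₁)) (∈-++⁺ʳ (clashes s Dq (Dp + t₁)) m)))) }
      first : (∃[ t ] t < s × t ∉ F₁) → Offsets P a Dp Dq Dc
      first (t₁ , t₁<s , t₁∉) = second t₁ t₁<s t₁∉ (missing s (F₂ t₁)
        (≤-<-trans (≤-reflexive (trans (length-++ (allClashes s P a Dq Dq)) (cong₂ _+_ (allClashes-length s P a Dq Dq)
          (trans (length-++ (allClashes s P a Dc (Dc + t₁))) (cong (_+ 6) (allClashes-length s P a Dc (Dc + t₁)))))))
          (pair<s (cost s P a Dq) (cost s P a Dc) kq kc)))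

    finalise-path : ∀ {W B P a p q c Dp Dq Dc} → Invariant W B P a → (o : Offsets P a Dp Dq Dc) →
      R p ≡ true → R q ≡ true → R c ≡ true → B p ≡ true → B q ≡ true → B c ≡ true →
      P p ≡ false → P q ≡ false → P c ≡ false → p ≢ q → c ≢ p → c ≢ q → Free Dp → Free Dq → Free Dc →
      val W p ≡ Dp + Offsets.t₁ o → val W q ≡ Dq + Offsets.t₂ o → val W c ≡ Dc + Offsets.t₁ o + Offsets.t₂ o →
      Σ (Fin n → ℕ) (Invariant W B (insert c (insert q (insert p P))))
    finalise-path {W} {B} {P} {a} {p} {q} {c} {Dp} {Dq} {Dc} I o Rp Rq Rc Bp Bq Bc Pp Pq Pc p≢q c≢p c≢q fp fq fc vp vq vc =
      assign a₂ c (Dc + t₁ + t₂) ,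
      finalise I₂ c Rc Bc (trans (insert-≢ {P = insert p P} c≢q) (trans (insert-≢ {P = P} c≢p) Pc)) (Dc + t₁ + t₂) vc
        (Dc , fc , ≤-trans (m≤m+n Dc t₁) (m≤m+n _ t₂) , window₂ Dc t₁<s t₂<s) apart₃
      where
      open Offsets o
      a₁ = assign a p (Dp + t₁)
      a₂ = assign a₁ q (Dq + t₂)
      I₁ : Invariant W B (insert p P) a₁
      I₁ = finalise I p Rp Bp Pp (Dp + t₁) vp (Dp , fp , m≤m+n Dp t₁ , window₁ Dp t₁<s) apart-p
      old : ∀ {u} → P u ≡ true → u ≢ p
      old Pu refl = true≢false Pu Pp
      apart₂ : ∀ {x} → Apart s x (Dp + t₁) → (∀ u → P u ≡ true → Apart s x (a u)) → ∀ u → insert p P u ≡ true → Apart s x (a₁ u)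
      apart₂ {x} xp h u hu with insert-true⁻ {v = p} {u} {P} hu
      ... | inj₁ refl = subst (Apart s x) (sym (assign-self a u (Dp + t₁))) xp
      ... | inj₂ Pu = subst (Apart s x) (sym (assign-≢ {a = a} {x = Dp + t₁} (old Pu))) (h u Pu)
      q∉ : insert p P q ≡ false
      q∉ = trans (insert-≢ {P = P} (p≢q ∘ sym)) Pq
      I₂ : Invariant W B (insert q (insert p P)) a₂
      I₂ = finalise I₁ q Rq Bq q∉ (Dq + t₂) vq (Dq , fq , m≤m+n Dq t₂ , window₁ Dq t₂<s) (apart₂ apart-qp apart-q)
      apart₃ : ∀ u → insert q (insert p P) u ≡ true → Apart s (Dc + t₁ + t₂) (a₂ u)
      apart₃ u hu with insert-true⁻ {v = q} {u} {insert p P} hu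
      ... | inj₁ refl = subst (Apart s (Dc + t₁ + t₂)) (sym (assign-self a₁ u (Dq + t₂))) apart-cq
      ... | inj₂ h = subst (Apart s (Dc + t₁ + t₂)) (sym (assign-≢ {a = a₁} {x = Dq + t₂} (λ { refl → true≢false h q∉ }))) (apart₂ apart-cp apart-c u h)

    shift-path : ∀ {W B P a p q c Dp Dq Dc} → Invariant W B P a → (o : Offsets P a Dp Dq Dc) →
      B p ≡ true → B q ≡ true → B c ≡ true → P p ≡ false → P q ≡ false → P c ≡ false → p ≢ q →
      Hd c p ≡ true → Hd c q ≡ true → Free Dp → Free Dq → Free Dc →
      val W p ≡ Dp → val W q ≡ Dq → val W c ≡ Dc → W c p ≡ 1 + s → W c q ≡ 1 + s →
      Σ (Fin n → Fin n → ℕ) λ W′ → Σ (Fin n → ℕ) (Invariant W′ B (insert c (insert q (insert p P))))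
    shift-path {p = p} {q} {c} I o Bp Bq Bc Pp Pq Pc p≢q cp cq fp fq fc vp vq vc ecp ecq
      with shift I c p cp Bc Pc Pp ecp (Offsets.t₁ o) (<⇒≤ (Offsets.t₁<s o))
    ... | record { W′ = W₁ ; inv′ = I₁ ; valu = u₁ ; valv = v₁ ; value = x₁ ; away = away₁ }
      with shift I₁ c q cq Bc Pc Pq (edge-cq′ (away₁ c q (p≢q ∘ sym))) (Offsets.t₂ o) (<⇒≤ (Offsets.t₂<s o))
      where
      edge-cq′ : W₁ c q ≡ _ ⊎ c ≡ p → W₁ c q ≡ 1 + s
      edge-cq′ (inj₁ e) = trans e ecq
      edge-cq′ (inj₂ e) = ⊥-elim (Hd-irrefl cp e)
    ... | record { W′ = W₂ ; inv′ = I₂ ; valu = u₂ ; valv = v₂ ; value = x₂ } =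
      W₂ , finalise-path I₂ o (Hd-Rʳ cp) (Hd-Rʳ cq) (Hd-R c p cp) Bp Bq Bc Pp Pq Pc p≢q (Hd-irrefl cp) (Hd-irrefl cq) fp fq fc
        (trans (x₂ p (Hd-irrefl cp ∘ sym) p≢q) (trans v₁ (cong (_+ Offsets.t₁ o) vp)))
        (trans v₂ (cong (_+ Offsets.t₂ o) (trans (x₁ q (Hd-irrefl cq ∘ sym) (p≢q ∘ sym)) vq)))
        (trans u₂ (cong (_+ Offsets.t₂ o) (trans u₁ (cong (_+ Offsets.t₁ o) vc))))

    process-triple : ∀ {P} → Processed P → ∀ p q c → P p ≡ false → P q ≡ false → P c ≡ false → p ≢ q →
      Hd c p ≡ true → Hd c q ≡ true → Processed (insert c (insert q (insert p P)))
    process-triple {P} (W , a , I) p q c Pp Pq Pc p≢q cp cq = continue (toggle-path I p q c Pp Pq Pc p≢q cp cq)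
      where
      continue : ToggledPath W P a p q c → Processed (insert c (insert q (insert p P)))
      continue record { inv₃ = I₃ ; Dp = Dp ; Dq = Dq ; Dc = Dc ; val-p = vp ; val-q = vq ; val-c = vc ; edge-cp = ecp ; edge-cq = ecq
                      ; free-p = fp ; free-q = fq ; free-c = fc ; cheap-p = kp ; cheap-q = kq ; cheap-c = kc } =
        shift-path I₃ (offsets P a Dp Dq Dc kp kq kc)
          (insert-⊇ {v = c} {p} {insert q (insert p P)} (insert-⊇ {v = q} {p} {insert p P} (insert-self p P)))
          (insert-⊇ {v = c} {q} {insert q (insert p P)} (insert-self q (insert p P)))
          (insert-self c (insert q (insert p P)))
          Pp Pq Pc p≢q cp cq fp fq fc vp vq vc ecp ecq

    Processed-resp : ∀ {P P′} → (∀ x → P′ x ≡ P x) → Processed P → Processed P′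
    Processed-resp e (W , a , I) = W , a , Invariant-resp e I

    process : ∀ {P} → Schedule P → Processed P → Σ (Fin n → Bool) λ P′ → (∀ v → R v ≡ true → P′ v ≡ true) × Processed P′
    process (done h) X = _ , h , X
    process (single v u pv pu vu e S) X = process S (Processed-resp e (process-single X v u pv pu vu))
    process (triple p q c pp pq pc p≢q cp cq e S) X = process S (Processed-resp e (process-triple X p q c pp pq pc p≢q cp cq))

    initial : Processed (λ _ → false)
    initial = W₀ , (λ _ → 0) , record
      { W-sym = W₀-sym ; off = λ _ _ _ → refl ; fresh = λ u v h _ _ → W₀-Hd u v h
      ; half = λ _ _ _ () ; full = λ _ _ _ () ; P⊆B = λ _ () ; P⊆R = λ _ ()
      ; pair = λ _ () ; apart = λ _ _ () ; place = λ _ () }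

  absorbed : ∀ {P} → (∀ v → R v ≡ true → P v ≡ true) → ∀ {W a} → Invariant W P P a → Absorbed G R Hd s W₀ Free
  absorbed {P} all {W} {a} I = record
    { W = W ; W-sym′ = W-sym I ; W-off = off I ; W-bounds = bounds I ; W-distinct = distinct ; W-free = free }
    where
    clash : ∀ {x y x′ y′} → Apart s x y → x′ ≡ x ⊎ x′ ≡ x + s → y′ ≡ y ⊎ y′ ≡ y + s → x′ ≢ y′
    clash (p , q , r) (inj₁ refl) (inj₁ refl) e = p e
    clash (p , q , r) (inj₁ refl) (inj₂ refl) e = q e
    clash (p , q , r) (inj₂ refl) (inj₁ refl) e = r e
    clash (p , q , r) (inj₂ refl) (inj₂ refl) e = p (+-cancelʳ-≡ s _ _ e)
    distinct : ∀ u v → R u ≡ true → R v ≡ true → val W u ≡ val W v → u ≡ v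
    distinct u v Ru Rv e with u ≟F v
    ... | yes u≡v = u≡v
    ... | no u≢v = ⊥-elim (clash (apart I u v (all u Ru) (all v Rv) u≢v) (pair I u (all u Ru)) (pair I v (all v Rv)) e)
    free : ∀ u → R u ≡ true → Σ ℕ λ D → Free D × D ≤ val W u × val W u < D + 3 * s
    free u Ru with place I u (all u Ru) | pair I u (all u Ru)
    ... | D , f , lo , hi | inj₁ e rewrite e = D , f , lo , ≤-<-trans (m≤m+n _ s) hi
    ... | D , f , lo , hi | inj₂ e rewrite e = D , f , ≤-trans lo (m≤m+n _ s) , hi

  absorb : (∀ v → R v ≡ true → ∃[ u ] Hd v u ≡ true) →
    (∀ v u → Hd v u ≡ true → ∃[ w ] ((w ≢ u × Hd v w ≡ true) ⊎ (w ≢ v × Hd u w ≡ true))) →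
    ∀ τ → (∀ v ex → R v ≡ true → # ex ≤ 2 → τ ≤ # (λ w → tog v w ∧ not (ex w))) →
    (∀ W P a v D → (∀ x y → Hd x y ≡ false → W x y ≡ W₀ x y) →
      (∀ x y → Hd x y ≡ true → 1 ≤ W x y × W x y ≤ 1 + 3 * s) →
      (∀ u → P u ≡ true → R u ≡ true) →
      (∀ u → P u ≡ true → val W u ≡ a u ⊎ val W u ≡ a u + s) → R v ≡ true →
      Σ ℕ λ i → i ≤ τ × Free (D + i * s) × 6 * cost s P a (D + i * s) + 7 ≤ s) → Absorbed G R Hd s W₀ Free
  absorb has-neighbour no-isolated τ τ≤tog find = finish (process schedule initial)
    where
    open Scheduling has-neighbour no-isolated
    open Run τ τ≤tog find
    finish : (Σ (Fin n → Bool) λ P → (∀ v → R v ≡ true → P v ≡ true) × Processed P) → Absorbed G R Hd s W₀ Free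
    finish (P , all , W , a , I) = absorbed all I

-- Degrees and the bound linear in the number of vertices.

degree : ∀ {n} → Graph n → Fin n → ℕ
degree G v = # (adj G v)

deg≡degree : ∀ {n} (G : Graph n) v → deg G v ≡ degree G v
deg≡degree {n} G v = trans (∑-allFin n _) (∑-cong (λ j → lem (adj G v j)))
  where
  lem : ∀ b → (if b then 1 else 0) ≡ 𝟙 b
  lem true  = refl
  lem false = refl

irregular-by : ∀ {n} (G : Graph n) k (W : Fin n → Fin n → ℕ) → (∀ u v → W u v ≡ W v u) →
  (∀ u v → adj G u v ≡ true → 1 ≤ W u v × W u v ≤ k) →
  (∀ u v → ∑ n (λ w → if adj G u w then W u w else 0) ≡ ∑ n (λ w → if adj G v w then W v w else 0) → u ≡ v) →
  Irregular G k
irregular-by {n} G k W W-sym W-bounds W-inj = f , λ {u} {v} e → W-inj u v (trans (sym (∑-allFin n _)) (trans e (∑-allFin n _)))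
  where
  f : Weighting G k
  f = record { w = W ; w-sym = W-sym ; w-low = λ u v h → proj₁ (W-bounds u v h) ; w-high = λ u v h → proj₂ (W-bounds u v h) }

-- The greedy stage with `R` everything and all edges designated. No toggling is required: a window
-- has at most `n` vertices near it, and `s = 6 n + 7` is `6 cost + 7` for that cost.
irregular-linear : ∀ {n} (G : Graph n) → (∀ v → 0 < degree G v) → NoIsolatedEdge G → Irregular G (1 + 3 * (6 * n + 7))
irregular-linear {n} G 0<deg no-edge = finish
  (Absorb.absorb G (λ _ → true) (adj G) (λ u v h → trans (adj-sym G v u) h) (λ _ _ h → h) (λ _ _ _ → refl)
    (λ _ _ → false) (λ _ _ _ ()) s (λ _ _ → 1 + s) (λ _ _ → refl) (λ _ _ _ → refl) (λ _ → ⊤)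
    neighbour second 0 (λ _ _ _ _ → z≤n) find)
  where
  s = 6 * n + 7
  neighbour : ∀ v → true ≡ true → ∃[ u ] adj G v u ≡ true
  neighbour v _ = #-witness (adj G v) (0<deg v)
  second : ∀ v u → adj G v u ≡ true → ∃[ w ] ((w ≢ u × adj G v w ≡ true) ⊎ (w ≢ v × adj G u w ≡ true))
  second v u h with degree G v ≟ 1 | degree G u ≟ 1
  ... | yes dv | yes du = ⊥-elim (no-edge v u h (trans (deg≡degree G v) dv , trans (deg≡degree G u) du))
  ... | no dv | _ with #-witness₂ (adj G v) u (≤∧≢⇒< (0<deg v) (dv ∘ sym))
  ... | w , ne , e = w , inj₁ (ne , e)
  second v u h | yes _ | no du with #-witness₂ (adj G u) v (≤∧≢⇒< (0<deg u) (du ∘ sym))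
  ... | w , ne , e = w , inj₂ (ne , e)
  find : ∀ W P a v D → _ → _ → _ → _ → true ≡ true → Σ ℕ λ i → i ≤ 0 × ⊤ × 6 * cost s P a (D + i * s) + 7 ≤ s
  find W P a v D _ _ _ _ _ = 0 , z≤n , tt , +-monoˡ-≤ 7 (*-monoʳ-≤ 6 (#≤n (near s P a (D + 0 * s))))
  finish : Absorbed G (λ _ → true) (adj G) s (λ _ _ → 1 + s) (λ _ → ⊤) → Irregular G (1 + 3 * s)
  finish R = irregular-by G (1 + 3 * s) (Absorbed.W R) (Absorbed.W-sym′ R) (Absorbed.W-bounds R)
    (λ u v e → Absorbed.W-distinct R u v refl refl e)

#-cong : ∀ {n} {p q : Fin n → Bool} → (∀ i → p i ≡ q i) → # p ≡ # q
#-cong h = ∑-cong (λ i → cong 𝟙 (h i))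

#-all : ∀ {n} {p : Fin n → Bool} → (∀ i → p i ≡ true) → # p ≡ n
#-all {n} h = trans (∑-cong (λ i → cong 𝟙 (h i))) (trans (∑-const n 1) (*-identityʳ n))

bool-ext : ∀ {a b} → (a ≡ true → b ≡ true) → (b ≡ true → a ≡ true) → a ≡ b
bool-ext {true}  {b}     f g = sym (f refl)
bool-ext {false} {true}  f g = g refl
bool-ext {false} {false} f g = refl

#-below : ∀ {n} k → k ≤ n → # {n} (λ i → toℕ i <ᵇ k) ≡ k
#-below {n}     zero    h = #-false {n} (λ i → refl)
#-below {suc n} (suc k) (s≤s h) = cong suc (#-below k h)

#-sum-reaches : ∀ n e → e ≤ n → # {n} (λ i → n ≤ᵇ e + toℕ i) ≡ e
#-sum-reaches n e e≤n = +-cancelʳ-≡ (n ∸ e) _ _ (begin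
  # {n} (λ i → n ≤ᵇ e + toℕ i) + (n ∸ e)                       ≡⟨ cong (# {n} (λ i → n ≤ᵇ e + toℕ i) +_) (#-below {n} (n ∸ e) (m∸n≤m n e)) ⟨
  # {n} (λ i → n ≤ᵇ e + toℕ i) + # {n} (λ i → toℕ i <ᵇ n ∸ e)  ≡⟨ cong (# {n} (λ i → n ≤ᵇ e + toℕ i) +_) (#-cong {n} flip) ⟩
  # {n} (λ i → n ≤ᵇ e + toℕ i) + # {n} (λ i → not (n ≤ᵇ e + toℕ i)) ≡⟨ #-not {n} (λ i → n ≤ᵇ e + toℕ i) ⟩
  n                                                            ≡⟨ m+[n∸m]≡n e≤n ⟨
  e + (n ∸ e)                                                  ∎)
  where
  open ≡-Reasoning
  flip : ∀ (i : Fin n) → (toℕ i <ᵇ n ∸ e) ≡ not (n ≤ᵇ e + toℕ i)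
  flip i with n ≤ᵇ e + toℕ i in eq
  ... | true = not-¬-true (λ h → <⇒≱ (m<n∸o⇒m+o<n′ (<ᵇ-true⁻ {toℕ i} h)) (≤ᵇ-true⁻ {n} eq))
    where
    m<n∸o⇒m+o<n′ : toℕ i < n ∸ e → e + toℕ i < n
    m<n∸o⇒m+o<n′ h = <-≤-trans (+-monoʳ-< e h) (≤-reflexive (m+[n∸m]≡n e≤n))
  ... | false = <ᵇ-true {toℕ i} (+-cancelˡ-< e _ _ (<-≤-trans (≤ᵇ-false⁻ {n} eq) (≤-reflexive (sym (m+[n∸m]≡n e≤n)))))

-- Terms of arithmetic progressions in intervals, and sizes of label sets.

window : (α β lo Λ e : ℕ) → Bool
window α β lo Λ e = (lo ≤ᵇ α + β * e) ∧ (α + β * e <ᵇ lo + Λ)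

private
  progression-suc : ∀ α β e → α + β * suc e ≡ (α + β) + β * e
  progression-suc α β e = trans (cong (α +_) (*-suc β e)) (sym (+-assoc α β (β * e)))

#-progression-below : ∀ n α β ub → # {n} (λ i → α + β * toℕ i <ᵇ ub) * β ≤ (ub ∸ α) + β
#-progression-below zero    α β ub = z≤n
#-progression-below (suc n) α β ub with α + β * 0 <ᵇ ub in eq
... | false = ≤-trans (≤-reflexive (cong (_* β) (#-false {n} above))) z≤n
  where
  above : ∀ (i : Fin n) → (α + β * suc (toℕ i) <ᵇ ub) ≡ false
  above i = not-¬-true (λ h → <⇒≱ (<ᵇ-true⁻ {α + β * suc (toℕ i)} {ub} h) (≤-trans (<ᵇ-false⁻ {α + β * 0} {ub} eq) (+-monoʳ-≤ α (*-monoʳ-≤ β z≤n))))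
... | true = begin
  β + # {n} (λ i → α + β * suc (toℕ i) <ᵇ ub) * β   ≡⟨ cong (λ z → β + z * β) (#-cong {n} (λ i → cong (_<ᵇ ub) (progression-suc α β (toℕ i)))) ⟩
  β + # {n} (λ i → α + β + β * toℕ i <ᵇ ub) * β     ≤⟨ rest ⟩
  (ub ∸ α) + β                                      ∎
  where
  open ≤-Reasoning
  rest : β + # {n} (λ i → α + β + β * toℕ i <ᵇ ub) * β ≤ (ub ∸ α) + β
  rest with α + β ≤? ub
  ... | yes h = ≤-trans (+-monoʳ-≤ β (#-progression-below n (α + β) β ub)) (≤-reflexive
    (trans (cong (λ z → β + (z + β)) (sym (∸-+-assoc ub α β)))
      (trans (sym (+-assoc β _ β)) (cong (_+ β) (m+[n∸m]≡n (m+n≤o⇒m≤o∸n β (≤-trans (≤-reflexive (+-comm β α)) h)))))))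
  ... | no h = ≤-trans (≤-reflexive (trans (cong (λ z → β + z * β) (#-false {n} above)) (+-identityʳ β))) (m≤n+m β _)
    where
    above : ∀ (i : Fin n) → (α + β + β * toℕ i <ᵇ ub) ≡ false
    above i = not-¬-true (λ e → h (<⇒≤ (≤-<-trans (m≤m+n (α + β) (β * toℕ i)) (<ᵇ-true⁻ {α + β + β * toℕ i} e))))

#-window : ∀ n α β lo Λ → # {n} (λ i → window α β lo Λ (toℕ i)) * β ≤ Λ + β
#-window zero    α β lo Λ = z≤n
#-window (suc n) α β lo Λ with lo ≤ᵇ α + β * 0 in eq
... | false = ≤-trans (≤-reflexive (cong (_* β) (#-cong {n} (λ i → cong (λ z → (lo ≤ᵇ z) ∧ (z <ᵇ lo + Λ)) (progression-suc α β (toℕ i))))))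
                (#-window n (α + β) β lo Λ)
... | true = begin
  _                                              ≤⟨ *-monoˡ-≤ β (+-monoʳ-≤ (𝟙 (α + β * 0 <ᵇ lo + Λ)) (#-mono {n} (λ i h → proj₂ (∧-true⁻ {lo ≤ᵇ α + β * suc (toℕ i)} h)))) ⟩
  # {suc n} (λ i → α + β * toℕ i <ᵇ lo + Λ) * β  ≤⟨ #-progression-below (suc n) α β (lo + Λ) ⟩
  (lo + Λ ∸ α) + β                               ≤⟨ +-monoˡ-≤ β (≤-trans (∸-monoʳ-≤ (lo + Λ) lo≤α) (≤-reflexive (m+n∸m≡n lo Λ))) ⟩
  Λ + β                                          ∎
  where
  open ≤-Reasoning
  lo≤α : lo ≤ α
  lo≤α = ≤-trans (≤ᵇ-true⁻ {lo} eq) (≤-reflexive (trans (cong (α +_) (*-zeroʳ β)) (+-identityʳ α)))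

-- The hypothesis amounts to `(k - 1) β ≤ q` for positive `k`, so `β` may be lowered. This replaces
-- slopes that depend on the degree of a vertex by one that depends on `δ`.
shrink-step : ∀ k {β β′ q} → β′ ≤ β → k * β ≤ q + β → k * β′ ≤ q + β′
shrink-step zero    _ _ = z≤n
shrink-step (suc k) {β} {β′} {q} h h′ = ≤-trans (+-monoʳ-≤ β′ (≤-trans (*-monoʳ-≤ k h)
  (+-cancelˡ-≤ β (k * β) q (≤-trans h′ (≤-reflexive (+-comm q β)))))) (≤-reflexive (+-comm β′ q))

module LabelSizes (T₀ H : ℕ) where
  open Labels T₀ H

  size-product : ∀ (p : Fin T₀ → Bool) (q : Fin H → Bool) → size (λ l → p (proj₁ l) ∧ q (proj₂ l)) ≡ # p * # q
  size-product p q = trans (∑-cong row) (∑-*ʳ T₀ (# q) (𝟙 ∘ p))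
    where
    row : ∀ e → ∑ H (λ z → 𝟙 (p e ∧ q z)) ≡ 𝟙 (p e) * # q
    row e with p e
    ... | true  = sym (+-identityʳ _)
    ... | false = ∑-zero {H} (λ _ → refl)

  size-class : ∀ (q : Fin H → Bool) → size (λ l → q (proj₂ l)) ≡ T₀ * # q
  size-class q = ∑-const T₀ (# q)

  size-∧ : ∀ b p → size (λ l → b ∧ p l) ≡ 𝟙 b * size p
  size-∧ true  p = sym (+-identityʳ _)
  size-∧ false p = trans (∑ᴸ-const 0) (*-zeroʳ T)

#-positive : ∀ {n} → # {suc n} (λ i → 0 <ᵇ toℕ i) ≡ n
#-positive {n} = #-all {n} (λ i → refl)

division-unique : ∀ p a b {o o′} → o < p → o′ < p → a * p + o ≡ b * p + o′ → a ≡ b × o ≡ o′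
division-unique p a b {o} {o′} o<p o′<p e with <-cmp a b
... | tri< a<b _ _ = ⊥-elim (<⇒≢ (division-< a b o<p a<b) e)
  where
  division-< : ∀ a b {o o′} → o < p → a < b → a * p + o < b * p + o′
  division-< a b {o} {o′} o<p a<b = <-≤-trans (+-monoʳ-< (a * p) o<p)
    (≤-trans (≤-reflexive (+-comm (a * p) p)) (≤-trans (*-monoˡ-≤ p a<b) (m≤m+n (b * p) o′)))
... | tri≈ _ refl _ = refl , +-cancelˡ-≡ (a * p) o o′ e
... | tri> _ _ b<a = ⊥-elim (<⇒≢ (<-≤-trans (+-monoʳ-< (b * p) o′<p)
    (≤-trans (≤-reflexive (+-comm (b * p) p)) (≤-trans (*-monoˡ-≤ p b<a) (m≤m+n (a * p) o)))) (sym e))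

-- Concentration in neighbourhoods and the combined choice of a labelling.

existsL : ∀ {A : Set} → (A → Bool) → List A → Bool
existsL p []       = false
existsL p (x ∷ xs) = p x ∨ existsL p xs

existsL⁻ : ∀ {A : Set} (p : A → Bool) xs → existsL p xs ≡ true → ∃[ x ] x ∈ xs × p x ≡ true
existsL⁻ p (x ∷ xs) h with ∨-true⁻ {p x} h
... | inj₁ e = x , here refl , e
... | inj₂ e with existsL⁻ p xs e
... | y , y∈ , e′ = y , there y∈ , e′

existsL-false : ∀ {A : Set} (p : A → Bool) {xs x} → existsL p xs ≡ false → x ∈ xs → p x ≡ false
existsL-false p {x ∷ xs} h (here refl) = proj₁ (∨-false⁻ h)
existsL-false p {x ∷ xs} h (there m)   = existsL-false p (proj₂ (∨-false⁻ {p x} h)) m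

𝟙-∨ : ∀ a b → 𝟙 (a ∨ b) ≤ 𝟙 a + 𝟙 b
𝟙-∨ true  b = s≤s z≤n
𝟙-∨ false b = ≤-refl

*-𝟙-≤ : ∀ b {C y} → (b ≡ true → C ≤ y) → C * 𝟙 b ≤ y
*-𝟙-≤ true  {C} h = ≤-trans (≤-reflexive (*-identityʳ C)) (h refl)
*-𝟙-≤ false {C} h = ≤-trans (≤-reflexive (*-zeroʳ C)) z≤n

module Labelling (T₀ H : ℕ) (0<T₀ : 0 < T₀) (0<H : 0 < H) {n : ℕ} (G : Graph n) (Ω : ℕ) (0<Ω : 0 < Ω) where
  open Labels T₀ H
  open LabelSizes T₀ H

  private
    L : ℕ
    L = 48 * H

    2≤L : 2 ≤ L
    2≤L = *-mono-≤ {2} {48} {1} {H} (s≤s (s≤s z≤n)) 0<H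

    D : Fin n → ℕ
    D = degree G

  inside : Fin n → (Label → Bool) → (Fin n → Label) → ℕ
  inside v A x = # (λ u → adj G v u ∧ A (x u))

  inside≤degree : ∀ v A x → inside v A x ≤ D v
  inside≤degree v A x = #-mono {n} {λ u → adj G v u ∧ A (x u)} {adj G v} (λ u e → proj₁ (∧-true⁻ {adj G v u} e))

  -- An upward deviation of at least `D v / (8 H)` from the mean. Lower bounds come from the same
  -- event for the complementary set.
  violated : Fin n → (Label → Bool) → (Fin n → Label) → Bool
  violated v A x = 8 * (D v * size A) + T₀ * D v ≤ᵇ 8 * (T * inside v A x)

  -- The tolerated deviation, multiplied by `L = 48 H`, is worth `48 T d`. Of this 16 parts pay for
  -- the `2` in `L + 2`, 8 for the term `T X`, and 24 for the tail by `768 H² B ≤ d`; this is the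
  -- origin of 48 and 768.
  exponent-gap : ∀ d a X B → 768 * (H * H) * B ≤ d → X ≤ d → a ≤ T →
    8 * (d * a) + T₀ * d ≤ 8 * (T * X) → (L + 2) * (d * a) + T * X + L * L * T * B ≤ L * T * X
  exponent-gap d a X B hB hX ha hv = *-cancelˡ-≤ 8 (begin
    8 * ((L + 2) * (d * a) + T * X + L * L * T * B)
      ≡⟨ eq₁ H T d a X B ⟩
    L * (8 * (d * a)) + (16 * (d * a) + 8 * (T * X) + 24 * T * (768 * (H * H) * B))
      ≤⟨ +-monoʳ-≤ (L * (8 * (d * a))) (+-mono-≤ (+-mono-≤ (*-monoʳ-≤ 16 (*-monoʳ-≤ d ha)) (*-monoʳ-≤ 8 (*-monoʳ-≤ T hX))) (*-monoʳ-≤ (24 * T) hB)) ⟩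
    L * (8 * (d * a)) + (16 * (d * T) + 8 * (T * d) + 24 * T * d)
      ≡⟨ eq₂ T₀ H d a ⟩
    L * (8 * (d * a) + T₀ * d)
      ≤⟨ *-monoʳ-≤ L hv ⟩
    L * (8 * (T * X))
      ≡⟨ eq₃ L T X ⟩
    8 * (L * T * X) ∎)
    where
    open ≤-Reasoning
    eq₁ : ∀ H T d a X B → 8 * ((48 * H + 2) * (d * a) + T * X + 48 * H * (48 * H) * T * B)
      ≡ 48 * H * (8 * (d * a)) + (16 * (d * a) + 8 * (T * X) + 24 * T * (768 * (H * H) * B))
    eq₁ = solve-∀
    eq₂ : ∀ T₀ H d a → 48 * H * (8 * (d * a)) + (16 * (d * (T₀ * H)) + 8 * (T₀ * H * d) + 24 * (T₀ * H) * d)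
      ≡ 48 * H * (8 * (d * a) + T₀ * d)
    eq₂ = solve-∀
    eq₃ : ∀ L T X → L * (8 * (T * X)) ≡ 8 * (L * T * X)
    eq₃ = solve-∀

  module _ (κ : ℕ) (κ-eq : κ * (L * L * T) ≡ Ω) where

    neighbourhood : ℕ → Fin n → (Label → Bool) → Constraint n Ω
    neighbourhood coef v A = chernoff 0<T₀ 0<H L 2≤L (λ u l → adj G v u ∧ A l) coef κ Ω κ-eq

    neighbourhood-potential : ∀ coef v A x B → 768 * (H * H) * B ≤ D v → violated v A x ≡ true →
      coef * (Ω ^ n * 2 ^ B) ≤ potential x (neighbourhood coef v A)
    neighbourhood-potential coef v A x B hB h = potential-chernoff 0<T₀ 0<H L 2≤L (λ u l → adj G v u ∧ A l) coef κ Ω κ-eq x B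
      (subst (λ z → (L + 2) * z + T * inside v A x + L * L * T * B ≤ L * T * inside v A x) (sym sizes)
        (exponent-gap (D v) (size A) (inside v A x) B hB (inside≤degree v A x) (size≤T A) (≤ᵇ-true⁻ h)))
      where
      sizes : ∑ n (λ u → size (λ l → adj G v u ∧ A l)) ≡ D v * size A
      sizes = trans (∑-cong (λ u → size-∧ (adj G v u) A)) (∑-*ʳ n (size A) (𝟙 ∘ adj G v))

    bad : List (Label → Bool) → (Fin n → Label) → Fin n → Bool
    bad sets x v = existsL (λ A → violated v A x) sets

    existsL-potential : ∀ W v sets x B → 768 * (H * H) * B ≤ D v →
      W * (Ω ^ n * 2 ^ B) * 𝟙 (bad sets x v) ≤ ∑L (potential x) (map (neighbourhood W v) sets)
    existsL-potential W v [] x B h = ≤-reflexive (*-zeroʳ (W * (Ω ^ n * 2 ^ B)))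
    existsL-potential W v (A ∷ sets) x B h = begin
      C * 𝟙 (violated v A x ∨ bad sets x v)              ≤⟨ *-monoʳ-≤ C (𝟙-∨ (violated v A x) (bad sets x v)) ⟩
      C * (𝟙 (violated v A x) + 𝟙 (bad sets x v))        ≡⟨ *-distribˡ-+ C _ _ ⟩
      C * 𝟙 (violated v A x) + C * 𝟙 (bad sets x v)      ≤⟨ +-mono-≤ (*-𝟙-≤ (violated v A x) (neighbourhood-potential W v A x B h))
                                                                     (existsL-potential W v sets x B h) ⟩
      potential x (neighbourhood W v A) + ∑L (potential x) (map (neighbourhood W v) sets) ∎
      where
      open ≤-Reasoning
      C = W * (Ω ^ n * 2 ^ B)

    -- Each local constraint gets the total weight `W` of the global ones, so the whole potential is
    -- at most `Ω ^ n W (n l + 1)` with `l` the number of sets. After division by `W` this bounds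
    -- the number of bad vertices, and it bounds every global potential by itself. Local failures
    -- thus become rare, whereas a sufficiently large `B₂` excludes global ones.
    labelling : ∀ (sets : List (Label → Bool)) (globals : List (Constraint n Ω)) B → 0 < ∑L coef globals →
      (∀ v → 768 * (H * H) * B ≤ D v) →
      Σ (Fin n → Label) λ x → (# (bad sets x) * 2 ^ B ≤ n * length sets + 1)
        × (∀ {c} → c ∈ globals → potential x c ≤ Ω ^ n * (∑L coef globals * (n * length sets + 1)))
    labelling sets globals B 0<W hB = conclude (derandomise n 0<T₀ 0<H cs)
      where
      W = ∑L coef globals
      local = flat n (λ v → map (neighbourhood W v) sets)
      cs = local ++ globals
      instance
        WΩ-nonZero : NonZero (W * Ω ^ n)
        WΩ-nonZero = m*n≢0 W (Ω ^ n) {{>-nonZero 0<W}} {{m^n≢0 Ω n {{>-nonZero 0<Ω}}}}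
      row : ∀ v xs → ∑L coef (map (neighbourhood W v) xs) ≡ W * length xs
      row v []       = sym (*-zeroʳ W)
      row v (A ∷ xs) = trans (cong (W +_) (row v xs)) (sym (*-suc W (length xs)))
      total : ∑L coef cs ≡ W * (n * length sets + 1)
      total = trans (∑L-++ coef local globals) (trans (cong (_+ W) (trans (∑L-flat coef n _)
        (trans (∑-cong (λ v → row v sets)) (∑-const n _)))) (lem n W (length sets)))
        where
        lem : ∀ n W l → n * (W * l) + W ≡ W * (n * l + 1)
        lem = solve-∀
      conclude : (Σ (Fin n → Label) λ x → ∑L (potential x) cs ≤ Ω ^ n * ∑L coef cs) →
        Σ (Fin n → Label) λ x → (# (bad sets x) * 2 ^ B ≤ n * length sets + 1)
          × (∀ {c} → c ∈ globals → potential x c ≤ Ω ^ n * (∑L coef globals * (n * length sets + 1)))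
      conclude (x , h) = x , *-cancelˡ-≤ (W * Ω ^ n) few ,
        (λ c∈ → ≤-trans (∑L-∈ (potential x) (∈-++⁺ʳ local c∈)) h′)
        where
        h′ : ∑L (potential x) cs ≤ Ω ^ n * (W * (n * length sets + 1))
        h′ = ≤-trans h (≤-reflexive (cong (Ω ^ n *_) total))
        few : W * Ω ^ n * (# (bad sets x) * 2 ^ B) ≤ W * Ω ^ n * (n * length sets + 1)
        few = begin
          W * Ω ^ n * (# (bad sets x) * 2 ^ B)               ≡⟨ lem W (Ω ^ n) (# (bad sets x)) (2 ^ B) ⟩
          W * (Ω ^ n * 2 ^ B) * # (bad sets x)               ≡⟨ ∑-*ˡ n (W * (Ω ^ n * 2 ^ B)) (𝟙 ∘ bad sets x) ⟨
          ∑ n (λ v → W * (Ω ^ n * 2 ^ B) * 𝟙 (bad sets x v)) ≤⟨ ∑-mono (λ v → existsL-potential W v sets x B (hB v)) ⟩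
          ∑ n (λ v → ∑L (potential x) (map (neighbourhood W v) sets)) ≡⟨ ∑L-flat (potential x) n _ ⟨
          ∑L (potential x) local                             ≤⟨ m≤m+n _ _ ⟩
          ∑L (potential x) local + ∑L (potential x) globals  ≡⟨ ∑L-++ (potential x) local globals ⟨
          ∑L (potential x) cs                                ≤⟨ h′ ⟩
          Ω ^ n * (W * (n * length sets + 1))                ≡⟨ lem₂ (Ω ^ n) W _ ⟩
          W * Ω ^ n * (n * length sets + 1)                  ∎
          where
          open ≤-Reasoning
          lem : ∀ a b c d → a * b * (c * d) ≡ a * (b * d) * c
          lem = solve-∀
          lem₂ : ∀ a b c → a * (b * c) ≡ b * a * c
          lem₂ = solve-∀


-- Numerical inequalities behind the global tail bounds.

module CellGap (n δ s γ M μ H T₀ : ℕ) (M≡ : M ≡ 16 + μ) (T₀≡ : T₀ ≡ 12 * H * M)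
  (0<sδ : 0 < s * δ) (0<H : 0 < H) (capacity : n * (M + 16) ≤ 3 * (s * δ) * M) (δ≤γ : δ ≤ 4 * (H * M) * γ) (M²≤H : M * M ≤ H) where

  private
    N x T : ℕ
    N = 3 * (s * δ)
    x = γ * s
    T = T₀ * H

    0<M : 0 < M
    0<M rewrite M≡ = s≤s z≤n

    n≤N : n ≤ N
    n≤N = *-cancelʳ-≤ n N M {{>-nonZero 0<M}} (≤-trans (*-monoʳ-≤ n (m≤m+n M 16)) capacity)

    N≤x : N ≤ 12 * (H * M) * x
    N≤x = ≤-trans (*-monoʳ-≤ 3 (*-monoʳ-≤ s δ≤γ)) (≤-reflexive (lem s (H * M) γ))
      where
      lem : ∀ s p γ → 3 * (s * (4 * p * γ)) ≡ 12 * p * (γ * s)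
      lem = solve-∀

    HN≤Tx : H * N ≤ T * x
    HN≤Tx = ≤-trans (*-monoʳ-≤ H N≤x) (≤-reflexive (trans (lem H M x) (cong (λ z → z * H * x) (sym T₀≡))))
      where
      lem : ∀ H M x → H * (12 * (H * M) * x) ≡ 12 * H * M * H * x
      lem = solve-∀

    -- Here `31 + 2 μ = 2 M - 1` and `12 + μ = M - 4`. The cubic terms of both sides agree; the 16
    -- in `M + 16` decides at the quadratic term, with 65 against 368.
    polynomial : 32 * ((M + 1) * (M + 1)) * M + M * (M + 16) ≤ 16 * ((31 + 2 * μ) * (12 + μ)) * (M + 16)
    polynomial = subst (λ M → 32 * ((M + 1) * (M + 1)) * M + M * (M + 16) ≤ 16 * ((31 + 2 * μ) * (12 + μ)) * (M + 16)) (sym M≡)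
      (≤-cancel-cert (303 * (μ * μ) + 7408 * μ + 41984) (≤-refl {0}) (lem μ))
      where
      lem : ∀ μ → 32 * ((16 + μ + 1) * (16 + μ + 1)) * (16 + μ) + (16 + μ) * (16 + μ + 16) + 0 + (303 * (μ * μ) + 7408 * μ + 41984)
        ≡ 16 * ((31 + 2 * μ) * (12 + μ)) * (16 + μ + 16) + 0
      lem = solve-∀

    density : 32 * ((M + 1) * (M + 1)) * n + M * N ≤ 16 * ((31 + 2 * μ) * (12 + μ)) * N
    density = *-cancelʳ-≤ _ _ (M + 16) {{>-nonZero (≤-trans 0<M (m≤m+n M 16))}} (begin
      (32 * ((M + 1) * (M + 1)) * n + M * N) * (M + 16)          ≡⟨ lem₁ M n N ⟩
      32 * ((M + 1) * (M + 1)) * (n * (M + 16)) + M * (M + 16) * N ≤⟨ +-monoˡ-≤ _ (*-monoʳ-≤ (32 * ((M + 1) * (M + 1))) capacity) ⟩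
      32 * ((M + 1) * (M + 1)) * (N * M) + M * (M + 16) * N      ≡⟨ lem₂ M N ⟩
      (32 * ((M + 1) * (M + 1)) * M + M * (M + 16)) * N          ≤⟨ *-monoˡ-≤ N polynomial ⟩
      16 * ((31 + 2 * μ) * (12 + μ)) * (M + 16) * N              ≡⟨ lem₃ (16 * ((31 + 2 * μ) * (12 + μ))) (M + 16) N ⟩
      16 * ((31 + 2 * μ) * (12 + μ)) * N * (M + 16)              ∎)
      where
      open ≤-Reasoning
      lem₁ : ∀ M n N → (32 * ((M + 1) * (M + 1)) * n + M * N) * (M + 16) ≡ 32 * ((M + 1) * (M + 1)) * (n * (M + 16)) + M * (M + 16) * N
      lem₁ = solve-∀
      lem₂ : ∀ M N → 32 * ((M + 1) * (M + 1)) * (N * M) + M * (M + 16) * N ≡ (32 * ((M + 1) * (M + 1)) * M + M * (M + 16)) * N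
      lem₂ = solve-∀
      lem₃ : ∀ a b c → a * b * c ≡ a * c * b
      lem₃ = solve-∀

  -- Apart from rounding, a cell has mean load at most `n M x / N ≤ M² x / (M + 16)`, about
  -- `(M - 16) x`, and room for `(M - 4) x`. The relative gap of about `12 / M` pays for the
  -- `3 / (2 M)` lost in the tail bound with `L = 2 M`, for the rounding and for the term with `B`.
  cell-gap : ∀ Y B X → 768 * (H * H) * B ≤ n → 8 * N * Y ≤ n * (8 * T * (M * x) + 8 * N * H) → x * (12 + μ) ≤ X →
    (2 * M + 2) * Y + T * X + 2 * M * (2 * M) * T * B ≤ 2 * M * T * X
  cell-gap Y B X hB hY hX = begin
    (2 * M + 2) * Y + T * X + 2 * M * (2 * M) * T * B        ≡⟨ lem₁ M Y T X B ⟩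
    ((2 * M + 2) * Y + 4 * (M * M) * T * B) + T * X          ≤⟨ +-monoˡ-≤ (T * X) main ⟩
    (31 + 2 * μ) * (T * X) + T * X                           ≡⟨ lem₂ μ (T * X) ⟩
    2 * (16 + μ) * (T * X)                                   ≡⟨ cong (λ z → 2 * z * (T * X)) (sym M≡) ⟩
    2 * M * (T * X)                                          ≡⟨ *-assoc (2 * M) T X ⟨
    2 * M * T * X                                            ∎
    where
    open ≤-Reasoning
    lem₁ : ∀ M Y T X B → (2 * M + 2) * Y + T * X + 2 * M * (2 * M) * T * B ≡ ((2 * M + 2) * Y + 4 * (M * M) * T * B) + T * X
    lem₁ = solve-∀
    lem₂ : ∀ μ y → (31 + 2 * μ) * y + y ≡ 2 * (16 + μ) * y
    lem₂ = solve-∀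
    64HB≤Mx : 64 * H * B ≤ M * x
    64HB≤Mx = *-cancelʳ-≤ (64 * H * B) (M * x) (12 * H) {{>-nonZero (*-mono-< {0} {12} (s≤s z≤n) 0<H)}} (begin
      64 * H * B * (12 * H)  ≡⟨ lem H B ⟩
      768 * (H * H) * B      ≤⟨ ≤-trans hB (≤-trans n≤N N≤x) ⟩
      12 * (H * M) * x       ≡⟨ lem₃ H M x ⟩
      M * x * (12 * H)       ∎)
      where
      lem : ∀ H B → 64 * H * B * (12 * H) ≡ 768 * (H * H) * B
      lem = solve-∀
      lem₃ : ∀ H M x → 12 * (H * M) * x ≡ M * x * (12 * H)
      lem₃ = solve-∀
    64M²B≤Mx : 64 * (M * M) * B ≤ M * x
    64M²B≤Mx = ≤-trans (*-monoˡ-≤ B (*-monoʳ-≤ 64 M²≤H)) 64HB≤Mx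
    instance
      nz : NonZero (128 * N)
      nz = >-nonZero (*-mono-< {0} {128} {0} {N} (s≤s z≤n) (*-mono-< {0} {3} {0} (s≤s z≤n) 0<sδ))
    main : (2 * M + 2) * Y + 4 * (M * M) * T * B ≤ (31 + 2 * μ) * (T * X)
    main = *-cancelˡ-≤ (128 * N) (begin
      128 * N * ((2 * M + 2) * Y + 4 * (M * M) * T * B)
        ≡⟨ eq₁ N M Y T B ⟩
      32 * (M + 1) * (8 * N * Y) + 8 * (N * T) * (64 * (M * M) * B)
        ≤⟨ +-mono-≤ (*-monoʳ-≤ (32 * (M + 1)) hY) (*-monoʳ-≤ (8 * (N * T)) 64M²B≤Mx) ⟩
      32 * (M + 1) * (n * (8 * T * (M * x) + 8 * N * H)) + 8 * (N * T) * (M * x)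
        ≡⟨ eq₂ M n T x N H ⟩
      256 * (M + 1) * n * (T * (M * x)) + 256 * (M + 1) * n * (H * N) + 8 * (N * T) * (M * x)
        ≤⟨ +-monoˡ-≤ _ (+-monoʳ-≤ (256 * (M + 1) * n * (T * (M * x))) (*-monoʳ-≤ (256 * (M + 1) * n) HN≤Tx)) ⟩
      256 * (M + 1) * n * (T * (M * x)) + 256 * (M + 1) * n * (T * x) + 8 * (N * T) * (M * x)
        ≡⟨ eq₃ M n T x N ⟩
      8 * (T * x) * (32 * ((M + 1) * (M + 1)) * n + M * N)
        ≤⟨ *-monoʳ-≤ (8 * (T * x)) density ⟩
      8 * (T * x) * (16 * ((31 + 2 * μ) * (12 + μ)) * N)
        ≡⟨ eq₄ T x (31 + 2 * μ) (12 + μ) N ⟩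
      128 * N * ((31 + 2 * μ) * (T * (x * (12 + μ))))
        ≤⟨ *-monoʳ-≤ (128 * N) (*-monoʳ-≤ (31 + 2 * μ) (*-monoʳ-≤ T hX)) ⟩
      128 * N * ((31 + 2 * μ) * (T * X)) ∎)
      where
      eq₁ : ∀ N M Y T B → 128 * N * ((2 * M + 2) * Y + 4 * (M * M) * T * B) ≡ 32 * (M + 1) * (8 * N * Y) + 8 * (N * T) * (64 * (M * M) * B)
      eq₁ = solve-∀
      eq₂ : ∀ M n T x N H → 32 * (M + 1) * (n * (8 * T * (M * x) + 8 * N * H)) + 8 * (N * T) * (M * x)
        ≡ 256 * (M + 1) * n * (T * (M * x)) + 256 * (M + 1) * n * (H * N) + 8 * (N * T) * (M * x)
      eq₂ = solve-∀
      eq₃ : ∀ M n T x N → 256 * (M + 1) * n * (T * (M * x)) + 256 * (M + 1) * n * (T * x) + 8 * (N * T) * (M * x)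
        ≡ 8 * (T * x) * (32 * ((M + 1) * (M + 1)) * n + M * N)
      eq₃ = solve-∀
      eq₄ : ∀ T x a b N → 8 * (T * x) * (16 * (a * b) * N) ≡ 128 * N * (a * (T * (x * b)))
      eq₄ = solve-∀

-- A tail bound up to a constant factor, with `L = 8`. The mean is at most `7 n g² / H²`, and 18
-- arises from `10 * 7 + 56 = 7 * 18`, where 56 is reserved for the term with `B`.
query-gap : ∀ n g H T₀ Y X B → 0 < H → 0 < g → H * Y ≤ n * (7 * (g * g) * T₀) → 18 * (n * (g * g)) ≤ H * H * X →
  768 * (H * H) * B ≤ n → (8 + 2) * Y + T₀ * H * X + 8 * 8 * (T₀ * H) * B ≤ 8 * (T₀ * H) * X
query-gap n g H T₀ Y X B 0<H 0<g hY hX hB = *-cancelˡ-≤ (H * H) {{>-nonZero (*-mono-< 0<H 0<H)}} (begin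
  H * H * ((8 + 2) * Y + T₀ * H * X + 8 * 8 * (T₀ * H) * B)
    ≡⟨ eq₁ H T₀ Y X B ⟩
  10 * H * (H * Y) + T₀ * H * (64 * (H * H) * B) + T₀ * H * (H * H * X)
    ≤⟨ +-monoˡ-≤ (T₀ * H * (H * H * X)) (+-mono-≤ (*-monoʳ-≤ (10 * H) hY) (*-monoʳ-≤ (T₀ * H) 64≤)) ⟩
  10 * H * (n * (7 * (g * g) * T₀)) + T₀ * H * (56 * (n * (g * g))) + T₀ * H * (H * H * X)
    ≡⟨ eq₂ H T₀ n (g * g) (H * H * X) ⟩
  7 * (T₀ * H) * (18 * (n * (g * g))) + T₀ * H * (H * H * X)
    ≤⟨ +-monoˡ-≤ (T₀ * H * (H * H * X)) (*-monoʳ-≤ (7 * (T₀ * H)) hX) ⟩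
  7 * (T₀ * H) * (H * H * X) + T₀ * H * (H * H * X)
    ≡⟨ eq₃ (T₀ * H) (H * H) X ⟩
  H * H * (8 * (T₀ * H) * X) ∎)
  where
  open ≤-Reasoning
  64≤ : 64 * (H * H) * B ≤ 56 * (n * (g * g))
  64≤ = ≤-trans (*-monoˡ-≤ B (*-monoˡ-≤ (H * H) {64} {768} (m≤m+n 64 704))) (≤-trans hB
    (≤-trans (≤-trans (≤-reflexive (sym (*-identityʳ n))) (*-monoʳ-≤ n (*-mono-≤ 0<g 0<g))) (m≤m+n _ _)))
  eq₁ : ∀ H T₀ Y X B → H * H * ((8 + 2) * Y + T₀ * H * X + 8 * 8 * (T₀ * H) * B)
    ≡ 10 * H * (H * Y) + T₀ * H * (64 * (H * H) * B) + T₀ * H * (H * H * X)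
  eq₁ = solve-∀
  eq₂ : ∀ H T₀ n q z → 10 * H * (n * (7 * q * T₀)) + T₀ * H * (56 * (n * q)) + T₀ * H * z ≡ 7 * (T₀ * H) * (18 * (n * q)) + T₀ * H * z
  eq₂ = solve-∀
  eq₃ : ∀ T a X → 7 * T * (a * X) + T * (a * X) ≡ a * (8 * T * X)
  eq₃ = solve-∀

class-gap : ∀ n H T₀ X B → 0 < H → 2 * n ≤ H * X → 768 * (H * H) * B ≤ n →
  (8 + 2) * (n * (T₀ * 1)) + T₀ * H * X + 8 * 8 * (T₀ * H) * B ≤ 8 * (T₀ * H) * X
class-gap n H T₀ X B 0<H hX hB = begin
  (8 + 2) * (n * (T₀ * 1)) + T₀ * H * X + 8 * 8 * (T₀ * H) * B ≡⟨ eq₁ n T₀ H X B ⟩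
  T₀ * (10 * n + 64 * H * B) + T₀ * H * X        ≤⟨ +-monoˡ-≤ (T₀ * H * X) (*-monoʳ-≤ T₀ (+-monoʳ-≤ (10 * n) 64≤)) ⟩
  T₀ * (10 * n + 4 * n) + T₀ * H * X             ≡⟨ eq₂ T₀ n (T₀ * H * X) ⟩
  7 * T₀ * (2 * n) + T₀ * H * X                  ≤⟨ +-monoˡ-≤ (T₀ * H * X) (*-monoʳ-≤ (7 * T₀) hX) ⟩
  7 * T₀ * (H * X) + T₀ * H * X                  ≡⟨ eq₃ T₀ H X ⟩
  8 * (T₀ * H) * X                               ∎
  where
  open ≤-Reasoning
  64≤ : 64 * H * B ≤ 4 * n
  64≤ = ≤-trans (*-monoˡ-≤ B (*-mono-≤ {64} {768} (m≤m+n 64 704) (≤-trans (≤-reflexive (sym (*-identityʳ H))) (*-monoʳ-≤ H 0<H)))) (≤-trans hB (m≤m+n n _))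
  eq₁ : ∀ n T₀ H X B → (8 + 2) * (n * (T₀ * 1)) + T₀ * H * X + 8 * 8 * (T₀ * H) * B ≡ T₀ * (10 * n + 64 * H * B) + T₀ * H * X
  eq₁ = solve-∀
  eq₂ : ∀ T₀ n z → T₀ * (10 * n + 4 * n) + z ≡ 7 * T₀ * (2 * n) + z
  eq₂ = solve-∀
  eq₃ : ∀ T₀ H X → 7 * T₀ * (H * X) + T₀ * H * X ≡ 8 * (T₀ * H) * X
  eq₃ = solve-∀

-- k counts the levels in a query window.
query-count : ∀ k s d δ g H H₁ T₀ τ → H ≡ suc H₁ → 0 < H₁ → 12 * H ≤ T₀ → 6 ≤ g → 0 < s * d → δ ≤ d → (τ + 5) * H ≤ 2 * (δ * g) →
  k * (24 * (s * d) * H₁) ≤ (8 * (T₀ * H) * ((τ + 5) * s) + 6 * (s * d) * T₀ * (8 * g + 17)) + 24 * (s * d) * H₁ →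
  H * k ≤ 7 * g * T₀
query-count k s d δ g H H₁ T₀ τ H≡ 0<H₁ 12H≤T₀ 6≤g 0<sd δ≤d hτ h = *-cancelʳ-≤ (H * k) (7 * g * T₀) 12 (begin
  H * k * 12              ≡⟨ lem₀ H k ⟩
  k * (12 * H)            ≤⟨ shrink-step k {q = A} 12H≤24H₁ reduced ⟩
  A + 12 * H              ≤⟨ +-monoʳ-≤ A 12H≤T₀ ⟩
  A + T₀                  ≡⟨ lem₁ T₀ g ⟩
  T₀ * (64 * g + 103)     ≤⟨ *-monoʳ-≤ T₀ (+-monoʳ-≤ (64 * g) (≤-trans (m≤m+n 103 17) (*-monoʳ-≤ 20 6≤g))) ⟩
  T₀ * (64 * g + 20 * g)  ≡⟨ lem₂ T₀ g ⟩
  7 * g * T₀ * 12         ∎)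
  where
  open ≤-Reasoning
  A = 16 * (T₀ * g) + 6 * T₀ * (8 * g + 17)
  12H≤24H₁ : 12 * H ≤ 24 * H₁
  12H≤24H₁ rewrite H≡ = ≤-trans (*-monoʳ-≤ 12 (+-monoˡ-≤ H₁ 0<H₁)) (≤-reflexive (lem H₁))
    where
    lem : ∀ H₁ → 12 * (H₁ + H₁) ≡ 24 * H₁
    lem = solve-∀
  reduced : k * (24 * H₁) ≤ A + 24 * H₁
  reduced = *-cancelˡ-≤ (s * d) {{>-nonZero 0<sd}} (begin
    s * d * (k * (24 * H₁))       ≡⟨ lem₃ (s * d) k H₁ ⟩
    k * (24 * (s * d) * H₁)       ≤⟨ h ⟩
    (8 * (T₀ * H) * ((τ + 5) * s) + 6 * (s * d) * T₀ * (8 * g + 17)) + 24 * (s * d) * H₁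
                                  ≡⟨ lem₄ T₀ H τ s (s * d) g H₁ ⟩
    (8 * T₀ * s * ((τ + 5) * H) + 6 * (s * d) * T₀ * (8 * g + 17)) + 24 * (s * d) * H₁
                                  ≤⟨ +-monoˡ-≤ _ (+-monoˡ-≤ _ (*-monoʳ-≤ (8 * T₀ * s) (≤-trans hτ (*-monoʳ-≤ 2 (*-monoˡ-≤ g δ≤d))))) ⟩
    (8 * T₀ * s * (2 * (d * g)) + 6 * (s * d) * T₀ * (8 * g + 17)) + 24 * (s * d) * H₁
                                  ≡⟨ lem₅ T₀ s d g H₁ ⟩
    s * d * (A + 24 * H₁)         ∎)
    where
    lem₃ : ∀ p k h → p * (k * (24 * h)) ≡ k * (24 * p * h)
    lem₃ = solve-∀
    lem₄ : ∀ T₀ H τ s p g h → (8 * (T₀ * H) * ((τ + 5) * s) + 6 * p * T₀ * (8 * g + 17)) + 24 * p * h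
      ≡ (8 * T₀ * s * ((τ + 5) * H) + 6 * p * T₀ * (8 * g + 17)) + 24 * p * h
    lem₄ = solve-∀
    lem₅ : ∀ T₀ s d g h → (8 * T₀ * s * (2 * (d * g)) + 6 * (s * d) * T₀ * (8 * g + 17)) + 24 * (s * d) * h
      ≡ s * d * (16 * (T₀ * g) + 6 * T₀ * (8 * g + 17) + 24 * h)
    lem₅ = solve-∀
  lem₀ : ∀ H k → H * k * 12 ≡ k * (12 * H)
  lem₀ = solve-∀
  lem₁ : ∀ T₀ g → 16 * (T₀ * g) + 6 * T₀ * (8 * g + 17) + T₀ ≡ T₀ * (64 * g + 103)
  lem₁ = solve-∀
  lem₂ : ∀ T₀ g → T₀ * (64 * g + 20 * g) ≡ 7 * g * T₀ * 12
  lem₂ = solve-∀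

#-above-zero : ∀ {H H₁} → H ≡ suc H₁ → # {H} (λ i → 0 <ᵇ toℕ i) ≡ H₁
#-above-zero {H₁ = H₁} refl = #-positive {H₁}

#-between : ∀ {H H₁} g → H ≡ suc H₁ → g ≤ H₁ → # {H} (λ i → (0 <ᵇ toℕ i) ∧ (toℕ i <ᵇ suc g)) ≡ g
#-between {H₁ = H₁} g refl h = #-below {H₁} g h

-- H and T₀ are the numbers of classes and levels, 1/H and g/H the densities of
-- the two reservoirs P (class 0) and Q (classes 1, …, g); T = T₀ H is the number
-- of labels, and values are grouped into cells of length M γ s.  The greedy stage
-- changes weights in steps of s, up to τ of the r designated edges at a vertex,
-- and reaches N free windows; B₁ and B₂ are the exponents of the tail bounds.
record Parameters {n : ℕ} (G : Graph n) : Set where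
  field
    δ M μ g H H₁ T₀ s γ τ r N B₁ B₂ : ℕ
    M≡       : M ≡ 16 + μ
    H≡       : H ≡ suc H₁
    T₀≡      : T₀ ≡ 12 * H * M
    0<n      : 0 < n
    δ≤deg    : ∀ v → δ ≤ degree G v
    0<δ      : 0 < δ
    28≤s     : 28 ≤ s
    -- Equivalent to `3 s ≥ (n / δ) (1 + 16 / M)`.
    capacity : n * (M + 16) ≤ 3 * (s * δ) * M
    γ-upper  : 2 * (H * M) * γ ≤ δ
    γ-lower  : δ ≤ 4 * (H * M) * γ
    M²≤H     : M * M ≤ H
    6≤g      : 6 ≤ g
    g≤H₁     : g ≤ H₁
    τ-upper  : (τ + 5) * H ≤ 2 * (δ * g)
    B₁-small : 768 * (H * H) * B₁ ≤ δ
    B₂-small : 768 * (H * H) * B₂ ≤ n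
    -- The factor `(1 + δ)²` makes bad vertices so rare that everything within two designated steps
    -- of them still has density at most `1 / H`.
    B₁-large : H * (T₀ * 2 + 4) * ((1 + δ) * (1 + δ)) ≤ 2 ^ B₁
    B₂-large : ((n + 6 * (s * n) + s + 1) * 2 + 1) * (n * (T₀ * 2 + 3) + 1) < 2 ^ B₂
    τ+2≤r    : τ + 2 ≤ r
    r-upper  : H * r ≤ δ * g
    0<N      : 0 < N
    MN≤τ     : M * N ≤ τ
    -- The competitors in a search, `3 n / H` exceptional and `18 n g² / H²` ordinary ones, average
    -- at most `s / 8` per free window.
    budget   : 8 * (3 * (n * H) + 18 * (n * (g * g))) ≤ H * H * (N * s)

-- The events that are controlled, and a labelling that satisfies them.

module Setting {n : ℕ} (G : Graph n) (parameters : Parameters G) where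

  open Parameters parameters
  open Labels T₀ H public
  open LabelSizes T₀ H

  D : Fin n → ℕ
  D = degree G

  -- Exceeds every cell index (`index<Nc`) and every query position near the value of an
  -- unexceptional vertex (`value-bounded`), so finitely many global constraints suffice.
  Nc : ℕ
  Nc = n + 6 * (s * n) + s + 1

  0<H : 0 < H
  0<H = subst (0 <_) (sym H≡) (s≤s z≤n)

  0<M : 0 < M
  0<M = subst (0 <_) (sym M≡) (s≤s z≤n)

  0<H₁ : 0 < H₁
  0<H₁ = ≤-trans (≤-trans (s≤s z≤n) 6≤g) g≤H₁

  0<T₀ : 0 < T₀
  0<T₀ = subst (0 <_) (sym T₀≡) (*-mono-< (*-mono-< {0} {12} (s≤s z≤n) 0<H) 0<M)

  0<T : 0 < T
  0<T = *-mono-< 0<T₀ 0<H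

  0<s : 0 < s
  0<s = ≤-trans (s≤s z≤n) 28≤s

  0<D : ∀ v → 0 < D v
  0<D v = <-≤-trans 0<δ (δ≤deg v)

  lev cls : Label → ℕ
  lev l = toℕ (proj₁ l)
  cls l = toℕ (proj₂ l)

  reach : ℕ → Label → Bool
  reach e l = (T₀ ≤ᵇ e + lev l) ∧ (0 <ᵇ cls l)

  -- Reaching sets and the reservoir come with complements, for control from both sides. For the
  -- positive classes only an upper bound is imposed, which is a lower bound for class 0, the
  -- vertices that absorb deviations.
  sets : List (Label → Bool)
  sets = flat T₀ (λ e → reach (toℕ e) ∷ (λ l → not (reach (toℕ e) l)) ∷ []) ++
    ((λ l → 0 <ᵇ cls l) ∷ (λ l → cls l <ᵇ suc g) ∷ (λ l → not (cls l <ᵇ suc g)) ∷ [])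

  cell : ℕ
  cell = M * (γ * s)

  -- `base u + slope u * level` is `8 T` times the upper estimate `D u + 3 s (D u level H₁ / T + D u
  -- / (8 H))` of the value of `u` before the adjustment towards class 0, the last term being the
  -- tolerated deviation.
  base slope : Fin n → ℕ
  base  u = 8 * T * D u + 3 * (s * D u) * T₀
  slope u = 24 * (s * D u) * H₁

  cellWindow : ℕ → Fin n → ℕ → Bool
  cellWindow i u = window (base u) (slope u) (i * (8 * T * cell)) (8 * T * cell)

  -- `8 g + 17 = 8 (g + 2) + 1` counts eighths of `D u / H`: at most `D u (g + 2) / H` designated
  -- edges, each off by at most `3 s`, and one eighth for the concentration error. The width
  -- contains it twice, for errors in both directions.
  queryBase queryWidth : Fin n → ℕ
  queryBase  u = 8 * T * D u + 3 * (s * D u) * T₀ * (8 * g + 17) + 8 * T * s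
  queryWidth u = 8 * T * ((τ + 5) * s) + 6 * (s * D u) * T₀ * (8 * g + 17)

  -- Contains the level of every vertex u of Q that may compete with a vertex of R
  -- searching for a free value from y on.
  queryWindow : ℕ → Fin n → ℕ → Bool
  queryWindow y u = window (queryBase u) (slope u) (8 * T * y) (queryWidth u)

  member query : ℕ → Fin n → Label → Bool
  member i u l = cellWindow i u (lev l) ∧ (0 <ᵇ cls l)
  query  y u l = queryWindow y u (lev l) ∧ ((0 <ᵇ cls l) ∧ (cls l <ᵇ suc g))

  class₀ : Fin n → Label → Bool
  class₀ u l = cls l <ᵇ 1

  abstract
    -- The normalisers `L² T` of the three families, with `L` equal to `48 H`, `2 M` and `8`, all
    -- divide this number; `κ₁`, `κ₂`, `κ₃` are the cofactors.
    Ω : ℕ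
    Ω = 48 * H * (48 * H) * (2 * M * (2 * M)) * (8 * 8) * T

    0<Ω : 0 < Ω
    0<Ω = *-mono-< (*-mono-< {0} {48 * H * (48 * H) * (2 * M * (2 * M))} {0} {8 * 8}
      (*-mono-< (*-mono-< 0<48H 0<48H) (*-mono-< 0<2M 0<2M)) (s≤s z≤n)) 0<T
      where
      0<48H : 0 < 48 * H
      0<48H = *-mono-< {0} {48} (s≤s z≤n) 0<H
      0<2M : 0 < 2 * M
      0<2M = *-mono-< {0} {2} (s≤s z≤n) 0<M

    κ₁ κ₂ κ₃ : ℕ
    κ₁ = 2 * M * (2 * M) * (8 * 8)
    κ₂ = 48 * H * (48 * H) * (8 * 8)
    κ₃ = 48 * H * (48 * H) * (2 * M * (2 * M))

    κ₁-eq : κ₁ * (48 * H * (48 * H) * T) ≡ Ω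
    κ₁-eq = lem (48 * H * (48 * H)) (2 * M * (2 * M)) (8 * 8) T
      where
      lem : ∀ a b c t → b * c * (a * t) ≡ a * b * c * t
      lem = solve-∀
    κ₂-eq : κ₂ * (2 * M * (2 * M) * T) ≡ Ω
    κ₂-eq = lem (48 * H * (48 * H)) (2 * M * (2 * M)) (8 * 8) T
      where
      lem : ∀ a b c t → a * c * (b * t) ≡ a * b * c * t
      lem = solve-∀
    κ₃-eq : κ₃ * (8 * 8 * T) ≡ Ω
    κ₃-eq = sym (*-assoc (48 * H * (48 * H) * (2 * M * (2 * M))) (8 * 8) T)

  module Lab = Labelling T₀ H 0<T₀ 0<H G Ω 0<Ω

  2≤2M : 2 ≤ 2 * M
  2≤2M = *-monoʳ-≤ 2 0<M

  bad : (Fin n → Label) → Fin n → Bool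
  bad = Lab.bad κ₁ κ₁-eq sets

  cellC queryC : ℕ → Constraint n Ω
  cellC  i = chernoff 0<T₀ 0<H (2 * M) 2≤2M (member i) 1 κ₂ Ω κ₂-eq
  queryC y = chernoff 0<T₀ 0<H 8 (s≤s (s≤s z≤n)) (query y) 1 κ₃ Ω κ₃-eq
  classC : Constraint n Ω
  classC   = chernoff 0<T₀ 0<H 8 (s≤s (s≤s z≤n)) class₀ 1 κ₃ Ω κ₃-eq

  globals : List (Constraint n Ω)
  globals = flat Nc (λ i → cellC (toℕ i) ∷ queryC (toℕ i) ∷ []) ++ (classC ∷ [])

  globals-coef : ∑L coef globals ≡ Nc * 2 + 1
  globals-coef = trans (∑L-++ coef (flat Nc _) (classC ∷ [])) (cong (_+ 1) (trans (∑L-flat coef Nc _) (∑-const Nc 2)))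

  sets-length : length sets ≡ T₀ * 2 + 3
  sets-length = trans (length-++ (flat T₀ _)) (cong (_+ 3) (trans (∑-length-flat T₀ _) (∑-const T₀ 2)))

  member-size : ∀ i u → 24 * (s * δ) * size (member i u) ≤ 8 * T * cell + 24 * (s * δ) * H
  member-size i u = subst (λ z → 24 * (s * δ) * z ≤ 8 * T * cell + 24 * (s * δ) * H) (sym size≡) (begin
    24 * (s * δ) * (k * H₁)               ≡⟨ lem k (24 * (s * δ)) H₁ ⟩
    k * (24 * (s * δ) * H₁)               ≤⟨ shrink-step k (*-monoˡ-≤ H₁ (*-monoʳ-≤ 24 (*-monoʳ-≤ s (δ≤deg u)))) (#-window T₀ (base u) (slope u) (i * (8 * T * cell)) (8 * T * cell)) ⟩
    8 * T * cell + 24 * (s * δ) * H₁      ≤⟨ +-monoʳ-≤ (8 * T * cell) (*-monoʳ-≤ (24 * (s * δ)) (subst (H₁ ≤_) (sym H≡) (n≤1+n H₁))) ⟩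
    8 * T * cell + 24 * (s * δ) * H       ∎)
    where
    open ≤-Reasoning
    k = # {T₀} (λ e → cellWindow i u (toℕ e))
    size≡ : size (member i u) ≡ k * H₁
    size≡ = trans (size-product (λ e → cellWindow i u (toℕ e)) (λ z → 0 <ᵇ toℕ z))
      (cong (k *_) (#-above-zero {H} H≡))
    lem : ∀ k a h → a * (k * h) ≡ k * (a * h)
    lem = solve-∀

  query-size : ∀ y u → H * size (query y u) ≤ 7 * (g * g) * T₀
  query-size y u = subst (λ z → H * z ≤ 7 * (g * g) * T₀) (sym size≡) (begin
    H * (k * g)         ≡⟨ *-assoc H k g ⟨
    H * k * g           ≤⟨ *-monoˡ-≤ g (query-count k s (D u) δ g H H₁ T₀ τ H≡ 0<H₁ 12H≤T₀ 6≤g (*-mono-< 0<s (0<D u)) (δ≤deg u) τ-upper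
                             (#-window T₀ (queryBase u) (slope u) (8 * T * y) (queryWidth u))) ⟩
    7 * g * T₀ * g      ≡⟨ lem g T₀ ⟩
    7 * (g * g) * T₀    ∎)
    where
    open ≤-Reasoning
    k = # {T₀} (λ e → queryWindow y u (toℕ e))
    size≡ : size (query y u) ≡ k * g
    size≡ = trans (size-product (λ e → queryWindow y u (toℕ e)) (λ z → (0 <ᵇ toℕ z) ∧ (toℕ z <ᵇ suc g))) (cong (k *_) (#-between {H} g H≡ g≤H₁))
    12H≤T₀ : 12 * H ≤ T₀
    12H≤T₀ = subst (12 * H ≤_) (sym T₀≡) (≤-trans (≤-reflexive (sym (*-identityʳ (12 * H)))) (*-monoʳ-≤ (12 * H) 0<M))
    lem : ∀ g T₀ → 7 * g * T₀ * g ≡ 7 * (g * g) * T₀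
    lem = solve-∀

  record GoodLabelling : Set where
    field
      x         : Fin n → Label
      few-bad   : H * (# (bad x) * ((1 + δ) * (1 + δ))) ≤ n
      cell-load : ∀ i → i < Nc → # (λ u → member i u (x u)) ≤ γ * s * (12 + μ)
      query-load : ∀ y → y < Nc → H * H * # (λ u → query y u (x u)) ≤ 18 * (n * (g * g))
      class-load : H * # (λ u → class₀ u (x u)) ≤ 2 * n

  good-labelling : GoodLabelling
  good-labelling = build (Lab.labelling κ₁ κ₁-eq sets globals B₁
    (subst (0 <_) (sym globals-coef) (≤-trans (s≤s z≤n) (m≤n+m 1 (Nc * 2))))
    (λ v → ≤-trans B₁-small (δ≤deg v)))
    where
    build : (Σ (Fin n → Label) λ x → (# (bad x) * 2 ^ B₁ ≤ n * length sets + 1)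
      × (∀ {c} → c ∈ globals → potential x c ≤ Ω ^ n * (∑L coef globals * (n * length sets + 1)))) → GoodLabelling
    build (x , few , small) = record { x = x ; few-bad = few-bad ; cell-load = cell-load ; query-load = query-load ; class-load = class-load }
      where
      few-bad : H * (# (bad x) * ((1 + δ) * (1 + δ))) ≤ n
      few-bad = *-cancelʳ-≤ _ n (T₀ * 2 + 4) {{>-nonZero (≤-trans (s≤s z≤n) (m≤n+m 4 (T₀ * 2)))}} (begin
        H * (# (bad x) * ((1 + δ) * (1 + δ))) * (T₀ * 2 + 4)   ≡⟨ lem H (# (bad x)) ((1 + δ) * (1 + δ)) (T₀ * 2 + 4) ⟩
        # (bad x) * (H * (T₀ * 2 + 4) * ((1 + δ) * (1 + δ)))   ≤⟨ *-monoʳ-≤ (# (bad x)) B₁-large ⟩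
        # (bad x) * 2 ^ B₁                                     ≤⟨ few ⟩
        n * length sets + 1                                    ≡⟨ cong (λ z → n * z + 1) sets-length ⟩
        n * (T₀ * 2 + 3) + 1                                   ≤⟨ +-monoʳ-≤ (n * (T₀ * 2 + 3)) 0<n ⟩
        n * (T₀ * 2 + 3) + n                                   ≡⟨ lem₂ n T₀ ⟩
        n * (T₀ * 2 + 4)                                       ∎)
        where
        open ≤-Reasoning
        lem : ∀ a b c d → a * (b * c) * d ≡ b * (a * d * c)
        lem = solve-∀
        lem₂ : ∀ n t → n * (t * 2 + 3) + n ≡ n * (t * 2 + 4)
        lem₂ = solve-∀
      -- By `B₂-large` a single violated global bound would exceed the whole potential.
      refute : ∀ {c} → c ∈ globals → ¬ (1 * (Ω ^ n * 2 ^ B₂) ≤ potential x c)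
      refute {c} c∈ h = <⇒≱ B₂-large (*-cancelˡ-≤ (Ω ^ n) {{m^n≢0 Ω n {{>-nonZero 0<Ω}}}} (begin
        Ω ^ n * 2 ^ B₂            ≡⟨ *-identityˡ _ ⟨
        1 * (Ω ^ n * 2 ^ B₂)      ≤⟨ h ⟩
        potential x c             ≤⟨ small c∈ ⟩
        Ω ^ n * (∑L coef globals * (n * length sets + 1)) ≡⟨ cong₂ (λ a b → Ω ^ n * (a * (n * b + 1))) globals-coef sets-length ⟩
        Ω ^ n * ((Nc * 2 + 1) * (n * (T₀ * 2 + 3) + 1)) ∎))
        where open ≤-Reasoning
      at : ∀ y → y < Nc → cellC y ∈ globals × queryC y ∈ globals
      at y y<Nc = subst (λ z → cellC z ∈ globals × queryC z ∈ globals) (toℕ-fromℕ< y<Nc)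
        (∈-++⁺ˡ (∈-flat (λ i → cellC (toℕ i) ∷ queryC (toℕ i) ∷ []) (fromℕ< y<Nc) (here refl)) ,
         ∈-++⁺ˡ (∈-flat (λ i → cellC (toℕ i) ∷ queryC (toℕ i) ∷ []) (fromℕ< y<Nc) (there (here refl))))
      open CellGap n δ s γ M μ H T₀ M≡ T₀≡ (*-mono-< 0<s 0<δ) 0<H capacity γ-lower M²≤H
      cell-load : ∀ i → i < Nc → # (λ u → member i u (x u)) ≤ γ * s * (12 + μ)
      cell-load i i<Nc = ≮⇒≥ (λ over → refute (proj₁ (at i i<Nc))
        (potential-chernoff 0<T₀ 0<H (2 * M) 2≤2M (member i) 1 κ₂ Ω κ₂-eq x B₂
          (cell-gap (∑ n (λ u → size (member i u))) B₂ (# (λ u → member i u (x u))) B₂-small sizes (<⇒≤ over))))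
        where
        sizes : 8 * (3 * (s * δ)) * ∑ n (λ u → size (member i u)) ≤ n * (8 * T * cell + 8 * (3 * (s * δ)) * H)
        sizes = subst (λ z → z * ∑ n (λ u → size (member i u)) ≤ n * (8 * T * cell + z * H)) (lem (s * δ))
          (≤-trans (≤-reflexive (sym (∑-*ˡ n (24 * (s * δ)) (λ u → size (member i u)))))
            (≤-trans (∑-mono (member-size i)) (≤-reflexive (∑-const n _))))
          where
          lem : ∀ a → 24 * a ≡ 8 * (3 * a)
          lem = solve-∀
      query-load : ∀ y → y < Nc → H * H * # (λ u → query y u (x u)) ≤ 18 * (n * (g * g))
      query-load y y<Nc = ≮⇒≥ (λ over → refute (proj₂ (at y y<Nc))
        (potential-chernoff 0<T₀ 0<H 8 (s≤s (s≤s z≤n)) (query y) 1 κ₃ Ω κ₃-eq x B₂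
          (query-gap n g H T₀ (∑ n (λ u → size (query y u))) (# (λ u → query y u (x u))) B₂ 0<H (≤-trans (s≤s z≤n) 6≤g) sizes (<⇒≤ over) B₂-small)))
        where
        sizes : H * ∑ n (λ u → size (query y u)) ≤ n * (7 * (g * g) * T₀)
        sizes = ≤-trans (≤-reflexive (sym (∑-*ˡ n H (λ u → size (query y u))))) (≤-trans (∑-mono (query-size y)) (≤-reflexive (∑-const n _)))
      class-global : classC ∈ globals
      class-global = ∈-++⁺ʳ (flat Nc (λ i → cellC (toℕ i) ∷ queryC (toℕ i) ∷ [])) (here refl)
      class-load : H * # (λ u → class₀ u (x u)) ≤ 2 * n
      class-load = ≮⇒≥ (λ over → refute class-global
        (potential-chernoff 0<T₀ 0<H 8 (s≤s (s≤s z≤n)) class₀ 1 κ₃ Ω κ₃-eq x B₂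
          (subst (λ z → (8 + 2) * z + T * # (λ u → class₀ u (x u)) + 8 * 8 * T * B₂ ≤ 8 * T * # (λ u → class₀ u (x u))) (sym sizes)
            (class-gap n H T₀ (# (λ u → class₀ u (x u))) B₂ 0<H (<⇒≤ over) B₂-small))))
        where
        sizes : ∑ n (λ u → size (class₀ u)) ≡ n * (T₀ * 1)
        sizes = trans (∑-cong {n} (λ u → trans (size-class (λ z → toℕ z <ᵇ 1)) (cong (T₀ *_) (#-below {H} 1 0<H)))) (∑-const n (T₀ * 1))

  reaching : (lv cl : Fin n → ℕ) → Fin n → Fin n → Bool
  reaching lv cl v u = (T₀ ≤ᵇ lv v + lv u) ∧ (0 <ᵇ cl u)

  reachable : (lv cl : Fin n → ℕ) → Fin n → ℕ
  reachable lv cl v = # (λ u → adj G v u ∧ reaching lv cl v u)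

  below : (cl : Fin n → ℕ) → ℕ → Fin n → ℕ
  below cl k v = # (λ u → adj G v u ∧ (cl u <ᵇ k))

  record Layout : Set where
    field
      lv cl : Fin n → ℕ
      Z     : Fin n → Bool
      lv≤T₀      : ∀ v → lv v ≤ T₀
      few-bad    : H * (# Z * ((1 + δ) * (1 + δ))) ≤ n
      cnt-upper  : ∀ v → Z v ≡ false → 8 * (T * reachable lv cl v) ≤ 8 * (D v * (lv v * H₁)) + T₀ * D v
      cnt-lower  : ∀ v → Z v ≡ false → 8 * (D v * (lv v * H₁)) ≤ 8 * (T * reachable lv cl v) + T₀ * D v
      nP-lower   : ∀ v → Z v ≡ false → 7 * D v ≤ 8 * (H * below cl 1 v)
      nR-lower   : ∀ v → Z v ≡ false → D v * g ≤ H * below cl (suc g) v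
      nR-upper   : ∀ v → Z v ≡ false → H * below cl (suc g) v ≤ D v * (g + 2)
      cell-load  : ∀ i → i < Nc → # (λ u → cellWindow i u (lv u) ∧ (0 <ᵇ cl u)) ≤ γ * s * (12 + μ)
      query-load : ∀ y → y < Nc → H * H * # (λ u → queryWindow y u (lv u) ∧ ((0 <ᵇ cl u) ∧ (cl u <ᵇ suc g))) ≤ 18 * (n * (g * g))
      class-load : H * # (λ u → cl u <ᵇ 1) ≤ 2 * n

  module Typical (x : Fin n → Label) (v : Fin n) (fine : bad x v ≡ false) where

    typical-upper : ∀ {A} → A ∈ sets → 8 * (T * Lab.inside v A x) ≤ 8 * (D v * size A) + T₀ * D v
    typical-upper {A} A∈ = <⇒≤ (≤ᵇ-false⁻ {8 * (D v * size A) + T₀ * D v} (existsL-false (λ A → Lab.violated v A x) {sets} fine A∈))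

    typical-lower : ∀ A → (λ l → not (A l)) ∈ sets → 8 * (D v * size A) ≤ 8 * (T * Lab.inside v A x) + T₀ * D v
    typical-lower A A∈ = ≤-cancel-cert 0 (typical-upper A∈) (trans (lem₁ (D v) (size A) (size (not ∘ A)) (T₀ * D v))
      (trans (cong (λ z → 8 * (D v * z) + T₀ * D v) (size-not A)) (trans (cong (λ z → 8 * (z * T) + T₀ * D v) (sym (#-split (adj G v) (A ∘ x))))
        (lem₂ T (Lab.inside v A x) (Lab.inside v (not ∘ A) x) (T₀ * D v)))))
      where
      lem₁ : ∀ d a b z → 8 * (d * a) + (8 * (d * b) + z) + 0 ≡ 8 * (d * (a + b)) + z
      lem₁ = solve-∀
      lem₂ : ∀ t a b z → 8 * ((a + b) * t) + z ≡ 8 * (t * a) + z + 8 * (t * b)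
      lem₂ = solve-∀

    class-upper : ∀ {A} k → A ∈ sets → size A ≡ T₀ * k → 8 * (H * Lab.inside v A x) ≤ 8 * (D v * k) + D v
    class-upper {A} k A∈ e = *-cancelˡ-≤ T₀ {{>-nonZero 0<T₀}} (≤-trans (≤-reflexive (lem₁ T₀ H (Lab.inside v A x)))
      (≤-trans (typical-upper A∈) (≤-reflexive (trans (cong (λ z → 8 * (D v * z) + T₀ * D v) e) (lem₂ T₀ (D v) k)))))
      where
      lem₁ : ∀ t h a → t * (8 * (h * a)) ≡ 8 * (t * h * a)
      lem₁ = solve-∀
      lem₂ : ∀ t d k → 8 * (d * (t * k)) + t * d ≡ t * (8 * (d * k) + d)
      lem₂ = solve-∀

    class-lower : ∀ A k → (λ l → not (A l)) ∈ sets → size A ≡ T₀ * k → 8 * (D v * k) ≤ 8 * (H * Lab.inside v A x) + D v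
    class-lower A k A∈ e = *-cancelˡ-≤ T₀ {{>-nonZero 0<T₀}} (≤-trans (≤-reflexive (trans (lem₁ T₀ (D v) k) (cong (λ z → 8 * (D v * z)) (sym e))))
      (≤-trans (typical-lower A A∈) (≤-reflexive (lem₂ T₀ H (Lab.inside v A x) (D v)))))
      where
      lem₁ : ∀ t d k → t * (8 * (d * k)) ≡ 8 * (d * (t * k))
      lem₁ = solve-∀
      lem₂ : ∀ t h a d → 8 * (t * h * a) + t * d ≡ t * (8 * (h * a) + d)
      lem₂ = solve-∀

    level = toℕ (proj₁ (x v))

    reach∈ : reach level ∈ sets × (λ l → not (reach level l)) ∈ sets
    reach∈ = ∈-++⁺ˡ (∈-flat (λ e → reach (toℕ e) ∷ (λ l → not (reach (toℕ e) l)) ∷ []) (proj₁ (x v)) (here refl)) ,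
             ∈-++⁺ˡ (∈-flat (λ e → reach (toℕ e) ∷ (λ l → not (reach (toℕ e) l)) ∷ []) (proj₁ (x v)) (there (here refl)))

    -- The point of the threshold rule: exactly `e` of the `T₀` levels add up with `e` to at least
    -- `T₀`, so the expected number of heavy edges is linear in the level.
    reach-size : size (reach level) ≡ level * H₁
    reach-size = trans (size-product (λ e → T₀ ≤ᵇ level + toℕ e) (λ z → 0 <ᵇ toℕ z))
      (cong₂ _*_ (#-sum-reaches T₀ level (<⇒≤ (toℕ<n (proj₁ (x v))))) (#-above-zero {H} H≡))

    count-upper : 8 * (T * Lab.inside v (reach level) x) ≤ 8 * (D v * (level * H₁)) + T₀ * D v
    count-upper = subst (λ z → 8 * (T * Lab.inside v (reach level) x) ≤ 8 * (D v * z) + T₀ * D v) reach-size (typical-upper (proj₁ reach∈))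

    count-lower : 8 * (D v * (level * H₁)) ≤ 8 * (T * Lab.inside v (reach level) x) + T₀ * D v
    count-lower = subst (λ z → 8 * (D v * z) ≤ 8 * (T * Lab.inside v (reach level) x) + T₀ * D v) reach-size (typical-lower (reach level) (proj₂ reach∈))

    private
      tail : List (Label → Bool)
      tail = (λ l → 0 <ᵇ cls l) ∷ (λ l → cls l <ᵇ suc g) ∷ (λ l → not (cls l <ᵇ suc g)) ∷ []
      in-tail : ∀ {A} → A ∈ tail → A ∈ sets
      in-tail = ∈-++⁺ʳ (flat T₀ (λ e → reach (toℕ e) ∷ (λ l → not (reach (toℕ e) l)) ∷ []))
      not-zero : ∀ k → not (0 <ᵇ k) ≡ (k <ᵇ 1)
      not-zero zero    = refl
      not-zero (suc k) = refl
      g<H : suc g ≤ H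
      g<H = subst (suc g ≤_) (sym H≡) (s≤s g≤H₁)
      reservoir-size : size (λ l → cls l <ᵇ suc g) ≡ T₀ * suc g
      reservoir-size = trans (size-class (λ z → toℕ z <ᵇ suc g)) (cong (T₀ *_) (#-below {H} (suc g) g<H))

    class₀-lower : 7 * D v ≤ 8 * (H * Lab.inside v (λ l → cls l <ᵇ 1) x)
    class₀-lower = ≤-cancel-cert 0 (class-upper H₁ (in-tail (here refl)) (trans (size-class (λ z → 0 <ᵇ toℕ z)) (cong (T₀ *_) (#-above-zero {H} H≡))))
      (trans (lem₁ (D v) H₁) (trans (cong₂ (λ a b → 8 * (a * b)) (sym H≡) (sym total)) (lem₂ H _ _)))
      where
      total : Lab.inside v (λ l → 0 <ᵇ cls l) x + Lab.inside v (λ l → cls l <ᵇ 1) x ≡ D v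
      total = trans (cong (Lab.inside v (λ l → 0 <ᵇ cls l) x +_) (#-cong (λ u → cong (adj G v u ∧_) (sym (not-zero (cls (x u)))))))
        (#-split (adj G v) (λ u → 0 <ᵇ cls (x u)))
      lem₁ : ∀ d h → 7 * d + (8 * (d * h) + d) + 0 ≡ 8 * (suc h * d)
      lem₁ = solve-∀
      lem₂ : ∀ h a b → 8 * (h * (a + b)) ≡ 8 * (h * b) + 8 * (h * a)
      lem₂ = solve-∀

    reservoir-upper : H * Lab.inside v (λ l → cls l <ᵇ suc g) x ≤ D v * (g + 2)
    reservoir-upper = *-cancelˡ-≤ 8 (≤-trans (class-upper (suc g) (in-tail (there (here refl))) reservoir-size)
      (≤-cancel-cert (7 * D v) (≤-refl {0}) (lem (D v) g)))
      where
      lem : ∀ d g → 8 * (d * suc g) + d + 0 + 7 * d ≡ 8 * (d * (g + 2)) + 0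
      lem = solve-∀

    reservoir-lower : D v * g ≤ H * Lab.inside v (λ l → cls l <ᵇ suc g) x
    reservoir-lower = *-cancelˡ-≤ 8 (≤-cancel-cert (7 * D v) (class-lower (λ l → cls l <ᵇ suc g) (suc g) (in-tail (there (there (here refl)))) reservoir-size)
      (lem (D v) g (8 * (H * Lab.inside v (λ l → cls l <ᵇ suc g) x))))
      where
      lem : ∀ d g z → 8 * (d * g) + (z + d) + 7 * d ≡ z + 8 * (d * suc g)
      lem = solve-∀

  layout : Layout
  layout = build good-labelling
    where
    build : GoodLabelling → Layout
    build L = record
      { lv = λ v → lev (x v) ; cl = λ v → cls (x v) ; Z = bad x
      ; lv≤T₀ = λ v → <⇒≤ (toℕ<n (proj₁ (x v)))
      ; few-bad = few-bad
      ; cnt-upper = λ v h → Typical.count-upper x v h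
      ; cnt-lower = λ v h → Typical.count-lower x v h
      ; nP-lower = λ v h → Typical.class₀-lower x v h
      ; nR-lower = λ v h → Typical.reservoir-lower x v h
      ; nR-upper = λ v h → Typical.reservoir-upper x v h
      ; cell-load = cell-load ; query-load = query-load ; class-load = class-load }
      where open GoodLabelling L

  -- The initial weighting and the targets of the vertices outside `R`.

  module Construct (lay : Layout) where
    open Layout lay

    P₀ Q₀ : Fin n → Bool
    P₀ u = cl u <ᵇ 1
    Q₀ u = cl u <ᵇ suc g

    P₀⇒Q₀ : ∀ u → P₀ u ≡ true → Q₀ u ≡ true
    P₀⇒Q₀ u h = <ᵇ-true {cl u} (<-≤-trans (<ᵇ-true⁻ {cl u} h) (s≤s z≤n))

    P₀-zero : ∀ u → P₀ u ≡ true → (0 <ᵇ cl u) ≡ false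
    P₀-zero u h with cl u
    ... | zero = refl

    P₀-positive : ∀ u → P₀ u ≡ false → (0 <ᵇ cl u) ≡ true
    P₀-positive u h with cl u
    ... | suc _ = refl

    -- A bad vertex may have no neighbour in Q₀; its designated neighbours are put into R.
    candidate : Fin n → Fin n → Bool
    candidate v u = adj G v u ∧ (Z v ∨ Q₀ u)

    r≤δ : r ≤ δ
    r≤δ = *-cancelˡ-≤ H {{>-nonZero 0<H}} (≤-trans r-upper (≤-trans (*-monoʳ-≤ δ (≤-trans g≤H₁ (subst (H₁ ≤_) (sym H≡) (n≤1+n H₁)))) (≤-reflexive (*-comm δ H))))

    r≤candidates : ∀ v → r ≤ # (candidate v)
    r≤candidates v with Z v in eq
    ... | true = ≤-trans r≤δ (≤-trans (δ≤deg v) (#-mono {n} {adj G v} (λ u h → ∧-true h refl)))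
    ... | false = *-cancelˡ-≤ H {{>-nonZero 0<H}} (≤-trans r-upper (≤-trans (*-monoˡ-≤ g (δ≤deg v)) (nR-lower v eq)))

    abstract
      tog : Fin n → Fin n → Bool
      tog v = proj₁ (choose-subset (candidate v) r (r≤candidates v))

      tog⇒candidate : ∀ v u → tog v u ≡ true → candidate v u ≡ true
      tog⇒candidate v = proj₁ (proj₂ (choose-subset (candidate v) r (r≤candidates v)))

      #tog : ∀ v → # (tog v) ≡ r
      #tog v = proj₂ (proj₂ (choose-subset (candidate v) r (r≤candidates v)))

    -- E consists of the vertices of R whose weighted degree is not controlled by their level.
    U ZU R F E : Fin n → Bool
    U u = exists (λ z → Z z ∧ tog z u)
    ZU u = Z u ∨ U u
    R u = Q₀ u ∨ ZU u
    F u = exists (λ w → ZU w ∧ tog w u)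
    E u = (P₀ u ∨ ZU u) ∨ F u

    Hd : Fin n → Fin n → Bool
    Hd u v = (R u ∧ R v) ∧ (tog u v ∨ tog v u)

    tog-adj : ∀ v u → tog v u ≡ true → adj G v u ≡ true
    tog-adj v u h = proj₁ (∧-true⁻ {adj G v u} (tog⇒candidate v u h))

    tog-R : ∀ v u → tog v u ≡ true → R u ≡ true
    tog-R v u h with ∨-true⁻ {Z v} (proj₂ (∧-true⁻ {adj G v u} (tog⇒candidate v u h)))
    ... | inj₁ Zv = ∨-trueʳ {Q₀ u} (∨-trueʳ {Z u} (exists⁺ (λ z → Z z ∧ tog z u) v (∧-true Zv h)))
    ... | inj₂ Qu = ∨-trueˡ Qu

    tog-Hd : ∀ v u → R v ≡ true → tog v u ≡ true → Hd v u ≡ true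
    tog-Hd v u Rv h = ∧-true (∧-true Rv (tog-R v u h)) (∨-trueˡ h)

    Hd-R : ∀ u v → Hd u v ≡ true → R u ≡ true
    Hd-R u v h = proj₁ (∧-true⁻ {R u} (proj₁ (∧-true⁻ {R u ∧ R v} h)))

    Hd-Rʳ : ∀ u v → Hd u v ≡ true → R v ≡ true
    Hd-Rʳ u v h = proj₂ (∧-true⁻ {R u} (proj₁ (∧-true⁻ {R u ∧ R v} h)))

    Hd-tog : ∀ u v → Hd u v ≡ true → tog u v ≡ true ⊎ tog v u ≡ true
    Hd-tog u v h = ∨-true⁻ {tog u v} (proj₂ (∧-true⁻ {R u ∧ R v} h))

    Hd-sym : ∀ u v → Hd u v ≡ true → Hd v u ≡ true
    Hd-sym u v h = ∧-true (∧-true (Hd-Rʳ u v h) (Hd-R u v h)) (flip (Hd-tog u v h))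
      where
      flip : tog u v ≡ true ⊎ tog v u ≡ true → (tog v u ∨ tog u v) ≡ true
      flip (inj₁ e) = ∨-trueʳ {tog v u} e
      flip (inj₂ e) = ∨-trueˡ e

    Hd-adj : ∀ u v → Hd u v ≡ true → adj G u v ≡ true
    Hd-adj u v h with Hd-tog u v h
    ... | inj₁ e = tog-adj u v e
    ... | inj₂ e = trans (adj-sym G u v) (tog-adj v u e)

    -- Class 0 contributes `2 n / H`. The rest lies within two designated steps of `Z`, at most
    -- `(1 + r)²` vertices for each element, which is at most `n / H` since `r ≤ δ`.
    few-exceptional : H * # E ≤ 3 * n
    few-exceptional = begin
      H * # E                                          ≤⟨ *-monoʳ-≤ H count ⟩
      H * (# P₀ + (1 + r) * (1 + r) * # Z)             ≡⟨ lem₁ H (# P₀) ((1 + r) * (1 + r)) (# Z) ⟩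
      H * # P₀ + H * (# Z * ((1 + r) * (1 + r)))       ≤⟨ +-mono-≤ class-load (≤-trans (*-monoʳ-≤ H (*-monoʳ-≤ (# Z) (*-mono-≤ (s≤s r≤δ) (s≤s r≤δ)))) few-bad) ⟩
      2 * n + n                                        ≡⟨ lem₂ n ⟩
      3 * n                                            ∎
      where
      open ≤-Reasoning
      lem₁ : ∀ h a q z → h * (a + q * z) ≡ h * a + h * (z * q)
      lem₁ = solve-∀
      lem₂ : ∀ n → 2 * n + n ≡ 3 * n
      lem₂ = solve-∀
      #U : # U ≤ r * # Z
      #U = #-union Z tog r (λ v → ≤-reflexive (#tog v))
      #ZU : # ZU ≤ (1 + r) * # Z
      #ZU = ≤-trans (#-∨ Z U) (+-monoʳ-≤ (# Z) #U)
      #F : # F ≤ r * # ZU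
      #F = #-union ZU tog r (λ v → ≤-reflexive (#tog v))
      count : # E ≤ # P₀ + (1 + r) * (1 + r) * # Z
      count = begin
        # E                             ≤⟨ #-∨ (λ u → P₀ u ∨ ZU u) F ⟩
        # (λ u → P₀ u ∨ ZU u) + # F     ≤⟨ +-mono-≤ (#-∨ P₀ ZU) #F ⟩
        # P₀ + # ZU + r * # ZU          ≡⟨ lem₃ (# P₀) (# ZU) r ⟩
        # P₀ + (1 + r) * # ZU           ≤⟨ +-monoʳ-≤ (# P₀) (*-monoʳ-≤ (1 + r) #ZU) ⟩
        # P₀ + (1 + r) * ((1 + r) * # Z) ≡⟨ cong (# P₀ +_) (*-assoc (1 + r) (1 + r) (# Z)) ⟨
        # P₀ + (1 + r) * (1 + r) * # Z  ∎
        where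
        lem₃ : ∀ a b r → a + b + r * b ≡ a + (1 + r) * b
        lem₃ = solve-∀

    A⇒ : ∀ {v} → R v ≡ false → Q₀ v ≡ false × Z v ≡ false
    A⇒ {v} h = proj₁ (∨-false⁻ {Q₀ v} h) , proj₁ (∨-false⁻ {Z v} (proj₂ (∨-false⁻ {Q₀ v} h)))

    A⇒¬P₀ : ∀ {v} → R v ≡ false → P₀ v ≡ false
    A⇒¬P₀ {v} h = not-¬-true (λ e → true≢false (P₀⇒Q₀ v e) (proj₁ (A⇒ h)))

    c : Fin n → ℕ
    c = reachable lv cl

    q : ℕ
    q = 8 * T * cell

    0<γ : 0 < γ
    0<γ = n≢0⇒n>0 (λ e → <⇒≱ 0<δ (≤-trans γ-lower (≤-reflexive (trans (cong (4 * (H * M) *_) e) (*-zeroʳ (4 * (H * M)))))))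

    0<cell : 0 < cell
    0<cell = *-mono-< 0<M (*-mono-< 0<γ 0<s)

    instance
      q-nonZero : NonZero q
      q-nonZero = >-nonZero (*-mono-< {0} {8 * T} (*-mono-< {0} {8} (s≤s z≤n) 0<T) 0<cell)

    num : Fin n → ℕ
    num v = base v + slope v * lv v

    abstract
      index : Fin n → ℕ
      index v = num v / q

      index-lower : ∀ v → index v * q ≤ num v
      index-lower v = m/n*n≤m (num v) q

      index-upper : ∀ v → num v < index v * q + q
      index-upper v = begin-strict
        num v                        ≡⟨ m≡m%n+[m/n]*n (num v) q ⟩
        num v % q + num v / q * q    <⟨ +-monoˡ-< (num v / q * q) (m%n<n (num v) q) ⟩
        q + num v / q * q            ≡⟨ +-comm q _ ⟩
        num v / q * q + q            ∎
        where open ≤-Reasoning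

    index<Nc : ∀ v → index v < Nc
    index<Nc v = ≤-<-trans bound (≤-trans (s≤s (m≤m+n (n + 6 * (s * n)) s)) (≤-reflexive (+-comm 1 _)))
      where
      open ≤-Reasoning
      lem : ∀ t₀ h s d l h₁ → 8 * (t₀ * h) * d + 3 * (s * d) * t₀ + 24 * (s * d) * h₁ * l ≡ 8 * (t₀ * h) * d + (3 * (s * d) * (t₀ * 1) + 24 * (s * d) * (h₁ * l))
      lem = solve-∀
      lem₂ : ∀ t₀ h s d → 8 * (t₀ * h) * d + (3 * (s * d) * (t₀ * h) + 24 * (s * d) * (h * t₀)) + 21 * (s * d) * (t₀ * h) ≡ 8 * (t₀ * h) * (d + 6 * (s * d))
      lem₂ = solve-∀
      bound : index v ≤ n + 6 * (s * n)
      bound = *-cancelˡ-≤ (8 * T) {{>-nonZero (*-mono-< {0} {8} (s≤s z≤n) 0<T)}} (begin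
        8 * T * index v             ≤⟨ *-monoʳ-≤ (8 * T) (≤-trans (≤-reflexive (sym (*-identityʳ (index v)))) (*-monoʳ-≤ (index v) 0<cell)) ⟩
        8 * T * (index v * cell)    ≡⟨ swap (8 * T) (index v) cell ⟩
        index v * q                 ≤⟨ index-lower v ⟩
        num v                       ≡⟨ lem T₀ H s (D v) (lv v) H₁ ⟩
        8 * T * D v + (3 * (s * D v) * (T₀ * 1) + 24 * (s * D v) * (H₁ * lv v)) ≤⟨ +-monoʳ-≤ (8 * T * D v) (+-mono-≤ (*-monoʳ-≤ (3 * (s * D v)) (*-monoʳ-≤ T₀ 0<H))
                                         (*-monoʳ-≤ (24 * (s * D v)) (*-mono-≤ (subst (H₁ ≤_) (sym H≡) (n≤1+n H₁)) (lv≤T₀ v)))) ⟩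
        8 * T * D v + (3 * (s * D v) * T + 24 * (s * D v) * (H * T₀)) ≤⟨ m≤m+n _ (21 * (s * D v) * T) ⟩
        8 * T * D v + (3 * (s * D v) * T + 24 * (s * D v) * (H * T₀)) + 21 * (s * D v) * T ≡⟨ lem₂ T₀ H s (D v) ⟩
        8 * T * (D v + 6 * (s * D v)) ≤⟨ *-monoʳ-≤ (8 * T) (+-mono-≤ (#≤n (adj G v)) (*-monoʳ-≤ 6 (*-monoʳ-≤ s (#≤n (adj G v))))) ⟩
        8 * T * (n + 6 * (s * n))   ∎)
        where
        swap : ∀ a b c → a * (b * c) ≡ b * (a * c)
        swap = solve-∀

    mem : ℕ → Fin n → Bool
    mem i u = cellWindow i u (lv u) ∧ (0 <ᵇ cl u)

    mem-index : ∀ v → R v ≡ false → mem (index v) v ≡ true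
    mem-index v h = ∧-true (∧-true (≤ᵇ-true (index-lower v)) (<ᵇ-true (index-upper v))) (P₀-positive v (A⇒¬P₀ h))

    sm : ℕ
    sm = s * (12 + μ)

    instance
      sm-nonZero : NonZero sm
      sm-nonZero = >-nonZero (*-mono-< {0} {s} {0} {12 + μ} 0<s (s≤s z≤n))

    place : Fin n → ℕ
    place v = rank (mem (index v)) v

    place< : ∀ v → R v ≡ false → place v < γ * sm
    place< v h = <-≤-trans (rank<# (mem (index v)) v (mem-index v h)) (≤-trans (cell-load (index v) (index<Nc v)) (≤-reflexive (*-assoc γ s (12 + μ))))

    abstract
      block offset : Fin n → ℕ
      block v  = place v / sm
      offset v = place v % sm

      place≡ : ∀ v → place v ≡ offset v + block v * sm
      place≡ v = m≡m%n+[m/n]*n (place v) sm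

      offset< : ∀ v → offset v < sm
      offset< v = m%n<n (place v) sm

    block< : ∀ v → R v ≡ false → block v < γ
    block< v h = *-cancelʳ-< sm (block v) γ (≤-<-trans (≤-trans (m≤n+m _ (offset v)) (≤-reflexive (sym (place≡ v)))) (place< v h))

    period : M * s ≡ 4 * s + sm
    period = trans (cong (_* s) M≡) (lem μ s)
      where
      lem : ∀ μ s → (16 + μ) * s ≡ 4 * s + s * (12 + μ)
      lem = solve-∀

    -- The digits are cell, block of length `M s`, and offset after the reserved `4 s`. The
    -- adjustment can only raise a value, and `lowest v` may lie up to the end of cell `index v`, so
    -- the next cell is used.
    target : Fin n → ℕ
    target v = ((index v + 1) * γ + block v) * (M * s) + (4 * s + offset v)

    target-residue : ∀ v → 4 * s + offset v < M * s
    target-residue v = <-≤-trans (+-monoʳ-< (4 * s) (offset< v)) (≤-reflexive (sym period))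

    target-lower : ∀ v → (index v + 1) * cell ≤ target v
    target-lower v = ≤-trans (≤-reflexive (lem (index v) M γ s)) (≤-trans (*-monoˡ-≤ (M * s) (m≤m+n ((index v + 1) * γ) (block v))) (m≤m+n _ (4 * s + offset v)))
      where
      lem : ∀ i M γ s → (i + 1) * (M * (γ * s)) ≡ (i + 1) * γ * (M * s)
      lem = solve-∀

    target-upper : ∀ v → R v ≡ false → target v ≤ (index v + 2) * cell
    target-upper v h = <⇒≤ (begin-strict
      target v                                            <⟨ +-monoʳ-< _ (target-residue v) ⟩
      ((index v + 1) * γ + block v) * (M * s) + M * s     ≡⟨ lem₁ ((index v + 1) * γ) (block v) (M * s) ⟩
      ((index v + 1) * γ + suc (block v)) * (M * s)       ≤⟨ *-monoˡ-≤ (M * s) (+-monoʳ-≤ ((index v + 1) * γ) (block< v h)) ⟩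
      ((index v + 1) * γ + γ) * (M * s)                   ≡⟨ lem₂ (index v) γ M s ⟩
      (index v + 2) * cell                                ∎)
      where
      open ≤-Reasoning
      lem₁ : ∀ a b p → (a + b) * p + p ≡ (a + suc b) * p
      lem₁ = solve-∀
      lem₂ : ∀ i γ M s → ((i + 1) * γ + γ) * (M * s) ≡ (i + 2) * (M * (γ * s))
      lem₂ = solve-∀

    8T-cancel : ∀ {a b} → 8 * T * a ≤ 8 * T * b → a ≤ b
    8T-cancel {a} {b} = *-cancelˡ-≤ (8 * T) {{>-nonZero (*-mono-< {0} {8} (s≤s z≤n) 0<T)}}

    lowest : Fin n → ℕ
    lowest v = D v + 3 * s * c v

    lowest≤target : ∀ v → R v ≡ false → lowest v ≤ target v
    lowest≤target v h = 8T-cancel (begin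
      8 * T * (D v + 3 * s * c v)              ≡⟨ lem₁ T (D v) s (c v) ⟩
      8 * T * D v + 3 * s * (8 * (T * c v))    ≤⟨ +-monoʳ-≤ (8 * T * D v) (*-monoʳ-≤ (3 * s) (cnt-upper v (proj₂ (A⇒ h)))) ⟩
      8 * T * D v + 3 * s * (8 * (D v * (lv v * H₁)) + T₀ * D v) ≡⟨ lem₂ T (D v) s (lv v) H₁ T₀ ⟩
      num v                                    ≤⟨ <⇒≤ (index-upper v) ⟩
      index v * q + q                          ≡⟨ lem₃ (index v) T cell ⟩
      8 * T * ((index v + 1) * cell)           ≤⟨ *-monoʳ-≤ (8 * T) (target-lower v) ⟩
      8 * T * target v                         ∎)
      where
      open ≤-Reasoning
      lem₁ : ∀ t d s c → 8 * t * (d + 3 * s * c) ≡ 8 * t * d + 3 * s * (8 * (t * c))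
      lem₁ = solve-∀
      lem₂ : ∀ t d s l h t₀ → 8 * t * d + 3 * s * (8 * (d * (l * h)) + t₀ * d) ≡ 8 * t * d + 3 * (s * d) * t₀ + 24 * (s * d) * h * l
      lem₂ = solve-∀
      lem₃ : ∀ i t c → i * (8 * t * c) + 8 * t * c ≡ 8 * t * ((i + 1) * c)
      lem₃ = solve-∀

    -- In units of `s (D v) / (8 H)`: two cells take at most 8 by `γ-upper`, the uncertainty of
    -- `lowest v` at most 6, and the neighbours in class 0 supply at least `3 * 7 = 21`. The slack
    -- of 7 is the certificate.
    target≤end : ∀ v → R v ≡ false → target v ≤ lowest v + 3 * s * below cl 1 v
    target≤end v h = 8T-cancel (≤-trans (*-monoʳ-≤ (8 * T) (target-upper v h)) (≤-cancel-cert (7 * (s * D v) * T₀)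
        (+-mono-≤ (+-mono-≤ (index-lower v) cells) (+-mono-≤ (*-monoʳ-≤ (3 * s) (cnt-lower v (proj₂ (A⇒ h)))) (*-monoʳ-≤ (3 * (s * T₀)) (nP-lower v (proj₂ (A⇒ h))))))
        (lem T₀ H (index v) M γ (D v) s (lv v) H₁ (c v) (below cl 1 v))))
      where
      cells : 8 * (T₀ * s) * (2 * (H * M) * γ) ≤ 8 * (T₀ * s) * D v
      cells = *-monoʳ-≤ (8 * (T₀ * s)) (≤-trans γ-upper (δ≤deg v))
      lem : ∀ T₀ H i M γ d s l H₁ c p → 8 * (T₀ * H) * ((i + 2) * (M * (γ * s)))
         + ((8 * (T₀ * H) * d + 3 * (s * d) * T₀ + 24 * (s * d) * H₁ * l + 8 * (T₀ * s) * d)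
           + (3 * s * (8 * (T₀ * H * c) + T₀ * d) + 3 * (s * T₀) * (8 * (H * p)))) + 7 * (s * d) * T₀
        ≡ 8 * (T₀ * H) * (d + 3 * s * c + 3 * s * p)
         + ((i * (8 * (T₀ * H) * (M * (γ * s))) + 8 * (T₀ * s) * (2 * (H * M) * γ)) + (3 * s * (8 * (d * (l * H₁))) + 3 * (s * T₀) * (7 * d)))
      lem = solve-∀

    target-injective : ∀ u v → R u ≡ false → R v ≡ false → target u ≡ target v → u ≡ v
    target-injective u v hu hv e = rank-injective (mem (index u)) u v (mem-index u hu)
      (subst (λ i → mem i v ≡ true) (sym same-index) (mem-index v hv))
      (trans same-place (cong (λ i → rank (mem i) v) (sym same-index)))
      where
      parts : (index u + 1) * γ + block u ≡ (index v + 1) * γ + block v × 4 * s + offset u ≡ 4 * s + offset v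
      parts = division-unique (M * s) ((index u + 1) * γ + block u) ((index v + 1) * γ + block v) (target-residue u) (target-residue v) e
      quotients : index u + 1 ≡ index v + 1 × block u ≡ block v
      quotients = division-unique γ (index u + 1) (index v + 1) (block< u hu) (block< v hv) (proj₁ parts)
      same-index : index u ≡ index v
      same-index = +-cancelʳ-≡ 1 _ _ (proj₁ quotients)
      same-place : place u ≡ place v
      same-place = trans (place≡ u) (trans (cong₂ (λ o b → o + b * sm) (+-cancelˡ-≡ (4 * s) _ _ (proj₂ parts)) (proj₂ quotients)) (sym (place≡ v)))

    amount : Fin n → ℕ
    amount v = (target v ∸ lowest v) ⊓ (3 * s * below cl 1 v)

    lowest+amount : ∀ v → R v ≡ false → lowest v + amount v ≡ target v
    lowest+amount v h = trans (cong (lowest v +_) (m≤n⇒m⊓n≡m (m≤n+o⇒m∸n≤o (target v) (lowest v) (target≤end v h)))) (m+[n∸m]≡n (lowest≤target v h))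

    abstract
      ω : Fin n → Fin n → ℕ
      ω v = proj₁ (distribute (3 * s) (λ u → adj G v u ∧ P₀ u) (amount v) (m⊓n≤n (target v ∸ lowest v) _))

      ω≤ : ∀ v u → ω v u ≤ 3 * s
      ω≤ v = proj₁ (proj₂ (distribute (3 * s) (λ u → adj G v u ∧ P₀ u) (amount v) (m⊓n≤n (target v ∸ lowest v) _)))

      ω-off : ∀ v u → (adj G v u ∧ P₀ u) ≡ false → ω v u ≡ 0
      ω-off v = proj₁ (proj₂ (proj₂ (distribute (3 * s) (λ u → adj G v u ∧ P₀ u) (amount v) (m⊓n≤n (target v ∸ lowest v) _))))

      ∑ω : ∀ v → ∑ n (ω v) ≡ amount v
      ∑ω v = proj₂ (proj₂ (proj₂ (distribute (3 * s) (λ u → adj G v u ∧ P₀ u) (amount v) (m⊓n≤n (target v ∸ lowest v) _))))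

    related : Fin n → Fin n → Bool
    related u v = ((T₀ ≤ᵇ lv u + lv v) ∧ (0 <ᵇ cl v)) ∧ (0 <ᵇ cl u)

    related-sym : ∀ u v → related u v ≡ related v u
    related-sym u v rewrite +-comm (lv u) (lv v) with T₀ ≤ᵇ lv v + lv u | 0 <ᵇ cl v | 0 <ᵇ cl u
    ... | false | _     | _     = refl
    ... | true  | true  | true  = refl
    ... | true  | true  | false = refl
    ... | true  | false | true  = refl
    ... | true  | false | false = refl

    plain : Fin n → Fin n → ℕ
    plain u v = if Hd u v then 1 + s else 1 + 3 * s * 𝟙 (related u v)

    plain-sym : ∀ u v → plain u v ≡ plain v u
    plain-sym u v rewrite related-sym u v | bool-ext (Hd-sym u v) (Hd-sym v u) = refl

    private
      AP : Fin n → Fin n → Bool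
      AP u v = not (R u) ∧ P₀ v

    AP-asym : ∀ {u v} → AP u v ≡ true → AP v u ≡ false
    AP-asym {u} {v} h rewrite A⇒¬P₀ {u} (not-true⁻ (proj₁ (∧-true⁻ {not (R u)} h))) with not (R v)
    ... | true  = refl
    ... | false = refl

    W₀ : Fin n → Fin n → ℕ
    W₀ u v = if AP u v then 1 + ω u v else (if AP v u then 1 + ω v u else plain u v)

    W₀-AP : ∀ u v → AP u v ≡ true → W₀ u v ≡ 1 + ω u v
    W₀-AP u v h = cong (λ b → if b then 1 + ω u v else (if AP v u then 1 + ω v u else plain u v)) h

    W₀-PA : ∀ u v → AP v u ≡ true → W₀ u v ≡ 1 + ω v u
    W₀-PA u v h = cong₂ (λ b b′ → if b then 1 + ω u v else (if b′ then 1 + ω v u else plain u v)) (AP-asym {v} {u} h) h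

    W₀-plain : ∀ u v → AP u v ≡ false → AP v u ≡ false → W₀ u v ≡ plain u v
    W₀-plain u v h h′ = cong₂ (λ b b′ → if b then 1 + ω u v else (if b′ then 1 + ω v u else plain u v)) h h′

    bool-cases : ∀ {A : Set} b → (b ≡ true → A) → (b ≡ false → A) → A
    bool-cases true  f g = f refl
    bool-cases false f g = g refl

    W₀-cases : ∀ {C : Set} u v → (AP u v ≡ true → C) → (AP v u ≡ true → C) → (AP u v ≡ false → AP v u ≡ false → C) → C
    W₀-cases u v f g k = bool-cases (AP u v) f (λ e → bool-cases (AP v u) g (k e))

    W₀-sym : ∀ u v → W₀ u v ≡ W₀ v u
    W₀-sym u v = W₀-cases u v
      (λ h → trans (W₀-AP u v h) (sym (W₀-PA v u h)))
      (λ h → trans (W₀-PA u v h) (sym (W₀-AP v u h)))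
      (λ h h′ → trans (W₀-plain u v h h′) (trans (plain-sym u v) (sym (W₀-plain v u h′ h))))

    AP-R : ∀ u v → R u ≡ true → AP u v ≡ false
    AP-R u v h = cong (λ b → not b ∧ P₀ v) h

    W₀-Hd : ∀ u v → Hd u v ≡ true → W₀ u v ≡ 1 + s
    W₀-Hd u v h = trans (W₀-plain u v (AP-R u v (Hd-R u v h)) (AP-R v u (Hd-Rʳ u v h)))
      (cong (λ b → if b then 1 + s else 1 + 3 * s * 𝟙 (related u v)) h)

    plain-off : ∀ u v → Hd u v ≡ false → plain u v ≡ 1 + 3 * s * 𝟙 (related u v)
    plain-off u v h = cong (λ b → if b then 1 + s else 1 + 3 * s * 𝟙 (related u v)) h

    W₀-bounds : ∀ u v → 1 ≤ W₀ u v × W₀ u v ≤ 1 + 3 * s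
    W₀-bounds u v = W₀-cases u v
      (λ h → subst Between (sym (W₀-AP u v h)) (s≤s z≤n , s≤s (ω≤ u v)))
      (λ h → subst Between (sym (W₀-PA u v h)) (s≤s z≤n , s≤s (ω≤ v u)))
      (λ h h′ → subst Between (sym (W₀-plain u v h h′)) (bool-cases (Hd u v)
        (λ e → subst Between (sym (cong (λ b → if b then 1 + s else 1 + 3 * s * 𝟙 (related u v)) e)) (s≤s z≤n , s≤s (m≤m+n s _)))
        (λ e → subst Between (sym (plain-off u v e)) (s≤s z≤n , s≤s (≤-trans (*-monoʳ-≤ (3 * s) (𝟙≤1 (related u v))) (≤-reflexive (*-identityʳ (3 * s))))))))
      where
      Between : ℕ → Set
      Between x = 1 ≤ x × x ≤ 1 + 3 * s

    -- A window of length `3 s` from such a point stays in the residues below `4 s` modulo `M s`,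
    -- which every `target` avoids.
    Free : ℕ → Set
    Free x = Σ ℕ λ k → Σ ℕ λ o → x ≡ k * (M * s) + o × o < s

    open Value G

    Off : (Fin n → Fin n → ℕ) → Set
    Off W = ∀ x y → Hd x y ≡ false → W x y ≡ W₀ x y

    reachB : Fin n → Fin n → Bool
    reachB = reaching lv cl

    related-positive : ∀ u v → P₀ u ≡ false → related u v ≡ reachB u v
    related-positive u v h = trans (cong (λ b → ((T₀ ≤ᵇ lv u + lv v) ∧ (0 <ᵇ cl v)) ∧ b) (P₀-positive u h)) (∧-identityʳ _)

    -- A vertex outside `R` has no designated edge, so the greedy stage leaves its value alone. Its
    -- edges to `P₀` weigh `1 + ω`, as class 0 is never reached; all others have the threshold
    -- weight.
    value-target : ∀ {W} → Off W → ∀ v → R v ≡ false → val W v ≡ target v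
    value-target {W} off v h = begin
      val W v                                          ≡⟨ ∑-cong each ⟩
      ∑ n (λ u → (𝟙 (adj G v u) + 3 * s * 𝟙 (adj G v u ∧ reachB v u)) + ω v u) ≡⟨ ∑-+ n _ (ω v) ⟩
      ∑ n (λ u → 𝟙 (adj G v u) + 3 * s * 𝟙 (adj G v u ∧ reachB v u)) + ∑ n (ω v) ≡⟨ cong₂ _+_ (trans (∑-+ n _ _) (cong (D v +_) (∑-*ˡ n (3 * s) _))) (∑ω v) ⟩
      lowest v + amount v                                  ≡⟨ lowest+amount v h ⟩
      target v                                            ∎
      where
      open ≡-Reasoning
      ¬Hd : ∀ u → Hd v u ≡ false
      ¬Hd u = not-¬-true (λ e → true≢false (Hd-R v u e) h)
      ¬AP : ∀ u → AP u v ≡ false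
      ¬AP u = bool-cases (not (R u)) (λ e → trans (cong (_∧ P₀ v) e) (A⇒¬P₀ h)) (λ e → cong (_∧ P₀ v) e)
      weight : ∀ u → adj G v u ≡ true → W v u ≡ (1 + 3 * s * 𝟙 (reachB v u)) + ω v u
      weight u a = bool-cases (P₀ u)
        (λ p → trans (off v u (¬Hd u)) (trans (W₀-AP v u (∧-true (cong not h) p))
          (sym (cong (λ z → 1 + z + ω v u) (trans (cong (λ b → 3 * s * 𝟙 b) (unreached p)) (*-zeroʳ (3 * s)))))))
        (λ p → trans (off v u (¬Hd u)) (trans (W₀-plain v u (trans (cong (not (R v) ∧_) p) (∧-zeroʳ (not (R v)))) (¬AP u))
          (trans (plain-off v u (¬Hd u)) (trans (cong (λ b → 1 + 3 * s * 𝟙 b) (related-positive v u (A⇒¬P₀ h)))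
            (trans (sym (+-identityʳ _)) (cong (1 + 3 * s * 𝟙 (reachB v u) +_) (sym (ω-off v u (trans (cong (adj G v u ∧_) p) (∧-zeroʳ (adj G v u)))))))))))
        where
        unreached : P₀ u ≡ true → reachB v u ≡ false
        unreached p = trans (cong ((T₀ ≤ᵇ lv v + lv u) ∧_) (P₀-zero u p)) (∧-zeroʳ (T₀ ≤ᵇ lv v + lv u))
      each : ∀ u → edge W v u ≡ (𝟙 (adj G v u) + 3 * s * 𝟙 (adj G v u ∧ reachB v u)) + ω v u
      each u = bool-cases (adj G v u)
        (λ a → trans (edge-true W a) (trans (weight u a) (cong (λ b → (𝟙 b + 3 * s * 𝟙 (b ∧ reachB v u)) + ω v u) (sym a))))
        (λ a → trans (cong (λ b → if b then W v u else 0) a)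
          (sym (trans (cong₂ (λ b z → (𝟙 b + 3 * s * 𝟙 (b ∧ reachB v u)) + z) a (ω-off v u (cong (_∧ P₀ u) a)))
            (trans (+-identityʳ _) (*-zeroʳ (3 * s))))))

    -- Crowding in `R` and the search for a free window.

    module Regular (W : Fin n → Fin n → ℕ) (off : Off W) (bnd : ∀ x y → Hd x y ≡ true → 1 ≤ W x y × W x y ≤ 1 + 3 * s)
      (u : Fin n) (Ru : R u ≡ true) (Eu : E u ≡ false) where

      ¬P₀ : P₀ u ≡ false
      ¬P₀ = proj₁ (∨-false⁻ {P₀ u} (proj₁ (∨-false⁻ {P₀ u ∨ ZU u} Eu)))
      ¬ZU : ZU u ≡ false
      ¬ZU = proj₂ (∨-false⁻ {P₀ u} (proj₁ (∨-false⁻ {P₀ u ∨ ZU u} Eu)))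
      ¬F : F u ≡ false
      ¬F = proj₂ (∨-false⁻ {P₀ u ∨ ZU u} Eu)
      ¬Z : Z u ≡ false
      ¬Z = proj₁ (∨-false⁻ {Z u} ¬ZU)
      inQ : Q₀ u ≡ true
      inQ with ∨-true⁻ {Q₀ u} Ru
      ... | inj₁ e = e
      ... | inj₂ e = ⊥-elim (true≢false e ¬ZU)

      hd : ℕ
      hd = # (Hd u)

      -- A neighbour designated by `u` lies in `Q₀` because `u` is not bad. A neighbour that
      -- designates `u` lies in `Q₀` too, for otherwise it would be in `ZU` and `u` in `F`. This
      -- purpose of `E` makes `hd` at most `D u (g + 2) / H`.
      Hd⇒Q₀ : ∀ w → Hd u w ≡ true → Q₀ w ≡ true
      Hd⇒Q₀ w h with Hd-tog u w h
      ... | inj₁ e with ∨-true⁻ {Z u} (proj₂ (∧-true⁻ {adj G u w} (tog⇒candidate u w e)))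
      ... | inj₁ z = ⊥-elim (true≢false z ¬Z)
      ... | inj₂ z = z
      Hd⇒Q₀ w h | inj₂ e with ∨-true⁻ {Q₀ w} (Hd-Rʳ u w h)
      ... | inj₁ z = z
      ... | inj₂ z = ⊥-elim (true≢false (exists⁺ (λ w → ZU w ∧ tog w u) w (∧-true z e)) ¬F)

      hd-upper : H * hd ≤ D u * (g + 2)
      hd-upper = ≤-trans (*-monoʳ-≤ H (#-mono (λ w h → ∧-true (Hd-adj u w h) (Hd⇒Q₀ w h)))) (nR-upper u ¬Z)

      weight : ∀ w → Hd u w ≡ false → W u w ≡ 1 + 3 * s * 𝟙 (reachB u w)
      weight w h = trans (off u w h) (trans (W₀-plain u w (AP-R u w Ru) (trans (cong (not (R w) ∧_) ¬P₀) (∧-zeroʳ (not (R w)))))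
        (trans (plain-off u w h) (cong (λ b → 1 + 3 * s * 𝟙 b) (related-positive u w ¬P₀))))

      nominal : Fin n → ℕ
      nominal w = 𝟙 (adj G u w) + 3 * s * 𝟙 (adj G u w ∧ reachB u w)

      edge-close : ∀ w → edge W u w ≤ nominal w + 3 * s * 𝟙 (Hd u w) × nominal w ≤ edge W u w + 3 * s * 𝟙 (Hd u w)
      edge-close w = bool-cases (adj G u w) adjacent
        (λ a → subst₂ (λ e m → e ≤ m + 3 * s * 𝟙 (Hd u w) × m ≤ e + 3 * s * 𝟙 (Hd u w))
          (sym (cong (λ b → if b then W u w else 0) a)) (sym (trans (cong (λ b → 𝟙 b + 3 * s * 𝟙 (b ∧ reachB u w)) a) (*-zeroʳ (3 * s)))) (z≤n , z≤n))
        where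
        Close : ℕ → ℕ → ℕ → Set
        Close e m h = e ≤ m + 3 * s * h × m ≤ e + 3 * s * h
        adjacent : adj G u w ≡ true → Close (edge W u w) (nominal w) (𝟙 (Hd u w))
        adjacent a = subst₂ (λ e m → Close e m (𝟙 (Hd u w))) (sym (edge-true W a))
          (sym (cong (λ b → 𝟙 b + 3 * s * 𝟙 (b ∧ reachB u w)) a))
          (bool-cases (Hd u w)
            (λ h → subst (λ b → Close (W u w) (1 + 3 * s * 𝟙 (reachB u w)) (𝟙 b)) (sym h)
              ( ≤-trans (proj₂ (bnd u w h)) (s≤s (≤-trans (≤-reflexive (sym (*-identityʳ (3 * s)))) (m≤n+m _ _)))
              , +-mono-≤ (proj₁ (bnd u w h)) (*-monoʳ-≤ (3 * s) (𝟙≤1 (reachB u w)))))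
            (λ h → subst (λ z → Close z (1 + 3 * s * 𝟙 (reachB u w)) (𝟙 (Hd u w))) (sym (weight w h)) (m≤m+n _ _ , m≤m+n _ _)))

      total : ∑ n (λ w → nominal w) ≡ lowest u
      total = trans (∑-+ n _ _) (cong (D u +_) (∑-*ˡ n (3 * s) _))

      slack : Fin n → ℕ
      slack w = 3 * s * 𝟙 (Hd u w)

      total-slack : ∑ n slack ≡ 3 * s * hd
      total-slack = ∑-*ˡ n (3 * s) (λ w → 𝟙 (Hd u w))

      value-upper : val W u ≤ lowest u + 3 * s * hd
      value-upper = begin
        val W u                    ≤⟨ ∑-mono (λ w → proj₁ (edge-close w)) ⟩
        ∑ n (λ w → nominal w + slack w) ≡⟨ ∑-+ n nominal slack ⟩
        ∑ n nominal + ∑ n slack       ≡⟨ cong₂ _+_ total total-slack ⟩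
        lowest u + 3 * s * hd          ∎
        where open ≤-Reasoning

      value-lower : lowest u ≤ val W u + 3 * s * hd
      value-lower = begin
        lowest u                       ≡⟨ total ⟨
        ∑ n nominal                   ≤⟨ ∑-mono (λ w → proj₂ (edge-close w)) ⟩
        ∑ n (λ w → edge W u w + slack w) ≡⟨ ∑-+ n (edge W u) slack ⟩
        val W u + ∑ n slack        ≡⟨ cong (val W u +_) total-slack ⟩
        val W u + 3 * s * hd       ∎
        where open ≤-Reasoning

      hit : ℕ → Bool
      hit y = queryWindow y u (lv u) ∧ ((0 <ᵇ cl u) ∧ (cl u <ᵇ suc g))

      hits-query : ∀ y → y ≤ val W u + s → val W u < y + (τ + 4) * s → hit y ≡ true
      hits-query y lo hi = ∧-true (∧-true (≤ᵇ-true lower) (<ᵇ-true upper)) (∧-true (P₀-positive u ¬P₀) inQ)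
        where
        lower : 8 * T * y ≤ queryBase u + slope u * lv u
        lower = ≤-trans (*-monoʳ-≤ (8 * T) (≤-trans lo (+-monoˡ-≤ s value-upper)))
          (≤-cancel-cert 0 (+-mono-≤ (*-monoʳ-≤ (3 * s) (cnt-upper u ¬Z)) (*-monoʳ-≤ (24 * (s * T₀)) hd-upper))
            (lem T₀ H (D u) s (c u) hd (lv u) H₁ g))
          where
          lem : ∀ T₀ H d s c h l H₁ g → 8 * (T₀ * H) * (d + 3 * s * c + 3 * s * h + s)
              + (3 * s * (8 * (d * (l * H₁)) + T₀ * d) + 24 * (s * T₀) * (d * (g + 2))) + 0
            ≡ 8 * (T₀ * H) * d + 3 * (s * d) * T₀ * (8 * g + 17) + 8 * (T₀ * H) * s + 24 * (s * d) * H₁ * l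
              + (3 * s * (8 * (T₀ * H * c)) + 24 * (s * T₀) * (H * h))
          lem = solve-∀
        upper : queryBase u + slope u * lv u < 8 * T * y + queryWidth u
        upper = ≤-cancel-cert 0 (+-mono-≤ (+-mono-≤ 1≤8T (+-mono-≤ (*-monoʳ-≤ (8 * T) hi) (*-monoʳ-≤ (8 * T) value-lower)))
            (+-mono-≤ (*-monoʳ-≤ (3 * s) (cnt-lower u ¬Z)) (*-monoʳ-≤ (24 * (s * T₀)) hd-upper)))
          (lem T₀ H (D u) s (c u) hd (lv u) H₁ g y τ (val W u))
          where
          1≤8T : 1 ≤ 8 * T
          1≤8T = *-mono-≤ {1} {8} {1} {T} (s≤s z≤n) 0<T
          lem : ∀ T₀ H d s c h l H₁ g y τ v → 1 + (8 * (T₀ * H) * d + 3 * (s * d) * T₀ * (8 * g + 17) + 8 * (T₀ * H) * s + 24 * (s * d) * H₁ * l)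
              + ((8 * (T₀ * H) + (8 * (T₀ * H) * (y + (τ + 4) * s) + 8 * (T₀ * H) * (v + 3 * s * h)))
                + (3 * s * (8 * (T₀ * H * c) + T₀ * d) + 24 * (s * T₀) * (d * (g + 2)))) + 0
            ≡ 8 * (T₀ * H) * y + (8 * (T₀ * H) * ((τ + 5) * s) + 6 * (s * d) * T₀ * (8 * g + 17))
              + ((1 + (8 * (T₀ * H) * (1 + v) + 8 * (T₀ * H) * (d + 3 * s * c))) + (3 * s * (8 * (d * (l * H₁))) + 24 * (s * T₀) * (H * h)))
          lem = solve-∀

      value-bounded : val W u + s < Nc
      value-bounded = ≤-<-trans (+-monoˡ-≤ s (≤-trans value-upper (+-mono-≤ (+-mono-≤ (#≤n (adj G u)) (*-monoʳ-≤ (3 * s) (#≤n (λ w → adj G u w ∧ reachB u w)))) (*-monoʳ-≤ (3 * s) (#≤n (Hd u))))))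
        (≤-reflexive (lem n s))
        where
        lem : ∀ n s → 1 + (n + 3 * s * n + 3 * s * n + s) ≡ n + 6 * (s * n) + s + 1
        lem = solve-∀

    instance
      s-nonZero : NonZero s
      s-nonZero = >-nonZero 0<s
      M-nonZero : NonZero M
      M-nonZero = >-nonZero 0<M

    record Progression (y : ℕ) : Set where
      field
        i₀ k o : ℕ
        i₀≤M   : i₀ ≤ M
        o<s    : o < s
        shifts : ∀ j → y + (i₀ + M * j) * s ≡ (k + j) * (M * s) + o

    progression : ∀ y → Progression y
    progression y = record
      -- `M ∸ ρ` steps carry the quotient `y / s` to the next multiple of `M`; the remainder `y % s`
      -- is unaffected and becomes `o`.
      { i₀ = M ∸ ρ ; k = suc (y / s / M) ; o = y % s ; i₀≤M = m∸n≤m M ρ ; o<s = m%n<n y s ; shifts = shifts }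
      where
      ρ = y / s % M
      shifts : ∀ j → y + (M ∸ ρ + M * j) * s ≡ (suc (y / s / M) + j) * (M * s) + y % s
      shifts j = begin
        y + (M ∸ ρ + M * j) * s                                  ≡⟨ cong (_+ (M ∸ ρ + M * j) * s) (m≡m%n+[m/n]*n y s) ⟩
        y % s + y / s * s + (M ∸ ρ + M * j) * s                  ≡⟨ cong (λ d → y % s + d * s + (M ∸ ρ + M * j) * s) (m≡m%n+[m/n]*n (y / s) M) ⟩
        y % s + (ρ + y / s / M * M) * s + (M ∸ ρ + M * j) * s    ≡⟨ lem₁ (y % s) ρ (y / s / M) M s (M ∸ ρ) j ⟩
        (ρ + (M ∸ ρ)) * s + (y / s / M + j) * (M * s) + y % s    ≡⟨ cong (λ z → z * s + (y / s / M + j) * (M * s) + y % s) (m+[n∸m]≡n (<⇒≤ (m%n<n (y / s) M))) ⟩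
        M * s + (y / s / M + j) * (M * s) + y % s                ≡⟨⟩
        (suc (y / s / M) + j) * (M * s) + y % s                  ∎
        where
        open ≡-Reasoning
        lem₁ : ∀ o ρ q M s i j → o + (ρ + q * M) * s + (i + M * j) * s ≡ (ρ + i) * s + (q + j) * (M * s) + o
        lem₁ = solve-∀

    module Find (W : Fin n → Fin n → ℕ) (P : Fin n → Bool) (a : Fin n → ℕ) (off : Off W)
      (bnd : ∀ x y → Hd x y ≡ true → 1 ≤ W x y × W x y ≤ 1 + 3 * s) (P⊆R : ∀ u → P u ≡ true → R u ≡ true)
      (pair : ∀ u → P u ≡ true → val W u ≡ a u ⊎ val W u ≡ a u + s) (y : ℕ) where

      open Progression (progression y)

      step : ℕ → ℕ
      step j = i₀ + M * j

      close : ℕ → Fin n → Bool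
      close j = near s P a (y + step j * s)

      win : Fin n → Bool
      win u = P u ∧ ((y ≤ᵇ a u + s) ∧ (a u <ᵇ y + (τ + 3) * s))

      step≤τ : ∀ j → j < N → step j ≤ τ
      step≤τ j j<N = ≤-trans (+-monoˡ-≤ (M * j) i₀≤M) (≤-trans (≤-reflexive (sym (*-suc M j))) (≤-trans (*-monoʳ-≤ M j<N) MN≤τ))

      close⁻ : ∀ j u → close j u ≡ true → P u ≡ true × y + step j * s ≤ a u + s × a u < y + step j * s + 3 * s
      close⁻ j u h = proj₁ (∧-true⁻ {P u} h) ,
        ≤ᵇ-true⁻ (proj₁ (∧-true⁻ {y + step j * s ≤ᵇ a u + s} (proj₂ (∧-true⁻ {P u} h)))) ,
        <ᵇ-true⁻ (proj₂ (∧-true⁻ {y + step j * s ≤ᵇ a u + s} (proj₂ (∧-true⁻ {P u} h))))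

      close⇒win : ∀ j u → j < N → close j u ≡ true → win u ≡ true
      close⇒win j u j<N h = ∧-true (proj₁ parts) (∧-true (≤ᵇ-true (≤-trans (m≤m+n y _) (proj₁ (proj₂ parts))))
        (<ᵇ-true (<-≤-trans (proj₂ (proj₂ parts)) (≤-trans (≤-reflexive (+-assoc y _ _))
          (+-monoʳ-≤ y (≤-trans (+-monoˡ-≤ (3 * s) (*-monoˡ-≤ s (step≤τ j j<N))) (≤-reflexive (sym (*-distribʳ-+ s τ 3)))))))))
        where parts = close⁻ j u h

      -- The range in which `a u` counts as near has length `4 s`, and consecutive windows start
      -- `M s ≥ 4 s` apart, so each processed vertex burdens at most one window.
      far : ∀ i j u → i < j → close i u ≡ true → close j u ≡ true → ⊥
      far i j u i<j hi hj = <⇒≱ (proj₂ (proj₂ (close⁻ i u hi)))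
        (+-cancelʳ-≤ s _ _ (≤-trans (≤-trans (≤-reflexive (lem (y + step i * s) s)) apart) (proj₁ (proj₂ (close⁻ j u hj)))))
        where
        lem : ∀ b s → b + 3 * s + s ≡ b + 4 * s
        lem = solve-∀
        4≤M : 4 ≤ M
        4≤M = subst (4 ≤_) (sym M≡) (m≤m+n 4 (12 + μ))
        apart : y + step i * s + 4 * s ≤ y + step j * s
        apart = ≤-trans (+-monoʳ-≤ (y + step i * s) (*-monoˡ-≤ s 4≤M)) (≤-trans (≤-reflexive (lem₂ y i₀ M i s))
          (+-monoʳ-≤ y (*-monoˡ-≤ s (+-monoʳ-≤ i₀ (*-monoʳ-≤ M i<j)))))
          where
          lem₂ : ∀ y i₀ M i s → y + (i₀ + M * i) * s + M * s ≡ y + (i₀ + M * suc i) * s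
          lem₂ = solve-∀

      close-once : ∀ u → # {N} (λ j → close (toℕ j) u) ≤ 𝟙 (win u)
      close-once u = bool-cases (win u)
        (λ e → subst (λ b → # {N} (λ j → close (toℕ j) u) ≤ 𝟙 b) (sym e) (#-unique (λ (j : Fin N) → close (toℕ j) u) once))
        (λ e → ≤-trans (≤-reflexive (#-false {N} {λ j → close (toℕ j) u} (λ j → not-¬-true (λ h → true≢false (close⇒win (toℕ j) u (toℕ<n j) h) e)))) z≤n)
        where
        once : ∀ (i j : Fin N) → close (toℕ i) u ≡ true → close (toℕ j) u ≡ true → i ≡ j
        once i j hi hj with <-cmp (toℕ i) (toℕ j)
        ... | tri< lt _ _ = ⊥-elim (far (toℕ i) (toℕ j) u lt hi hj)
        ... | tri≈ _ e _ = toℕ-injective e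
        ... | tri> _ _ gt = ⊥-elim (far (toℕ j) (toℕ i) u gt hj hi)

      total-cost : ∑ N (λ j → cost s P a (y + step (toℕ j) * s)) ≤ # win
      total-cost = ≤-trans (≤-reflexive (∑-swap N n (λ j u → 𝟙 (close (toℕ j) u)))) (∑-mono close-once)

      value-range : ∀ u → win u ≡ true → y ≤ val W u + s × val W u < y + (τ + 4) * s
      value-range u h = by (pair u (proj₁ (∧-true⁻ {P u} h)))
        where
        lo : y ≤ a u + s
        lo = ≤ᵇ-true⁻ (proj₁ (∧-true⁻ {y ≤ᵇ a u + s} (proj₂ (∧-true⁻ {P u} h))))
        hi : a u + s < y + (τ + 4) * s
        hi = <-≤-trans (+-monoˡ-< s (<ᵇ-true⁻ {a u} (proj₂ (∧-true⁻ {y ≤ᵇ a u + s} (proj₂ (∧-true⁻ {P u} h)))))) (≤-reflexive (lem y τ s))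
          where
          lem : ∀ y τ s → y + (τ + 3) * s + s ≡ y + (τ + 4) * s
          lem = solve-∀
        by : val W u ≡ a u ⊎ val W u ≡ a u + s → y ≤ val W u + s × val W u < y + (τ + 4) * s
        by (inj₁ e) = subst (λ z → y ≤ z + s × z < y + (τ + 4) * s) (sym e) (lo , ≤-<-trans (m≤m+n (a u) s) hi)
        by (inj₂ e) = subst (λ z → y ≤ z + s × z < y + (τ + 4) * s) (sym e) (≤-trans lo (m≤m+n (a u + s) s) , hi)

      queried : Fin n → Bool
      queried u = queryWindow y u (lv u) ∧ ((0 <ᵇ cl u) ∧ (cl u <ᵇ suc g))

      win⇒queried : ∀ u → win u ≡ true → E u ≡ false → queried u ≡ true × y < Nc
      win⇒queried u h e = Reg.hits-query y (proj₁ (value-range u h)) (proj₂ (value-range u h)) , ≤-<-trans (proj₁ (value-range u h)) Reg.value-bounded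
        where module Reg = Regular W off bnd u (P⊆R u (proj₁ (∧-true⁻ {P u} h))) e

      #win : # win ≤ # E + # (λ u → win u ∧ not (E u))
      #win = ≤-trans (#-mono {q = λ u → E u ∨ (win u ∧ not (E u))} (λ u h → bool-cases (E u) (λ e → ∨-trueˡ e) (λ e → ∨-trueʳ {E u} (∧-true h (cong not e)))))
        (#-∨ E (λ u → win u ∧ not (E u)))

      #regular : H * H * # (λ u → win u ∧ not (E u)) ≤ 18 * (n * (g * g))
      #regular = by (y <? Nc)
        where
        split : ∀ u → (win u ∧ not (E u)) ≡ true → queried u ≡ true × y < Nc
        split u h = win⇒queried u (proj₁ (∧-true⁻ {win u} h)) (not-true⁻ (proj₂ (∧-true⁻ {win u} h)))
        by : Dec (y < Nc) → H * H * # (λ u → win u ∧ not (E u)) ≤ 18 * (n * (g * g))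
        by (yes y<Nc) = ≤-trans (*-monoʳ-≤ (H * H) (#-mono (λ u h → proj₁ (split u h)))) (query-load y y<Nc)
        -- From `Nc` on no unexceptional vertex has a value near `y`, so the set is empty.
        by (no y≮Nc) = ≤-trans (≤-reflexive (trans (cong (H * H *_) (#-false {n} {λ u → win u ∧ not (E u)} (λ u → not-¬-true (λ h → y≮Nc (proj₂ (split u h)))))) (*-zeroʳ (H * H)))) z≤n

      crowd : 8 * # win ≤ N * s
      crowd = *-cancelˡ-≤ (H * H) {{>-nonZero (*-mono-< 0<H 0<H)}} (begin
        H * H * (8 * # win)                      ≤⟨ *-monoʳ-≤ (H * H) (*-monoʳ-≤ 8 #win) ⟩
        H * H * (8 * (# E + X))                  ≡⟨ lem H (# E) X ⟩
        8 * (H * (H * # E) + H * H * X)          ≤⟨ *-monoʳ-≤ 8 (+-mono-≤ (*-monoʳ-≤ H few-exceptional) #regular) ⟩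
        8 * (H * (3 * n) + 18 * (n * (g * g)))   ≡⟨ cong (λ z → 8 * (z + 18 * (n * (g * g)))) (lem₂ H n) ⟩
        8 * (3 * (n * H) + 18 * (n * (g * g)))   ≤⟨ budget ⟩
        H * H * (N * s)                          ∎)
        where
        open ≤-Reasoning
        X = # (λ u → win u ∧ not (E u))
        lem : ∀ h e x → h * h * (8 * (e + x)) ≡ 8 * (h * (h * e) + h * h * x)
        lem = solve-∀
        lem₂ : ∀ h n → h * (3 * n) ≡ 3 * (n * h)
        lem₂ = solve-∀

      cheap-step : Σ ℕ λ i → i ≤ τ × Free (y + i * s) × 6 * cost s P a (y + i * s) + 7 ≤ s
      cheap-step = by (∑-average N (λ j → cost s P a (y + step (toℕ j) * s)) 0<N)
        where
        by : (∃[ j ] N * cost s P a (y + step (toℕ j) * s) ≤ ∑ N (λ j → cost s P a (y + step (toℕ j) * s))) →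
          Σ ℕ λ i → i ≤ τ × Free (y + i * s) × 6 * cost s P a (y + i * s) + 7 ≤ s
        by (j , h) = step (toℕ j) , step≤τ (toℕ j) (toℕ<n j) , (k + toℕ j , o , shifts (toℕ j) , o<s) , small (cost s P a (y + step (toℕ j) * s)) h
          where
          small : ∀ x → N * x ≤ ∑ N (λ j → cost s P a (y + step (toℕ j) * s)) → 6 * x + 7 ≤ s
          -- An average window gives `8 x ≤ s`. Then `4 (6 x + 7) = 3 (8 x) + 28 ≤ 4 s`, which is
          -- where `28 ≤ s` comes from.
          small x h = *-cancelˡ-≤ 4 (≤-trans (≤-reflexive (lem₁ x)) (≤-trans (+-mono-≤ (*-monoʳ-≤ 3 8x≤s) 28≤s) (≤-reflexive (lem₂ s))))
            where
            lem₁ : ∀ x → 4 * (6 * x + 7) ≡ 3 * (8 * x) + 28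
            lem₁ = solve-∀
            lem₂ : ∀ s → 3 * s + s ≡ 4 * s
            lem₂ = solve-∀
            lem₃ : ∀ N x → N * (8 * x) ≡ 8 * (N * x)
            lem₃ = solve-∀
            8x≤s : 8 * x ≤ s
            8x≤s = *-cancelˡ-≤ N {{>-nonZero 0<N}} (≤-trans (≤-reflexive (lem₃ N x)) (≤-trans (*-monoʳ-≤ 8 (≤-trans h total-cost)) crowd))

    absorbed : Absorbed G R Hd s W₀ Free
    absorbed = Absorb.absorb G R Hd Hd-sym Hd-adj Hd-R tog tog-Hd s W₀ W₀-sym W₀-Hd Free neighbour second τ τ≤tog
      (λ W P a v y off bnd P⊆R pair _ → Find.cheap-step W P a off bnd P⊆R pair y)
      where
      neighbour : ∀ v → R v ≡ true → ∃[ u ] Hd v u ≡ true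
      neighbour v Rv = by (#-witness (tog v) (subst (0 <_) (sym (#tog v)) (≤-trans (s≤s z≤n) (≤-trans (m≤n+m 2 τ) τ+2≤r))))
        where
        by : (∃[ u ] tog v u ≡ true) → ∃[ u ] Hd v u ≡ true
        by (u , h) = u , tog-Hd v u Rv h
      second : ∀ v u → Hd v u ≡ true → ∃[ w ] ((w ≢ u × Hd v w ≡ true) ⊎ (w ≢ v × Hd u w ≡ true))
      second v u h = by (#-witness₂ (tog v) u (subst (1 <_) (sym (#tog v)) (≤-trans (m≤n+m 2 τ) τ+2≤r)))
        where
        by : (∃[ w ] w ≢ u × tog v w ≡ true) → ∃[ w ] ((w ≢ u × Hd v w ≡ true) ⊎ (w ≢ v × Hd u w ≡ true))
        by (w , ne , e) = w , inj₁ (ne , tog-Hd v w (Hd-R v u h) e)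
      τ≤tog : ∀ v ex → R v ≡ true → # ex ≤ 2 → τ ≤ # (λ w → tog v w ∧ not (ex w))
      τ≤tog v ex _ ex≤2 = +-cancelʳ-≤ 2 τ _ (begin
        τ + 2                                                            ≤⟨ τ+2≤r ⟩
        r                                                                ≡⟨ #tog v ⟨
        # (tog v)                                                        ≡⟨ #-split (tog v) ex ⟨
        # (λ w → tog v w ∧ ex w) + # (λ w → tog v w ∧ not (ex w))        ≤⟨ +-monoˡ-≤ _ (≤-trans (#-mono {q = ex} (λ w h → proj₂ (∧-true⁻ {tog v w} h))) ex≤2) ⟩
        2 + # (λ w → tog v w ∧ not (ex w))                               ≡⟨ +-comm 2 _ ⟩
        # (λ w → tog v w ∧ not (ex w)) + 2                               ∎)
        where open ≤-Reasoning

    irregular : Irregular G (1 + 3 * s)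
    irregular = conclude absorbed
      where
      conclude : Absorbed G R Hd s W₀ Free → Irregular G (1 + 3 * s)
      conclude A = irregular-by G (1 + 3 * s) W W-sym′ bounds distinct
        where
        open Absorbed A
        bounds : ∀ u v → adj G u v ≡ true → 1 ≤ W u v × W u v ≤ 1 + 3 * s
        bounds u v _ = bool-cases (Hd u v) (W-bounds u v)
          (λ h → subst (λ z → 1 ≤ z × z ≤ 1 + 3 * s) (sym (W-off u v h)) (W₀-bounds u v))
        -- Modulo `M s` the value of `u` has residue `o + x < 4 s`, while the target of `v` has
        -- residue at least `4 s`.
        mixed : ∀ u v → R u ≡ true → R v ≡ false → val W u ≢ val W v
        mixed u v Ru Rv e = clash (W-free u Ru)
          where
          clash : (Σ ℕ λ d → Free d × d ≤ val W u × val W u < d + 3 * s) → ⊥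
          clash (d , (k , o , refl , o<s) , lo , hi) = <⇒≱ o+c<4s (≤-trans (m≤m+n (4 * s) (offset v)) (≤-reflexive (sym (proj₂ parts))))
            where
            x = val W u ∸ (k * (M * s) + o)
            x-eq : k * (M * s) + o + x ≡ val W u
            x-eq = m+[n∸m]≡n lo
            x<3s : x < 3 * s
            x<3s = +-cancelˡ-< (k * (M * s) + o) x (3 * s) (subst (_< k * (M * s) + o + 3 * s) (sym x-eq) hi)
            o+c<4s : o + x < 4 * s
            o+c<4s = +-mono-< o<s x<3s
            parts : k ≡ (index v + 1) * γ + block v × o + x ≡ 4 * s + offset v
            parts = division-unique (M * s) k ((index v + 1) * γ + block v)
              (<-≤-trans o+c<4s (≤-trans (m≤m+n (4 * s) sm) (≤-reflexive (sym period)))) (target-residue v)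
              (trans (sym (+-assoc (k * (M * s)) o x)) (trans x-eq (trans e (value-target W-off v Rv))))
        distinct : ∀ u v → val W u ≡ val W v → u ≡ v
        distinct u v e = bool-cases (R u)
          (λ Ru → bool-cases (R v) (λ Rv → W-distinct u v Ru Rv e) (λ Rv → ⊥-elim (mixed u v Ru Rv e)))
          (λ Ru → bool-cases (R v) (λ Rv → ⊥-elim (mixed v u Rv Ru (sym e)))
            (λ Rv → target-injective u v Ru Rv (trans (sym (value-target W-off u Ru)) (trans e (value-target W-off v Rv)))))

  irregular-by-parameters : Irregular G (1 + 3 * s)
  irregular-by-parameters = Construct.irregular layout

-- Exponential growth, roots, and parameters for large minimum degree.

quotient-lower : ∀ x c .{{_ : NonZero c}} → x < (x / c + 1) * c
quotient-lower x c = begin-strict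
  x                     ≡⟨ m≡m%n+[m/n]*n x c ⟩
  x % c + x / c * c     <⟨ +-monoˡ-< (x / c * c) (m%n<n x c) ⟩
  c + x / c * c         ≡⟨ cong (_* c) (+-comm 1 (x / c)) ⟩
  (x / c + 1) * c       ∎
  where open ≤-Reasoning

≤-quotient : ∀ {b x} c .{{_ : NonZero c}} → b * c ≤ x → b ≤ x / c
≤-quotient {b} {x} c h = ≤-trans (≤-reflexive (sym (m*n/n≡m b c))) (/-monoˡ-≤ c h)

n<2^n : ∀ n → n < 2 ^ n
n<2^n zero    = s≤s z≤n
n<2^n (suc n) = ≤-trans (+-mono-≤ (≤-trans (s≤s z≤n) (n<2^n n)) (n<2^n n)) (≤-reflexive (cong (2 ^ n +_) (sym (+-identityʳ _))))

n³<8^n : ∀ n → n * n * n < 8 ^ n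
n³<8^n n = <-≤-trans (*-mono-< (*-mono-< (n<2^n n) (n<2^n n)) (n<2^n n)) (≤-reflexive
  (trans (cong₂ _*_ (sym (^-distribˡ-+-* 2 n n)) refl) (trans (sym (^-distribˡ-+-* 2 (n + n) n))
    (trans (cong (2 ^_) (lem n)) (sym (^-*-assoc 2 3 n))))))
  where
  lem : ∀ n → n + n + n ≡ 3 * n
  lem = solve-∀

-- With `z = m / c / suc e` one has `m ≤ w (z + 1) ≤ w 2 ^ z`, hence
-- `m ^ suc e ≤ w ^ suc e * 2 ^ (m / c)`. The one power of `m` beyond `m ^ e` absorbs `K w ^ suc e`.
exponential-dominates : ∀ K e c → 0 < c → Σ ℕ λ m₀ → ∀ m → m₀ ≤ m → .{{_ : NonZero c}} → K * m ^ e ≤ 2 ^ (m / c)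
exponential-dominates K e c 0<c = K * w ^ suc e , λ m h → bound m h
  where
  w = c * suc e
  bound : ∀ m → K * w ^ suc e ≤ m → .{{_ : NonZero c}} → K * m ^ e ≤ 2 ^ (m / c)
  bound m h = *-cancelˡ-≤ (w ^ suc e) {{m^n≢0 w (suc e) {{>-nonZero (*-mono-< 0<c (s≤s {0} z≤n))}}}} (begin
    w ^ suc e * (K * m ^ e)         ≡⟨ lem (w ^ suc e) K (m ^ e) ⟩
    K * w ^ suc e * m ^ e           ≤⟨ *-monoˡ-≤ (m ^ e) h ⟩
    m ^ suc e                       ≤⟨ ^-monoˡ-≤ (suc e) m≤ ⟩
    (w * suc z) ^ suc e             ≡⟨ ^-distribʳ-* (suc e) w (suc z) ⟩
    w ^ suc e * suc z ^ suc e       ≤⟨ *-monoʳ-≤ (w ^ suc e) (^-monoˡ-≤ (suc e) (n<2^n z)) ⟩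
    w ^ suc e * (2 ^ z) ^ suc e     ≡⟨ cong (w ^ suc e *_) (^-*-assoc 2 z (suc e)) ⟩
    w ^ suc e * 2 ^ (z * suc e)     ≤⟨ *-monoʳ-≤ (w ^ suc e) (^-monoʳ-≤ 2 (m/n*n≤m (m / c) (suc e))) ⟩
    w ^ suc e * 2 ^ (m / c)         ∎)
    where
    open ≤-Reasoning
    z = m / c / suc e
    lem : ∀ a b c → a * (b * c) ≡ b * a * c
    lem = solve-∀
    m≤ : m ≤ w * suc z
    m≤ = <⇒≤ (begin-strict
      m                        <⟨ quotient-lower m c ⟩
      (m / c + 1) * c          ≤⟨ *-monoˡ-≤ c (≤-trans (≤-reflexive (+-comm (m / c) 1)) (quotient-lower (m / c) (suc e))) ⟩
      (z + 1) * suc e * c      ≡⟨ lem₃ z (suc e) c ⟩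
      c * suc e * suc z        ∎)
      where
      lem₃ : ∀ z e c → (z + 1) * e * c ≡ c * e * suc z
      lem₃ = solve-∀

integer-root : ∀ b → 0 < b → ∀ x → Σ ℕ λ m → m ^ b ≤ x × x < suc m ^ b
integer-root (suc b) _ zero    = 0 , z≤n , m^n>0 1 (suc b)
integer-root (suc b) 0<b (suc x) = extend (integer-root (suc b) 0<b x)
  where
  extend : (Σ ℕ λ m → m ^ suc b ≤ x × x < suc m ^ suc b) → Σ ℕ λ m → m ^ suc b ≤ suc x × suc x < suc m ^ suc b
  extend (m , lo , hi) = by (suc m ^ suc b ≤? suc x)
    where
    by : Dec (suc m ^ suc b ≤ suc x) → Σ ℕ λ m → m ^ suc b ≤ suc x × suc x < suc m ^ suc b
    by (yes h) = suc m , h , ≤-<-trans hi (^-monoˡ-< (suc b) (n<1+n (suc m)))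
    by (no h)  = m , m≤n⇒m≤1+n lo , ≰⇒> h

-- As n / c₀ ≥ (n / δ) (δ / c₀), a polynomial bound at δ propagates to all n ≥ δ.
module Tail (n δ c₀ E : ℕ) .{{_ : NonZero c₀}} (0<δ : 0 < δ) (δ≤n : δ ≤ n) (0<E : 0 < E)
  (large : 8 * (E * (8 * (δ * δ * δ))) ≤ 2 ^ (δ / c₀)) where

  tail-large : E * (n * n * n) < 2 ^ (n / c₀)
  tail-large = begin-strict
    E * (n * n * n)                       ≤⟨ *-monoʳ-≤ E (*-mono-≤ (*-mono-≤ n≤ n≤) n≤) ⟩
    E * ((2 * j * δ) * (2 * j * δ) * (2 * j * δ)) ≡⟨ lem E j δ ⟩
    E * (8 * (δ * δ * δ)) * (j * j * j)   <⟨ *-monoʳ-< E′ {{>-nonZero 0<E′}} (n³<8^n j) ⟩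
    E′ * 8 ^ j                            ≤⟨ power j 0<j ⟩
    (2 ^ (δ / c₀)) ^ j                    ≡⟨ ^-*-assoc 2 (δ / c₀) j ⟩
    2 ^ (δ / c₀ * j)                      ≤⟨ ^-monoʳ-≤ 2 exponents ⟩
    2 ^ (n / c₀)                          ∎
    where
    open ≤-Reasoning
    instance
      δ-nonZero : NonZero δ
      δ-nonZero = >-nonZero 0<δ
    j = n / δ
    E′ = E * (8 * (δ * δ * δ))
    0<E′ : 0 < E′
    0<E′ = *-mono-< 0<E (*-mono-< {0} {8} (s≤s z≤n) (*-mono-< (*-mono-< 0<δ 0<δ) 0<δ))
    0<j : 0 < j
    0<j = ≤-quotient δ (≤-trans (≤-reflexive (+-identityʳ δ)) δ≤n)
    n≤ : n ≤ 2 * j * δ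
    n≤ = <⇒≤ (<-≤-trans (quotient-lower n δ) (*-monoˡ-≤ δ (≤-trans (+-monoʳ-≤ j 0<j) (≤-reflexive (cong (j +_) (sym (+-identityʳ j)))))))
    exponents : δ / c₀ * j ≤ n / c₀
    exponents = ≤-quotient c₀ (≤-trans (≤-reflexive (lem₂ (δ / c₀) j c₀)) (≤-trans (*-monoʳ-≤ j (m/n*n≤m δ c₀)) (≤-trans (≤-reflexive refl) (m/n*n≤m n δ))))
      where
      lem₂ : ∀ a j c → a * j * c ≡ j * (a * c)
      lem₂ = solve-∀
    lem : ∀ E j δ → E * ((2 * j * δ) * (2 * j * δ) * (2 * j * δ)) ≡ E * (8 * (δ * δ * δ)) * (j * j * j)
    lem = solve-∀
    -- One of the `j` factors `2 ^ (δ / c₀)` absorbs `8 E′`; each of the others has to absorb only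
    -- 8.
    power : ∀ j → 0 < j → E′ * 8 ^ j ≤ (2 ^ (δ / c₀)) ^ j
    power (suc j) _ = ≤-trans (≤-reflexive (lem₃ E′ (8 ^ j))) (*-mono-≤ large (^-monoˡ-≤ j (≤-trans (≤-trans (≤-reflexive (sym (*-identityʳ 8))) (*-monoʳ-≤ 8 0<E′)) large)))
      where
      lem₃ : ∀ e p → e * (8 * p) ≡ 8 * e * p
      lem₃ = solve-∀

module LargeDegree {n : ℕ} (G : Graph n) (δ M μ g H H₁ : ℕ) (M≡ : M ≡ 16 + μ) (H≡ : H ≡ suc H₁) (v₀ : Fin n)
  (δ≤deg : ∀ v → δ ≤ degree G v) (M²≤H : M * M ≤ H) (648M≤g : 648 * M ≤ g) (4320gM≤H : 4320 * (g * M) ≤ H)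
  .{{c₀-nonZero : NonZero (768 * (H * H))}}
  (large : 8 * (411 * (12 * H * M * 2 + 4) * H * (8 * ((1 + δ) * (1 + δ) * (1 + δ)))) ≤ 2 ^ (δ / (768 * (H * H)))) where

  private
    T₀ c₀ B₁ B₂ Y : ℕ
    T₀ = 12 * H * M
    c₀ = 768 * (H * H)
    B₁ = δ / c₀
    B₂ = n / c₀
    Y = T₀ * 2 + 4

    0<M : 0 < M
    0<M = subst (0 <_) (sym M≡) (s≤s z≤n)
    0<H : 0 < H
    0<H = subst (0 <_) (sym H≡) (s≤s z≤n)
    0<g : 0 < g
    0<g = ≤-trans (*-mono-≤ {1} {648} (s≤s z≤n) 0<M) 648M≤g

    0<Y : 0 < Y
    0<Y = ≤-trans (s≤s z≤n) (m≤n+m 4 (T₀ * 2))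

    cube : ℕ
    cube = (1 + δ) * (1 + δ) * (1 + δ)

    large′ : ∀ {x} → x ≤ 8 * (411 * Y * H * (8 * cube)) → x ≤ 2 ^ B₁
    large′ h = ≤-trans h large

    0<B₁ : 0 < B₁
    0<B₁ = n≢0⇒n>0 (λ e → <⇒≱ (s≤s (s≤s z≤n)) (subst (λ z → 2 ≤ 2 ^ z) e (large′ (*-mono-≤ {2} {8} {1} (s≤s (s≤s z≤n))
      (*-mono-≤ {1} {411 * Y * H} {1} (*-mono-≤ {1} {411 * Y} (*-mono-≤ {1} {411} (s≤s z≤n) 0<Y) 0<H) (*-mono-≤ {1} {8} {1} (s≤s z≤n) (s≤s z≤n)))))))

    c₀≤δ : c₀ ≤ δ
    c₀≤δ = ≤-trans (≤-trans (≤-reflexive (sym (+-identityʳ c₀))) (*-monoˡ-≤ c₀ 0<B₁)) (m/n*n≤m δ c₀)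

    0<δ : 0 < δ
    0<δ = <-≤-trans (*-mono-< {0} {768} (s≤s z≤n) (*-mono-< 0<H 0<H)) c₀≤δ

    δ≤n : δ ≤ n
    δ≤n = ≤-trans (δ≤deg v₀) (#≤n (adj G v₀))

    0<n : 0 < n
    0<n = <-≤-trans 0<δ δ≤n

    M≤H : M ≤ H
    M≤H = ≤-trans (≤-trans (≤-reflexive (sym (*-identityʳ M))) (*-monoʳ-≤ M 0<M)) M²≤H

    multiple : ∀ k → k ≤ 768 → k * (H * H) ≤ δ
    multiple k h = ≤-trans (*-monoˡ-≤ (H * H) h) c₀≤δ

    instance
      δM-nonZero : NonZero (3 * (δ * M))
      δM-nonZero = >-nonZero (*-mono-< {0} {3} (s≤s z≤n) (*-mono-< 0<δ 0<M))
      HM-nonZero : NonZero (2 * (H * M))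
      HM-nonZero = >-nonZero (*-mono-< {0} {2} (s≤s z≤n) (*-mono-< 0<H 0<M))
      H-nonZero : NonZero H
      H-nonZero = >-nonZero 0<H
      M-nonZero : NonZero M
      M-nonZero = >-nonZero 0<M

  abstract
    s : ℕ
    -- The quotient is about `(n / (3 δ)) (1 + 16 / M)`. The summand 28 makes up for its rounding
    -- and provides `28 ≤ s`.
    s = n * (M + 16) / (3 * (δ * M)) + 28

    28≤s : 28 ≤ s
    28≤s = m≤n+m 28 _

    capacity : n * (M + 16) ≤ 3 * (s * δ) * M
    capacity = ≤-trans (<⇒≤ (quotient-lower (n * (M + 16)) (3 * (δ * M)))) (≤-trans (*-monoˡ-≤ (3 * (δ * M)) (+-monoʳ-≤ (n * (M + 16) / (3 * (δ * M))) (s≤s {0} {27} z≤n))) (≤-reflexive (lem s δ M)))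
      where
      lem : ∀ s δ M → s * (3 * (δ * M)) ≡ 3 * (s * δ) * M
      lem = solve-∀

    s-upper : 3 * (δ * M) * s ≤ n * (M + 16) + 84 * (δ * M)
    s-upper = ≤-trans (≤-reflexive (lem (δ * M) (n * (M + 16) / (3 * (δ * M))))) (+-monoˡ-≤ (84 * (δ * M)) (m/n*n≤m (n * (M + 16)) (3 * (δ * M))))
      where
      lem : ∀ p x → 3 * p * (x + 28) ≡ x * (3 * p) + 84 * p
      lem = solve-∀

    γ : ℕ
    γ = δ / (2 * (H * M))

    γ-upper : 2 * (H * M) * γ ≤ δ
    γ-upper = ≤-trans (≤-reflexive (*-comm (2 * (H * M)) γ)) (m/n*n≤m δ (2 * (H * M)))

    γ-lower : δ ≤ 4 * (H * M) * γ
    γ-lower = ≤-trans (<⇒≤ (quotient-lower δ (2 * (H * M)))) (≤-trans (*-monoˡ-≤ (2 * (H * M)) (+-monoʳ-≤ γ 1≤γ)) (≤-reflexive (lem γ (H * M))))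
      where
      1≤γ : 1 ≤ γ
      1≤γ = ≤-quotient (2 * (H * M)) (≤-trans (≤-reflexive (+-identityʳ (2 * (H * M)))) (≤-trans (*-monoʳ-≤ 2 (*-monoʳ-≤ H M≤H)) (multiple 2 (m≤m+n 2 766))))
      lem : ∀ γ p → (γ + γ) * (2 * p) ≡ 4 * p * γ
      lem = solve-∀

    r : ℕ
    r = δ * g / H

    r-upper : H * r ≤ δ * g
    r-upper = ≤-trans (≤-reflexive (*-comm H r)) (m/n*n≤m (δ * g) H)

    r-lower : δ * g < (r + 1) * H
    r-lower = quotient-lower (δ * g) H

  private
    HH≤δg : 768 * (H * H) ≤ δ * g
    HH≤δg = ≤-trans c₀≤δ (≤-trans (≤-reflexive (sym (*-identityʳ δ))) (*-monoʳ-≤ δ 0<g))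

    H≤HH : H ≤ H * H
    H≤HH = ≤-trans (≤-reflexive (sym (*-identityʳ H))) (*-monoʳ-≤ H 0<H)

    2≤r : 2 ≤ r
    2≤r = *-cancelʳ-≤ 2 r H (≤-cancel-cert 0 (+-mono-≤ (<⇒≤ r-lower) (≤-trans (≤-trans (*-monoʳ-≤ 3 H≤HH) (*-monoˡ-≤ (H * H) {3} {768} (m≤m+n 3 765))) HH≤δg))
      (lem r H (δ * g)))
      where
      lem : ∀ r H x → 2 * H + ((r + 1) * H + x) + 0 ≡ r * H + (x + 3 * H)
      lem = solve-∀

    τ N : ℕ
    -- Up to two designated neighbours are protected at a turn.
    τ = r ∸ 2
    N = τ / M

    r≡ : τ + 2 ≡ r
    r≡ = m∸n+n≡m 2≤r

    τ-upper : (τ + 5) * H ≤ 2 * (δ * g)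
    τ-upper = ≤-trans (≤-reflexive (trans (lem τ H) (cong (λ z → H * z + 3 * H) r≡))) (≤-trans (+-mono-≤ r-upper (≤-trans (≤-trans (*-monoʳ-≤ 3 H≤HH) (*-monoˡ-≤ (H * H) {3} {768} (m≤m+n 3 765))) HH≤δg))
      (≤-reflexive (cong (δ * g +_) (sym (+-identityʳ (δ * g))))))
      where
      lem : ∀ τ H → (τ + 5) * H ≡ H * (τ + 2) + 3 * H
      lem = solve-∀

    MN≤τ : M * N ≤ τ
    MN≤τ = ≤-trans (≤-reflexive (*-comm M N)) (m/n*n≤m τ M)

    N-lower : δ * g ≤ 2 * (H * M) * N
    N-lower = ≤-cancel-cert 2 (+-mono-≤ (*-monoʳ-≤ 2 r-lower) (+-mono-≤ (*-monoʳ-≤ (2 * H) (quotient-lower τ M)) small))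
      (trans (cong (λ z → δ * g + (2 * ((z + 1) * H) + (2 * H * ((N + 1) * M) + δ * g)) + 2) (sym r≡)) (lem τ H N M (δ * g)))
      where
      small : 4 * H + 2 * (H * M) ≤ δ * g
      small = ≤-trans (+-mono-≤ (*-monoʳ-≤ 4 H≤HH) (*-monoʳ-≤ 2 (*-monoʳ-≤ H M≤H))) (≤-trans (≤-reflexive (sym (*-distribʳ-+ (H * H) 4 2))) (≤-trans (*-monoˡ-≤ (H * H) {6} {768} (m≤m+n 6 762)) HH≤δg))
      lem : ∀ τ H N M x → x + (2 * ((τ + 2 + 1) * H) + (2 * H * ((N + 1) * M) + x)) + 2
        ≡ 2 * (H * M) * N + (2 * (1 + x) + (2 * H * (1 + τ) + (4 * H + 2 * (H * M))))
      lem = solve-∀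

    0<N : 0 < N
    0<N = n≢0⇒n>0 (λ e → <⇒≱ (<-≤-trans (*-mono-< 0<δ 0<g) N-lower) (≤-reflexive (trans (cong (2 * (H * M) *_) e) (*-zeroʳ (2 * (H * M))))))

    n≤3sδ : n ≤ 3 * (s * δ)
    n≤3sδ = *-cancelʳ-≤ n (3 * (s * δ)) M (≤-trans (*-monoʳ-≤ n (m≤m+n M 16)) capacity)

    -- The first term comes from the exceptional competitors and is at most `(2/9) H g` by
    -- `648 M ≤ g`; the second comes from the ordinary ones and is at most `(1/5) H g` by
    -- `4320 g M ≤ H`.
    ratio : 144 * (M * H) + 864 * (M * (g * g)) ≤ H * g
    ratio = *-cancelˡ-≤ 45 (≤-cancel-cert (26 * (H * g)) (+-mono-≤ (*-monoʳ-≤ (10 * H) 648M≤g) (*-monoʳ-≤ (9 * g) 4320gM≤H)) (lem H g M))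
      where
      lem : ∀ H g M → 45 * (144 * (M * H) + 864 * (M * (g * g))) + (10 * H * g + 9 * g * H) + 26 * (H * g)
        ≡ 45 * (H * g) + (10 * H * (648 * M) + 9 * g * (4320 * (g * M)))
      lem = solve-∀

    budget : 8 * (3 * (n * H) + 18 * (n * (g * g))) ≤ H * H * (N * s)
    budget = *-cancelˡ-≤ (2 * M) {{>-nonZero (*-mono-< {0} {2} (s≤s z≤n) 0<M)}} (begin
      2 * M * (8 * (3 * (n * H) + 18 * (n * (g * g))))      ≡⟨ lem₁ M n H g ⟩
      n * (48 * (M * H) + 288 * (M * (g * g)))              ≤⟨ *-monoˡ-≤ _ n≤3sδ ⟩
      3 * (s * δ) * (48 * (M * H) + 288 * (M * (g * g)))    ≡⟨ lem₂ s δ M H g ⟩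
      s * δ * (144 * (M * H) + 864 * (M * (g * g)))         ≤⟨ *-monoʳ-≤ (s * δ) ratio ⟩
      s * δ * (H * g)                                       ≡⟨ lem₃ s δ H g ⟩
      H * s * (δ * g)                                       ≤⟨ *-monoʳ-≤ (H * s) N-lower ⟩
      H * s * (2 * (H * M) * N)                             ≡⟨ lem₄ H s M N ⟩
      2 * M * (H * H * (N * s))                             ∎)
      where
      open ≤-Reasoning
      lem₁ : ∀ M n H g → 2 * M * (8 * (3 * (n * H) + 18 * (n * (g * g)))) ≡ n * (48 * (M * H) + 288 * (M * (g * g)))
      lem₁ = solve-∀
      lem₂ : ∀ s δ M H g → 3 * (s * δ) * (48 * (M * H) + 288 * (M * (g * g))) ≡ s * δ * (144 * (M * H) + 864 * (M * (g * g)))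
      lem₂ = solve-∀
      lem₃ : ∀ s δ H g → s * δ * (H * g) ≡ H * s * (δ * g)
      lem₃ = solve-∀
      lem₄ : ∀ H s M N → H * s * (2 * (H * M) * N) ≡ 2 * M * (H * H * (N * s))
      lem₄ = solve-∀

    B₁-large : H * Y * ((1 + δ) * (1 + δ)) ≤ 2 ^ B₁
    B₁-large = large′ (≤-trans (m≤m*n _ (1 + δ)) (≤-trans (m≤m*n _ (8 * (411 * 8))) (≤-reflexive (lem H Y (1 + δ)))))
      where
      lem : ∀ h y d → h * y * (d * d) * d * (8 * (411 * 8)) ≡ 8 * (411 * y * h * (8 * (d * d * d)))
      lem = solve-∀

    s≤29n : s ≤ 29 * n
    s≤29n = *-cancelˡ-≤ (3 * (δ * M)) (≤-trans s-upper (≤-trans (+-mono-≤ part₁ part₂) (≤-reflexive (lem δ M n))))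
      where
      part₁ : n * (M + 16) ≤ 3 * (δ * M) * n
      part₁ = ≤-trans (*-monoʳ-≤ n (≤-trans (+-monoʳ-≤ M (subst (16 ≤_) (sym M≡) (m≤m+n 16 μ))) (≤-trans (m≤m+n (M + M) M) (≤-reflexive (lem₁ M)))))
        (≤-trans (≤-reflexive (lem₂ n M)) (*-monoˡ-≤ n (*-monoʳ-≤ 3 (≤-trans (≤-reflexive (sym (*-identityˡ M))) (*-monoˡ-≤ M 0<δ)))))
        where
        lem₁ : ∀ M → M + M + M ≡ 3 * M
        lem₁ = solve-∀
        lem₂ : ∀ n M → n * (3 * M) ≡ 3 * M * n
        lem₂ = solve-∀
      part₂ : 84 * (δ * M) ≤ 84 * (δ * M) * n
      part₂ = ≤-trans (≤-reflexive (sym (*-identityʳ _))) (*-monoʳ-≤ (84 * (δ * M)) 0<n)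
      lem : ∀ δ M n → 3 * (δ * M) * n + 84 * (δ * M) * n ≡ 3 * (δ * M) * (29 * n)
      lem = solve-∀

    B₂-large : ((n + 6 * (s * n) + s + 1) * 2 + 1) * (n * (T₀ * 2 + 3) + 1) < 2 ^ B₂
    B₂-large = ≤-<-trans (≤-trans (*-mono-≤ first second) (≤-reflexive (lem₃ n Y)))
      (Tail.tail-large n δ c₀ (411 * Y) 0<δ δ≤n (*-mono-< {0} {411} (s≤s z≤n) 0<Y) (large′ (*-monoʳ-≤ 8 (*-mono-≤ (≤-trans (≤-reflexive (sym (*-identityʳ (411 * Y)))) (*-monoʳ-≤ (411 * Y) 0<H))
        (*-monoʳ-≤ 8 (*-mono-≤ (*-mono-≤ (n≤1+n δ) (n≤1+n δ)) (n≤1+n δ)))))))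
      where
      n≤n² : n ≤ n * n
      n≤n² = ≤-trans (≤-reflexive (sym (*-identityʳ n))) (*-monoʳ-≤ n 0<n)
      1≤n² : 1 ≤ n * n
      1≤n² = *-mono-≤ 0<n 0<n
      -- The constant is `2 (1 + 6 * 29 + 29 + 1) + 1 = 411`, from `s ≤ 29 n`.
      first : (n + 6 * (s * n) + s + 1) * 2 + 1 ≤ 411 * (n * n)
      first = ≤-trans (+-mono-≤ (*-monoˡ-≤ 2 (+-mono-≤ (+-mono-≤ (+-mono-≤ n≤n² (*-monoʳ-≤ 6 (*-monoˡ-≤ n s≤29n))) (≤-trans s≤29n (*-monoʳ-≤ 29 n≤n²))) 1≤n²)) 1≤n²)
        (≤-reflexive (lem n))
        where
        lem : ∀ n → (n * n + 6 * (29 * n * n) + 29 * (n * n) + n * n) * 2 + n * n ≡ 411 * (n * n)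
        lem = solve-∀
      second : n * (T₀ * 2 + 3) + 1 ≤ n * Y
      second = ≤-trans (+-monoʳ-≤ (n * (T₀ * 2 + 3)) 0<n) (≤-reflexive (lem n T₀))
        where
        lem : ∀ n t → n * (t * 2 + 3) + n ≡ n * (t * 2 + 4)
        lem = solve-∀
      lem₃ : ∀ n y → 411 * (n * n) * (n * y) ≡ 411 * y * (n * n * n)
      lem₃ = solve-∀

    6≤g : 6 ≤ g
    6≤g = ≤-trans (*-mono-≤ {6} {648} {1} (m≤m+n 6 642) 0<M) 648M≤g

    g≤H₁ : g ≤ H₁
    g≤H₁ = s≤s⁻¹ (subst (suc g ≤_) H≡ (≤-trans (≤-trans (+-monoˡ-≤ g 0<g) (≤-trans (≤-reflexive (cong (g +_) (sym (+-identityʳ g)))) (≤-trans (*-monoʳ-≤ 2 (≤-trans (≤-reflexive (sym (*-identityʳ g))) (*-monoʳ-≤ g 0<M))) (*-monoˡ-≤ (g * M) {2} {4320} (m≤m+n 2 4318))))) 4320gM≤H))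

    parameters : Parameters G
    parameters = record
      { δ = δ ; M = M ; μ = μ ; g = g ; H = H ; H₁ = H₁ ; T₀ = T₀ ; s = s ; γ = γ ; τ = τ ; r = r ; N = N ; B₁ = B₁ ; B₂ = B₂
      ; M≡ = M≡ ; H≡ = H≡ ; T₀≡ = refl ; 0<n = 0<n ; δ≤deg = δ≤deg ; 0<δ = 0<δ ; 28≤s = 28≤s ; capacity = capacity
      ; γ-upper = γ-upper ; γ-lower = γ-lower ; M²≤H = M²≤H ; 6≤g = 6≤g ; g≤H₁ = g≤H₁ ; τ-upper = τ-upper
      ; B₁-small = ≤-trans (≤-reflexive (*-comm c₀ B₁)) (m/n*n≤m δ c₀) ; B₂-small = ≤-trans (≤-reflexive (*-comm c₀ B₂)) (m/n*n≤m n c₀)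
      ; B₁-large = B₁-large ; B₂-large = B₂-large ; τ+2≤r = ≤-reflexive r≡ ; r-upper = r-upper ; 0<N = 0<N ; MN≤τ = MN≤τ ; budget = budget }

  irregular-large : Irregular G (1 + 3 * s)
  irregular-large = Setting.irregular-by-parameters G parameters

  -- The number 85 is `1 + 3 * 28`: the 1 of the strength `1 + 3 s` and the summand 28 of `s`.
  strength-large : δ * (1 + 3 * s) * M ≤ n * (M + 16) + 85 * (δ * M)
  strength-large = ≤-trans (≤-reflexive (lem δ s M)) (≤-trans (+-monoʳ-≤ (δ * M) s-upper) (≤-reflexive (lem₂ (δ * M) (n * (M + 16)))))
    where
    lem : ∀ δ s M → δ * (1 + 3 * s) * M ≡ δ * M + 3 * (δ * M) * s
    lem = solve-∀
    lem₂ : ∀ p x → p + (x + 84 * p) ≡ x + 85 * p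
    lem₂ = solve-∀

-- Transfer of integer inequalities to the rational form of the bound.

-- The normal form of `nℚ m` with an explicit coprimality proof; `nℚ` itself normalises by a gcd,
-- which does not compute for a variable `m`.
intℚ : ℕ → ℚ
intℚ m = ℚ.mkℚ (ℤ.+ m) 0 (Coprimality.sym (Coprimality.1-coprimeTo m))

nℚ≡ : ∀ m → nℚ m ≡ intℚ m
nℚ≡ m = ℚ.↥p/↧p≡p (intℚ m)

nℚ-mono : ∀ {a b} → a ≤ b → nℚ a ℚ.≤ nℚ b
nℚ-mono {a} {b} h rewrite nℚ≡ a | nℚ≡ b = ℚ.*≤* (ℤ.*-monoʳ-≤-nonNeg (ℤ.+ 1) (ℤ.+≤+ h))

nℚ-+ : ∀ a b → nℚ (a + b) ≡ nℚ a ℚ.+ nℚ b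
nℚ-+ a b rewrite nℚ≡ (a + b) | nℚ≡ a | nℚ≡ b = ℚ.toℚᵘ-injective
  (ℚᵘ.≃-trans (ℚᵘ.*≡* (cong (ℤ._* ℤ.+ 1) (sym (cong₂ ℤ._+_ (ℤ.*-identityʳ (ℤ.+ a)) (ℤ.*-identityʳ (ℤ.+ b))))))
    (ℚᵘ.≃-sym (ℚ.toℚᵘ-homo-+ (intℚ a) (intℚ b))))

nℚ-* : ∀ a b → nℚ (a * b) ≡ nℚ a ℚ.* nℚ b
nℚ-* a b rewrite nℚ≡ (a * b) | nℚ≡ a | nℚ≡ b = ℚ.toℚᵘ-injective
  (ℚᵘ.≃-trans (ℚᵘ.*≡* (cong (ℤ._* ℤ.+ 1) (ℤ.pos-* a b)))
    (ℚᵘ.≃-sym (ℚ.toℚᵘ-homo-* (intℚ a) (intℚ b))))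

nℚ-^ : ∀ a k → nℚ (a ^ k) ≡ nℚ a ^ℚ k
nℚ-^ a zero    = refl
nℚ-^ a (suc k) = trans (nℚ-* a (a ^ k)) (cong (nℚ a ℚ.*_) (nℚ-^ a k))

0≤nℚ : ∀ a → ℚ.0ℚ ℚ.≤ nℚ a
0≤nℚ a = nℚ-mono {0} {a} z≤n

0<nℚ : ∀ {a} → 0 < a → ℚ.0ℚ ℚ.< nℚ a
0<nℚ {a} h = ℚ.<-≤-trans (ℚ.*<* (ℤ.+<+ (s≤s z≤n))) (nℚ-mono {1} {a} h)

*-monoʳ : ∀ {x y z} → ℚ.0ℚ ℚ.≤ z → x ℚ.≤ y → z ℚ.* x ℚ.≤ z ℚ.* y
*-monoʳ {z = z} h = ℚ.*-monoˡ-≤-nonNeg z {{ℚ.nonNegative h}}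

^ℚ-nonNeg : ∀ {x} → ℚ.0ℚ ℚ.≤ x → ∀ k → ℚ.0ℚ ℚ.≤ x ^ℚ k
^ℚ-nonNeg h zero    = ℚ.*≤* (ℤ.+≤+ z≤n)
^ℚ-nonNeg {x} h (suc k) = ℚ.≤-trans (ℚ.≤-reflexive (sym (ℚ.*-zeroʳ x))) (*-monoʳ h (^ℚ-nonNeg h k))

^ℚ-≤1 : ∀ {x} → ℚ.0ℚ ℚ.≤ x → x ℚ.≤ ℚ.1ℚ → ∀ k → x ^ℚ k ℚ.≤ ℚ.1ℚ
^ℚ-≤1 h h′ zero    = ℚ.≤-refl
^ℚ-≤1 {x} h h′ (suc k) = ℚ.≤-trans (*-monoʳ h (^ℚ-≤1 h h′ k)) (ℚ.≤-trans (ℚ.≤-reflexive (ℚ.*-identityʳ x)) h′)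

^ℚ-<1 : ∀ {x k} → 0 < k → ℚ.0ℚ ℚ.≤ x → x ℚ.< ℚ.1ℚ → x ^ℚ k ℚ.< ℚ.1ℚ
^ℚ-<1 {x} {suc k} _ h h′ = ℚ.≤-<-trans (ℚ.≤-trans (*-monoʳ h (^ℚ-≤1 h (ℚ.<⇒≤ h′) k)) (ℚ.≤-reflexive (ℚ.*-identityʳ x))) h′

^ℚ-distrib-* : ∀ x y k → (x ℚ.* y) ^ℚ k ≡ (x ^ℚ k) ℚ.* (y ^ℚ k)
^ℚ-distrib-* x y zero    = refl
^ℚ-distrib-* x y (suc k) = trans (cong ((x ℚ.* y) ℚ.*_) (^ℚ-distrib-* x y k)) (lem x y (x ^ℚ k) (y ^ℚ k))
  where
  open ℚSolver.+-*-Solver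
  lem : ∀ a b c d → (a ℚ.* b) ℚ.* (c ℚ.* d) ≡ (a ℚ.* c) ℚ.* (b ℚ.* d)
  lem = solve 4 (λ a b c d → (a :* b) :* (c :* d) := (a :* c) :* (b :* d)) refl

-- By monotonicity `(r E₀ ^ p) ^ q ≥ r ^ q δ ^ p ≥ 1`, whereas a number in `[0, 1)` has its `q`-th
-- power below 1. Thus the integer `E₀ ^ p` stands in for `δ ^ (p / q)`.
negative-power : ∀ {δ p q E₀ r} → 0 < q → δ ≤ E₀ ^ q → UpperBoundOfNegPow δ p q r → ℚ.1ℚ ℚ.≤ r ℚ.* nℚ (E₀ ^ p)
negative-power {δ} {p} {q} {E₀} {r} 0<q h (0≤r , 1≤) = ℚ.≮⇒≥ (λ lt → ℚ.<-irrefl refl (ℚ.≤-<-trans large (^ℚ-<1 0<q 0≤x lt)))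
  where
  x = r ℚ.* nℚ (E₀ ^ p)
  0≤x : ℚ.0ℚ ℚ.≤ x
  0≤x = ℚ.≤-trans (ℚ.≤-reflexive (sym (ℚ.*-zeroʳ r))) (*-monoʳ 0≤r (0≤nℚ (E₀ ^ p)))
  powers : δ ^ p ≤ (E₀ ^ p) ^ q
  powers = ≤-trans (^-monoˡ-≤ p h) (≤-reflexive (trans (^-*-assoc E₀ q p) (trans (cong (E₀ ^_) (*-comm q p)) (sym (^-*-assoc E₀ p q)))))
  large : ℚ.1ℚ ℚ.≤ x ^ℚ q
  large = ℚ.≤-trans 1≤ (ℚ.≤-trans (*-monoʳ (^ℚ-nonNeg 0≤r q) (subst₂ ℚ._≤_ (nℚ-^ δ p) (nℚ-^ (E₀ ^ p) q) (nℚ-mono powers)))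
    (ℚ.≤-reflexive (sym (^ℚ-distrib-* r (nℚ (E₀ ^ p)) q))))

-- After multiplication by `E` only the error term differs: `1 ≤ r E` turns `n C₁` into `n C₁ r E`.
rational-bound : ∀ n δ k C₁ C₂ E r → 0 < E → δ * k * E ≤ n * E + n * C₁ + C₂ * δ * E → ℚ.1ℚ ℚ.≤ r ℚ.* nℚ E →
  nℚ δ ℚ.* nℚ k ℚ.≤ nℚ n ℚ.* (ℚ.1ℚ ℚ.+ nℚ C₁ ℚ.* r) ℚ.+ nℚ C₂ ℚ.* nℚ δ
rational-bound n δ k C₁ C₂ E r 0<E h 1≤rE = ℚ.*-cancelʳ-≤-pos (nℚ E) {{ℚ.positive (0<nℚ 0<E)}} (begin
  nℚ δ ℚ.* nℚ k ℚ.* nℚ E                       ≡⟨ trans (cong (ℚ._* nℚ E) (sym (nℚ-* δ k))) (sym (nℚ-* (δ * k) E)) ⟩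
  nℚ (δ * k * E)                               ≤⟨ nℚ-mono h ⟩
  nℚ (n * E + n * C₁ + C₂ * δ * E)             ≡⟨ expand ⟩
  nℚ n ℚ.* nℚ E ℚ.+ nℚ n ℚ.* nℚ C₁ ℚ.+ nℚ C₂ ℚ.* nℚ δ ℚ.* nℚ E
                                               ≡⟨ cong (λ z → nℚ n ℚ.* nℚ E ℚ.+ z ℚ.+ nℚ C₂ ℚ.* nℚ δ ℚ.* nℚ E) (sym (ℚ.*-identityʳ (nℚ n ℚ.* nℚ C₁))) ⟩
  nℚ n ℚ.* nℚ E ℚ.+ nℚ n ℚ.* nℚ C₁ ℚ.* ℚ.1ℚ ℚ.+ nℚ C₂ ℚ.* nℚ δ ℚ.* nℚ E
                                               ≤⟨ ℚ.+-monoˡ-≤ (nℚ C₂ ℚ.* nℚ δ ℚ.* nℚ E) (ℚ.+-monoʳ-≤ (nℚ n ℚ.* nℚ E) (*-monoʳ (subst (ℚ.0ℚ ℚ.≤_) (nℚ-* n C₁) (0≤nℚ (n * C₁))) 1≤rE)) ⟩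
  nℚ n ℚ.* nℚ E ℚ.+ nℚ n ℚ.* nℚ C₁ ℚ.* (r ℚ.* nℚ E) ℚ.+ nℚ C₂ ℚ.* nℚ δ ℚ.* nℚ E
                                               ≡⟨ lem (nℚ n) (nℚ E) (nℚ C₁) r (nℚ C₂) (nℚ δ) ⟩
  (nℚ n ℚ.* (ℚ.1ℚ ℚ.+ nℚ C₁ ℚ.* r) ℚ.+ nℚ C₂ ℚ.* nℚ δ) ℚ.* nℚ E ∎)
  where
  open ℚ.≤-Reasoning
  open ℚSolver.+-*-Solver
  expand : nℚ (n * E + n * C₁ + C₂ * δ * E) ≡ nℚ n ℚ.* nℚ E ℚ.+ nℚ n ℚ.* nℚ C₁ ℚ.+ nℚ C₂ ℚ.* nℚ δ ℚ.* nℚ E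
  expand = trans (nℚ-+ (n * E + n * C₁) (C₂ * δ * E)) (cong₂ ℚ._+_ (trans (nℚ-+ (n * E) (n * C₁)) (cong₂ ℚ._+_ (nℚ-* n E) (nℚ-* n C₁)))
    (trans (nℚ-* (C₂ * δ) E) (cong (ℚ._* nℚ E) (nℚ-* C₂ δ))))
  lem : ∀ n E C r c d → n ℚ.* E ℚ.+ n ℚ.* C ℚ.* (r ℚ.* E) ℚ.+ c ℚ.* d ℚ.* E ≡ (n ℚ.* (ℚ.1ℚ ℚ.+ C ℚ.* r) ℚ.+ c ℚ.* d) ℚ.* E
  lem = solve 6 (λ n E C r c d → n :* E :+ n :* C :* (r :* E) :+ c :* d :* E := (n :* (con ℚ.1ℚ :+ C :* r) :+ c :* d) :* E) refl

-- The constants for a given exponent, and the division into small and large degree.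

module Constants (a b : ℕ) (0<a : 0 < a) (4a<b : 4 * a < b) where

  abstract
    -- With `H = C M²` and `g = 648 M`, the condition `4320 g M ≤ H` holds for this `C`.
    C : ℕ
    C = 4320 * 648

    C-large : 4320 * 648 ≤ C
    C-large = ≤-refl

    C-positive : 0 < C
    C-positive = s≤s z≤n

  0<b : 0 < b
  0<b = ≤-trans (s≤s z≤n) 4a<b

  0<c : 0 < 768 * (C * C)
  0<c = *-mono-< {0} {768} (s≤s z≤n) (*-mono-< C-positive C-positive)

  instance
    c-nonZero : NonZero (768 * (C * C))
    c-nonZero = >-nonZero 0<c

  abstract
    K : ℕ
    K = 8 * (411 * (28 * C) * C * 8) * 2 ^ (3 * b)

    K≡ : K ≡ 8 * (411 * (28 * C) * C * 8) * 2 ^ (3 * b)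
    K≡ = refl

  abstract
    m₁ : ℕ
    -- The exponent collects `M²` from `H`, `M³` from the number of levels and `m ^ (3 b)` from
    -- `(1 + δ)³`.
    m₁ = proj₁ (exponential-dominates K (a + a + (a + a + a) + 3 * b) (768 * (C * C)) 0<c) + 16

    m₁-large : ∀ m → m₁ ≤ m → K * m ^ (a + a + (a + a + a) + 3 * b) ≤ 2 ^ (m / (768 * (C * C)))
    m₁-large m h = proj₂ (exponential-dominates K (a + a + (a + a + a) + 3 * b) (768 * (C * C)) 0<c) m (≤-trans (m≤m+n _ 16) h)

    16≤m₁ : 16 ≤ m₁
    16≤m₁ = m≤n+m 16 _

  module Root (δ m : ℕ) (m₁≤m : m₁ ≤ m) (lo : m ^ b ≤ δ) (hi : δ < suc m ^ b) where
    M H : ℕ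
    M = m ^ a
    H = C * (M * M)

    16≤m : 16 ≤ m
    16≤m = ≤-trans 16≤m₁ m₁≤m

    0<m : 0 < m
    0<m = ≤-trans (s≤s z≤n) 16≤m

    instance
      m-nonZero : NonZero m
      m-nonZero = >-nonZero 0<m

    16≤M : 16 ≤ M
    16≤M = ≤-trans 16≤m (≤-trans (≤-reflexive (sym (*-identityʳ m))) (^-monoʳ-≤ m 0<a))

    0<M : 0 < M
    0<M = ≤-trans (s≤s z≤n) 16≤M

    0<H : 0 < H
    0<H = *-mono-< C-positive (*-mono-< 0<M 0<M)

    instance
      c₀-nonZero : NonZero (768 * (H * H))
      c₀-nonZero = >-nonZero (*-mono-< {0} {768} (s≤s z≤n) (*-mono-< 0<H 0<H))

    -- `H²` is `C² m ^ (4 a)`, and `suc (4 a) ≤ b` leaves one factor `m` of `δ ≥ m ^ b`. This is the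
    -- quantitative form of `ε < 1/4`.
    exponent : m / (768 * (C * C)) ≤ δ / (768 * (H * H))
    exponent = ≤-quotient (768 * (H * H)) (begin
      m / (768 * (C * C)) * (768 * (H * H))                 ≡⟨ lem (m / (768 * (C * C))) C M ⟩
      m / (768 * (C * C)) * (768 * (C * C)) * (M * M * (M * M)) ≤⟨ *-monoˡ-≤ (M * M * (M * M)) (m/n*n≤m m (768 * (C * C))) ⟩
      m * (M * M * (M * M))                                  ≡⟨ cong (m *_) powers ⟩
      m ^ suc (4 * a)                                        ≤⟨ ^-monoʳ-≤ m 4a<b ⟩
      m ^ b                                                  ≤⟨ lo ⟩
      δ                                                      ∎)
      where
      open ≤-Reasoning
      lem : ∀ x C M → x * (768 * (C * (M * M) * (C * (M * M)))) ≡ x * (768 * (C * C)) * (M * M * (M * M))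
      lem = solve-∀
      powers : M * M * (M * M) ≡ m ^ (4 * a)
      powers = trans (cong₂ _*_ (sym (^-distribˡ-+-* m a a)) (sym (^-distribˡ-+-* m a a))) (trans (sym (^-distribˡ-+-* m (a + a) (a + a))) (cong (m ^_) (lem₂ a)))
        where
        lem₂ : ∀ a → a + a + (a + a) ≡ 4 * a
        lem₂ = solve-∀

    δ-upper : 1 + δ ≤ (2 * m) ^ b
    δ-upper = ≤-trans hi (^-monoˡ-≤ b (≤-trans (+-monoˡ-≤ m 0<m) (≤-reflexive (cong (m +_) (sym (+-identityʳ m))))))

    cube : (1 + δ) * (1 + δ) * (1 + δ) ≤ 2 ^ (3 * b) * m ^ (3 * b)
    cube = ≤-trans (*-mono-≤ (*-mono-≤ δ-upper δ-upper) δ-upper) (≤-reflexive (trans (cong₂ _*_ (sym (^-distribˡ-+-* (2 * m) b b)) refl)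
      (trans (sym (^-distribˡ-+-* (2 * m) (b + b) b)) (trans (cong ((2 * m) ^_) (lem b)) (^-distribʳ-* (3 * b) 2 m)))))
      where
      lem : ∀ b → b + b + b ≡ 3 * b
      lem = solve-∀

    levels : 12 * H * M * 2 + 4 ≤ 28 * C * (M * M * M)
    levels = ≤-trans (+-monoʳ-≤ (12 * H * M * 2) (*-monoʳ-≤ 4 (*-mono-≤ C-positive (*-mono-≤ (*-mono-≤ 0<M 0<M) 0<M)))) (≤-reflexive (lem C M))
      where
      lem : ∀ C M → 12 * (C * (M * M)) * M * 2 + 4 * (C * (M * M * M)) ≡ 28 * C * (M * M * M)
      lem = solve-∀

    large : 8 * (411 * (12 * H * M * 2 + 4) * H * (8 * ((1 + δ) * (1 + δ) * (1 + δ)))) ≤ 2 ^ (δ / (768 * (H * H)))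
    large = begin
      8 * (411 * (12 * H * M * 2 + 4) * H * (8 * ((1 + δ) * (1 + δ) * (1 + δ))))
        ≤⟨ *-monoʳ-≤ 8 (*-mono-≤ (*-monoˡ-≤ H (*-monoʳ-≤ 411 levels)) (*-monoʳ-≤ 8 cube)) ⟩
      8 * (411 * (28 * C * (M * M * M)) * H * (8 * (2 ^ (3 * b) * m ^ (3 * b))))
        ≡⟨ lem C M (2 ^ (3 * b)) (m ^ (3 * b)) ⟩
      8 * (411 * (28 * C) * C * 8) * 2 ^ (3 * b) * ((M * M) * (M * M * M) * m ^ (3 * b))
        ≡⟨ cong₂ _*_ (sym K≡) powers ⟩
      K * m ^ (a + a + (a + a + a) + 3 * b)
        ≤⟨ m₁-large m m₁≤m ⟩
      2 ^ (m / (768 * (C * C)))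
        ≤⟨ ^-monoʳ-≤ 2 exponent ⟩
      2 ^ (δ / (768 * (H * H))) ∎
      where
      open ≤-Reasoning
      lem : ∀ C M x y → 8 * (411 * (28 * C * (M * M * M)) * (C * (M * M)) * (8 * (x * y)))
        ≡ 8 * (411 * (28 * C) * C * 8) * x * ((M * M) * (M * M * M) * y)
      lem = solve-∀
      powers : (M * M) * (M * M * M) * m ^ (3 * b) ≡ m ^ (a + a + (a + a + a) + 3 * b)
      powers = trans (cong (_* m ^ (3 * b)) (trans (cong₂ _*_ (sym (^-distribˡ-+-* m a a)) (trans (cong (_* M) (sym (^-distribˡ-+-* m a a))) (sym (^-distribˡ-+-* m (a + a) a))))
        (sym (^-distribˡ-+-* m (a + a) (a + a + a))))) (sym (^-distribˡ-+-* m (a + a + (a + a + a)) (3 * b)))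

    reservoir : 4320 * (648 * M * M) ≤ H
    reservoir = ≤-trans (≤-reflexive (lem 4320 648 M)) (*-monoˡ-≤ (M * M) C-large)
      where
      lem : ∀ x y M → x * (y * M * M) ≡ x * y * (M * M)
      lem = solve-∀

    squares : M * M ≤ H
    squares = ≤-trans (≤-reflexive (sym (*-identityˡ (M * M)))) (*-monoˡ-≤ (M * M) C-positive)

    module _ {n : ℕ} (G : Graph n) (v₀ : Fin n) (δ≤deg : ∀ v → δ ≤ degree G v) where

      private
        module LD = LargeDegree G δ M (M ∸ 16) (648 * M) H (H ∸ 1) (sym (m+[n∸m]≡n 16≤M)) (sym (m+[n∸m]≡n 0<H)) v₀ δ≤deg
          squares ≤-refl reservoir large

      irregular-optimal : Σ ℕ λ k → 0 < k × Irregular G k × δ * k * M ≤ n * (M + 16) + 85 * (δ * M)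
      irregular-optimal = 1 + 3 * LD.s , s≤s z≤n , LD.irregular-large , LD.strength-large

  -- Errors are measured against `(2 m) ^ a`, since `δ < (m + 1) ^ b ≤ (2 m) ^ b`. For large degree
  -- `16 / M` becomes `16 * 2 ^ a / (2 m) ^ a`, the first summand. The second pays for the `18 n` in
  -- the linear strength `18 n + 22` when `δ < Δ`.
  Δ C₁ : ℕ
  Δ = m₁ ^ b
  C₁ = 16 * 2 ^ a + 18 * Δ * (2 * m₁) ^ a

  0<m₁ : 0 < m₁
  0<m₁ = ≤-trans (s≤s z≤n) 16≤m₁

  0<C₁ : 0 < C₁
  0<C₁ = ≤-trans (*-mono-≤ {1} {16} {1} (s≤s z≤n) (m^n>0 2 a)) (m≤m+n _ _)

  module _ {n : ℕ} (G : Graph n) (δ : ℕ) (minimum : IsMinDegree G δ) (0<δ : 0 < δ) (no-edge : NoIsolatedEdge G) where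

    Goal : Set
    Goal = ∃[ k ] (0 < k) × Irregular G k × Bound n δ a b (nℚ C₁) (nℚ 85) k

    δ≤deg : ∀ v → δ ≤ degree G v
    δ≤deg v = subst (δ ≤_) (deg≡degree G v) (proj₁ minimum v)

    bound-by : ∀ E₀ k → 0 < E₀ → δ ≤ E₀ ^ b → 0 < k → Irregular G k → δ * k * E₀ ^ a ≤ n * E₀ ^ a + n * C₁ + 85 * δ * E₀ ^ a → Goal
    bound-by E₀ k 0<E₀ hδ 0<k irr h = k , 0<k , irr ,
      λ r hr → rational-bound n δ k C₁ 85 (E₀ ^ a) r (m^n>0 E₀ {{>-nonZero 0<E₀}} a) h (negative-power {δ} {a} {b} {E₀} 0<b hδ hr)

    small-degree : δ < Δ → Goal
    small-degree δ<Δ = bound-by (2 * m₁) (1 + 3 * (6 * n + 7)) (*-mono-< {0} {2} (s≤s z≤n) 0<m₁)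
      (≤-trans (<⇒≤ δ<Δ) (^-monoˡ-≤ b (m≤m+n m₁ _))) (s≤s z≤n)
      (irregular-linear G (λ v → <-≤-trans 0<δ (δ≤deg v)) no-edge)
      (≤-cancel-cert (n * E + n * (16 * 2 ^ a) + 63 * δ * E) (*-monoˡ-≤ (18 * n * E) (<⇒≤ δ<Δ)) (lem n δ E Δ (16 * 2 ^ a)))
      where
      E = (2 * m₁) ^ a
      lem : ∀ n δ E Δ z → δ * (1 + 3 * (6 * n + 7)) * E + Δ * (18 * n * E) + (n * E + n * z + 63 * δ * E)
        ≡ n * E + n * (z + 18 * Δ * E) + 85 * δ * E + δ * (18 * n * E)
      lem = solve-∀

    large-degree : ∀ m → m₁ ≤ m → m ^ b ≤ δ → δ < suc m ^ b → Goal
    large-degree m m₁≤m lo hi = finish (R.irregular-optimal G (proj₁ (proj₂ minimum)) δ≤deg)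
      where
      module R = Root δ m m₁≤m lo hi
      finish : (Σ ℕ λ k → 0 < k × Irregular G k × δ * k * m ^ a ≤ n * (m ^ a + 16) + 85 * (δ * m ^ a)) → Goal
      finish (k , 0<k , irr , h) = bound-by (2 * m) k (*-mono-< {0} {2} (s≤s z≤n) R.0<m) (≤-trans (n≤1+n δ) R.δ-upper) 0<k irr
        (subst (λ E → δ * k * E ≤ n * E + n * C₁ + 85 * δ * E) (sym (^-distribʳ-* a 2 m))
          (≤-cancel-cert (n * (18 * Δ * (2 * m₁) ^ a)) (*-monoʳ-≤ (2 ^ a) h) (lem₂ n δ k (2 ^ a) (m ^ a) (18 * Δ * (2 * m₁) ^ a))))
        where
        lem₂ : ∀ n δ k x M z → δ * k * (x * M) + x * (n * (M + 16) + 85 * (δ * M)) + n * z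
          ≡ n * (x * M) + n * (16 * x + z) + 85 * δ * (x * M) + x * (δ * k * M)
        lem₂ = solve-∀

    bounded-strength : Goal
    bounded-strength = by (integer-root b 0<b δ)
      where
      by : (Σ ℕ λ m → m ^ b ≤ δ × δ < suc m ^ b) → Goal
      by (m , lo , hi) = split (m₁ ≤? m)
        where
        split : Dec (m₁ ≤ m) → Goal
        split (yes h) = large-degree m h lo hi
        split (no h)  = small-degree (<-≤-trans hi (^-monoˡ-≤ b (≰⇒> h)))

theorem2 : ∀ (p q : ℕ) → 0 < p → 4 * p < q →
    Σ ℚ λ C₁ → Σ ℚ λ C₂ → (0ℚ <ℚ C₁) × (0ℚ <ℚ C₂) ×
    (∀ (n : ℕ) (G : Graph n) (δ : ℕ) → IsMinDegree G δ → 0 < δ → NoIsolatedEdge G →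
    ∃[ k ] (0 < k) × Irregular G k × Bound n δ p q C₁ C₂ k)
theorem2 p q 0<p 4p<q = nℚ C₁ , nℚ 85 , 0<nℚ 0<C₁ , 0<nℚ {85} (s≤s z≤n) ,
  λ n G δ minimum 0<δ no-edge → bounded-strength G δ minimum 0<δ no-edge
  where open Constants p q 0<p 4p<q
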